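{- Let $K$ be an infinite field, $\mathsf{M}$ a matroid on $[n]$ without loops, $E=K\langle e_1,\dots,e_n\rangle$ and $J$ the Orlik–Solomon ideal of $\mathsf{M}$. Then $\operatorname{depth}E/J=1$ if and only if $\beta(\mathsf{M})\neq0$.
   Context: A matroid on $[n]$ is a nonempty family of subsets of $[n]$ (independent sets) containing $\emptyset$, closed under subsets, satisfying the exchange axiom; other subsets are dependent; a loop is an $i$ with $\{i\}$ dependent. The rank $r(X)$ of $X\subseteq[n]$ is the maximal size of an independent subset of $X$, and $r(\mathsf{M})=r([n])$. The beta-invariant is $\beta(\mathsf{M})=(-1)^{r(\mathsf{M})}\sum_{S\subseteq[n]}(-1)^{|S|}r(S)$. $E$ is the standard graded exterior algebra; for $S=\{i_0<\dots<i_m\}$, $e_S=e_{i_0}\wedge\dots\wedge e_{i_m}$ and $\partial e_S=\sum_{j=0}^m(-1)^je_{S\setminus\{i_j\}}$; the Orlik–Solomon ideal is $J=(\partial e_S:S\text{ dependent})$. For a graded module $N$, $v\in E_1$ is $N$-regular if $0:_Nv=vN$; a sequence $v_1,\dots,v_s\in E_1$ is $N$-regular if $v_i$ is $N/(v_1,\dots,v_{i-1})N$-regular for each $i$ and $N/(v_1,\dots,v_s)N\neq0$; $\operatorname{depth}N$ is the common length of maximal $N$-regular sequences. -}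

module Defs where

open import Level using (Level; _⊔_)
import Data.Bool
open import Data.Bool using (Bool; true; false; _∧_; _∨_; not; if_then_else_)
open import Data.Nat as ℕ using (ℕ; zero; suc; _<_; _<ᵇ_)
open import Data.Fin using (Fin; toℕ)
open import Data.List as List using (List; []; _∷_; _++_; [_]; length; lookup; foldr; allFin)
open import Data.Vec using (Vec; []; _∷_)
import Data.Vec as Vec
open import Data.Fin.Subset using (Subset; _∈_; _∉_; _⊆_; _∪_; ⁅_⁆; ∣_∣; inside; outside)
import Data.Fin.Subset as Sub
open import Data.Integer as ℤ using (ℤ)
open import Data.Product using (Σ; ∃; _×_; _,_)
open import Relation.Binary.PropositionalEquality using (_≡_)
open import Relation.Nullary using (¬_)
open import Algebra.Bundles using (CommutativeRing)

allSubsets : (n : ℕ) → List (Subset n)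
allSubsets zero    = [] ∷ []
allSubsets (suc n) = List.map (inside ∷_) (allSubsets n) ++ List.map (outside ∷_) (allSubsets n)

memᵇ : ∀ {n} → Subset n → Fin n → Bool
memᵇ S i = Vec.lookup S i

⊆ᵇ : ∀ {n} → Subset n → Subset n → Bool
⊆ᵇ [] [] = true
⊆ᵇ (a ∷ S) (b ∷ T) = (not a ∨ b) ∧ ⊆ᵇ S T

≡ᵇ : ∀ {n} → Subset n → Subset n → Bool
≡ᵇ S T = ⊆ᵇ S T ∧ ⊆ᵇ T S

disjointᵇ : ∀ {n} → Subset n → Subset n → Bool
disjointᵇ [] [] = true
disjointᵇ (a ∷ S) (b ∷ T) = not (a ∧ b) ∧ disjointᵇ S T

countᵇ : {A : Set} → List A → (A → Bool) → ℕ
countᵇ xs p = foldr (λ x k → if p x then suc k else k) 0 xs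

record Matroid (n : ℕ) : Set where
  field
    indep      : Subset n → Bool
    indep-∅    : indep Sub.⊥ ≡ true
    indep-down : ∀ X Y → Y ⊆ X → indep X ≡ true → indep Y ≡ true
    exchange   : ∀ X Y → indep X ≡ true → indep Y ≡ true → ∣ X ∣ < ∣ Y ∣ →
                 ∃ λ j → j ∈ Y × j ∉ X × indep (X ∪ ⁅ j ⁆) ≡ true

open Matroid public

Dependent : ∀ {n} → Matroid n → Subset n → Set
Dependent M S = indep M S ≡ false

Loopless : ∀ {n} → Matroid n → Set
Loopless {n} M = ∀ (i : Fin n) → indep M ⁅ i ⁆ ≡ true

rank : ∀ {n} → Matroid n → Subset n → ℕ
rank {n} M X = foldr (λ Y k → if ⊆ᵇ Y X ∧ indep M Y then ∣ Y ∣ ℕ.⊔ k else k) 0 (allSubsets n)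

signℤ : ℕ → ℤ
signℤ zero    = ℤ.+ 1
signℤ (suc k) = ℤ.- signℤ k

β : ∀ {n} → Matroid n → ℤ
β {n} M = signℤ (rank M Sub.⊤) ℤ.* foldr (λ S z → signℤ ∣ S ∣ ℤ.* ℤ.+ (rank M S) ℤ.+ z) (ℤ.+ 0) (allSubsets n)

module _ {c ℓ : Level} (K : CommutativeRing c ℓ) where
  open CommutativeRing K

  IsField : Set (c ⊔ ℓ)
  IsField = (¬ (0# ≈ 1#)) × (∀ x → ¬ (x ≈ 0#) → ∃ λ y → x * y ≈ 1#)

  Infinite : Set (c ⊔ ℓ)
  Infinite = Σ (ℕ → Carrier) λ f → ∀ m k → f m ≈ f k → m ≡ k

-- The exterior algebra E = K⟨e_1,…,e_n⟩, an element being its coordinate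
-- vector w.r.t. the basis (e_S)_{S ⊆ [n]}.

module Exterior {c ℓ : Level} (K : CommutativeRing c ℓ) (n : ℕ) where
  open CommutativeRing K

  E : Set c
  E = Subset n → Carrier

  infix 4 _≈E_
  _≈E_ : E → E → Set ℓ
  x ≈E y = ∀ U → x U ≈ y U

  sumL : {A : Set} → List A → (A → Carrier) → Carrier
  sumL xs f = foldr (λ a r → f a + r) 0# xs

  negpow : ℕ → Carrier
  negpow zero    = 1#
  negpow (suc k) = - negpow k

  [_]· : Bool → Carrier → Carrier
  [ b ]· a = if b then a else 0#

  zeroE : E
  zeroE U = 0#

  _+E_ : E → E → E
  (x +E y) U = x U + y U

  _-E_ : E → E → E
  (x -E y) U = x U + (- y U)

  e : Subset n → E
  e S U = [ ≡ᵇ S U ]· 1#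

  -- number of pairs (s,t), s ∈ S, t ∈ T, t < s: the sign of e_S ∧ e_T = ± e_{S∪T}
  inversions : Subset n → Subset n → ℕ
  inversions S T =
    foldr (λ s k → (if memᵇ S s then countᵇ (allFin n) (λ t → memᵇ T t ∧ (toℕ t <ᵇ toℕ s)) else 0) ℕ.+ k)
          0 (allFin n)

  infixr 7 _∧E_
  _∧E_ : E → E → E
  (x ∧E y) U = sumL (allSubsets n) λ S → sumL (allSubsets n) λ T →
    [ disjointᵇ S T ∧ ≡ᵇ (S ∪ T) U ]· (negpow (inversions S T) * (x S * y T))

  -- ∂ e_S = Σ_j (-1)^j e_{S \ {i_j}}  where S = {i_0 < … < i_m}; here j = #{s ∈ S : s < i}
  ∂e : Subset n → E
  ∂e S = λ U → sumL (allFin n) λ i →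
    [ memᵇ S i ∧ ≡ᵇ (S Sub.- i) U ]· (negpow (countᵇ (allFin n) (λ s → memᵇ S s ∧ (toℕ s <ᵇ toℕ i))))

  E₁ : Set c
  E₁ = Fin n → Carrier

  lin : E₁ → E
  lin v U = sumL (allFin n) λ i → [ ≡ᵇ ⁅ i ⁆ U ]· (v i)

  InIdeal : List E → E → Set (c ⊔ ℓ)
  InIdeal gs x = Σ (List (E × Fin (length gs) × E)) λ ts →
    x ≈E foldr (λ { (a , k , b) r → (a ∧E (lookup gs k ∧E b)) +E r }) zeroE ts

  NonzeroQuot : List E → Set (c ⊔ ℓ)
  NonzeroQuot gs = ∃ λ x → ¬ InIdeal gs x

  -- v is (E/I)-regular:  0 :_{E/I} v  =  v (E/I)   (both inclusions, on representatives)
  Regular : List E → E → Set (c ⊔ ℓ)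
  Regular gs v =
    (∀ x → InIdeal gs (v ∧E x) → ∃ λ y → InIdeal gs (x -E (v ∧E y)))
    × (∀ y → InIdeal gs (v ∧E (v ∧E y)))

  -- v₁,…,v_s is (E/I)-regular; note (E/I)/(v₁,…,v_{i-1})(E/I) = E/(I + (v₁,…,v_{i-1}))
  RegSeq : List E → List E₁ → Set (c ⊔ ℓ)
  RegSeq gs []       = NonzeroQuot gs
  RegSeq gs (v ∷ vs) = Regular gs (lin v) × RegSeq (gs ++ [ lin v ]) vs

  MaximalRegSeq : List E → List E₁ → Set (c ⊔ ℓ)
  MaximalRegSeq gs vs = RegSeq gs vs × (∀ v → ¬ RegSeq gs (vs ++ [ v ]))

  DepthQuot : List E → ℕ → Set (c ⊔ ℓ)
  DepthQuot gs d = (∃ λ vs → MaximalRegSeq gs vs × length vs ≡ d)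
                 × (∀ vs → MaximalRegSeq gs vs → length vs ≡ d)

  OSgens : Matroid n → List E
  OSgens M = List.map ∂e (List.filter (λ S → Data.Bool._≟_ (indep M S) false) (allSubsets n))

module Submission where

-- Multiplication by v is regular on E/J as soon as some contraction D w with w(v) = 1 preserves J.  Taking w = (1,…,1)
-- shows that e₁ is always regular, so the depth is at least 1 when n > 0.
-- If β(M) = 0 then, by Crapo's theorem, M splits as X ⊔ Y; the contractions by 1 and by the indicator of Y show that
-- e_i, e_j is a regular sequence for i ∈ X, j ∈ Y.  Regular sequences have length at most n, because v₁ ⋯ v_s does not
-- annihilate E/J, so this one extends to a maximal one of length at least 2.
-- Conversely, a regular sequence v₁, v₂ makes E/J free over the exterior algebra on v₁, v₂, so its Hilbert series is
-- divisible by (1 + t)².  As E/J has the nbc monomials as a basis, deletion and contraction show that the derivative of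
-- the Hilbert series at t = -1 is β(M) up to sign, hence β(M) = 0.
-- The nbc basis rests on the injectivity of E/J(M \ e) → E/J(M), proved by induction on the degree from the grading of J
-- by flats and the homotopy x = ∂ (e_i x) + e_i ∂ x.

open import Algebra.Bundles using (CommutativeRing)
open import Data.Bool as Bool using (Bool; true; false; _∧_; _∨_; not; if_then_else_)
open import Data.Fin using (Fin; zero; suc)
open import Data.Fin.Subset using (Subset; ∣_∣; inside; outside)
open import Data.List as List using (List; []; _∷_)
open import Data.List.Relation.Unary.Any using (here; there)
open import Data.Nat as ℕ using (ℕ; zero; suc)
open import Data.Product using (∃; ∃₂; _×_; _,_; proj₁; proj₂)
open import Data.Sum using (_⊎_; inj₁; inj₂; [_,_]′)
open import Data.Vec using ([]; _∷_; here; there)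
open import Function using (_∘_; id; case_of_)
open import Level using (Level)
open import Relation.Nullary using (¬_; Dec; yes; no; does; contradiction)
import Data.Integer.Properties as ℤₚ
import Data.Nat.Properties as ℕₚ
import Relation.Binary.PropositionalEquality as ≡
open ≡ using (_≡_; _≢_)

-- Equality in K is not assumed decidable, so solutions of linear systems and bases of quotients are
-- obtained only under a double negation. Nothing is lost: what is extracted from them, an
-- inequality of dimensions in ℕ and β = 0 in ℤ, is decidable and hence stable. Two changes of
-- encoding carry the proof. The exterior product given by a double sum with inversion signs is
-- replaced by a recursion on element 0, so that deletion and contraction of 0 become the lower and
-- upper half of a coordinate vector. The ideal given by lists of products is replaced by vectors p
-- + ∂ q with p, q supported on dependent sets, so that membership is argued coordinate by
-- coordinate. The grading by flats enters because e_i x is supported on dependent sets once i lies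
-- in the closure of every monomial of x; a general x has no such i, but a piece belonging to one
-- nonempty flat does. Crapo's theorem is proved together with β ≥ 0: in β(M) = β(deletion) +
-- β(contraction) a zero sum then forces both summands to vanish, and the separations of the two
-- minors are combined into one of M.

-- Ring solver with integer coefficients.

module RingSolver where
  open import Algebra.Solver.Ring.AlmostCommutativeRing using (AlmostCommutativeRing; fromCommutativeRing; _-Raw-AlmostCommutative⟶_)
  import Algebra.Solver.Ring
  import Algebra.Properties.Semiring.Mult
  import Algebra.Properties.Ring
  open import Data.Integer as ℤ using (ℤ; +_; -[1+_]; _⊖_)
  open import Data.Maybe using (Maybe; just; nothing)
  import Relation.Binary.Reasoning.Setoid

  -- Integer coefficients let the solver recognise cancellations such as a - a = 0, which abstract coefficients in K would not.
  module IntegerSolver {c ℓ} (K : CommutativeRing c ℓ) where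
    open CommutativeRing K
    open Algebra.Properties.Semiring.Mult semiring using (×-homo-+; ×1-homo-*) renaming (_×_ to _·_)
    open Algebra.Properties.Ring ring using (-0#≈0#; -‿distribˡ-*; -‿distribʳ-*; -‿involutive; -‿+-comm)
    open Relation.Binary.Reasoning.Setoid setoid

    fromℤ : ℤ → Carrier
    fromℤ (+ n)      = n · 1#
    fromℤ (-[1+ n ]) = - (suc n · 1#)

    fromℤ-neg : ∀ z → fromℤ (ℤ.- z) ≈ - fromℤ z
    fromℤ-neg (+ zero)    = sym -0#≈0#
    fromℤ-neg (+ (suc n)) = refl
    fromℤ-neg (-[1+ n ])  = sym (-‿involutive _)

    fromℤ-⊖ : ∀ m n → fromℤ (m ⊖ n) ≈ m · 1# + - (n · 1#)
    fromℤ-⊖ zero    zero    = trans (sym (-‿inverseʳ 0#)) refl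
    fromℤ-⊖ zero    (suc n) = sym (+-identityˡ _)
    fromℤ-⊖ (suc m) zero    = trans (sym (+-identityʳ _)) (+-congˡ (sym -0#≈0#))
    fromℤ-⊖ (suc m) (suc n) = begin
      fromℤ (suc m ⊖ suc n)                            ≡⟨ ≡.cong fromℤ (ℤₚ.[1+m]⊖[1+n]≡m⊖n m n) ⟩
      fromℤ (m ⊖ n)                                    ≈⟨ fromℤ-⊖ m n ⟩
      m · 1# + - (n · 1#)                              ≈⟨ +-congʳ (+-identityʳ _) ⟨
      (m · 1# + 0#) + - (n · 1#)                       ≈⟨ +-congʳ (+-congˡ (-‿inverseʳ 1#)) ⟨
      (m · 1# + (1# + - 1#)) + - (n · 1#)              ≈⟨ +-congʳ (trans (sym (+-assoc _ _ _)) (+-congʳ (+-comm _ _))) ⟩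
      ((1# + m · 1#) + - 1#) + - (n · 1#)              ≈⟨ +-assoc _ _ _ ⟩
      (1# + m · 1#) + (- 1# + - (n · 1#))              ≈⟨ +-congˡ (-‿+-comm _ _) ⟩
      (1# + m · 1#) + - (1# + n · 1#)                  ∎

    fromℤ-+ : ∀ x y → fromℤ (x ℤ.+ y) ≈ fromℤ x + fromℤ y
    fromℤ-+ (+ m)      (+ n)      = ×-homo-+ 1# m n
    fromℤ-+ (+ m)      (-[1+ n ]) = fromℤ-⊖ m (suc n)
    fromℤ-+ (-[1+ m ]) (+ n)      = trans (fromℤ-⊖ n (suc m)) (+-comm _ _)
    fromℤ-+ (-[1+ m ]) (-[1+ n ]) = begin
      - ((2 ℕ.+ (m ℕ.+ n)) · 1#)          ≡⟨ ≡.cong (λ k → - (suc k · 1#)) (≡.sym (ℕₚ.+-suc m n)) ⟩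
      - ((suc m ℕ.+ suc n) · 1#)          ≈⟨ -‿cong (×-homo-+ 1# (suc m) (suc n)) ⟩
      - (suc m · 1# + suc n · 1#)         ≈⟨ -‿+-comm _ _ ⟨
      - (suc m · 1#) + - (suc n · 1#)     ∎

    fromℤ-* : ∀ x y → fromℤ (x ℤ.* y) ≈ fromℤ x * fromℤ y
    fromℤ-* (+ m) (+ n) = trans (reflexive (≡.cong fromℤ (≡.sym (ℤₚ.pos-* m n)))) (×1-homo-* m n)
    fromℤ-* (+ m) (-[1+ n ]) = begin
      fromℤ (+ m ℤ.* -[1+ n ])           ≡⟨ ≡.cong fromℤ (ℤₚ.neg-distribʳ-* (+ m) (+ suc n)) ⟨
      fromℤ (ℤ.- (+ m ℤ.* + suc n))      ≈⟨ fromℤ-neg (+ m ℤ.* + suc n) ⟩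
      - fromℤ (+ m ℤ.* + suc n)          ≈⟨ -‿cong (fromℤ-* (+ m) (+ suc n)) ⟩
      - (m · 1# * (suc n · 1#))          ≈⟨ -‿distribʳ-* _ _ ⟩
      m · 1# * - (suc n · 1#)            ∎
    fromℤ-* (-[1+ m ]) (+ n) = begin
      fromℤ (-[1+ m ] ℤ.* + n)           ≡⟨ ≡.cong fromℤ (ℤₚ.neg-distribˡ-* (+ suc m) (+ n)) ⟨
      fromℤ (ℤ.- (+ suc m ℤ.* + n))      ≈⟨ fromℤ-neg (+ suc m ℤ.* + n) ⟩
      - fromℤ (+ suc m ℤ.* + n)          ≈⟨ -‿cong (fromℤ-* (+ suc m) (+ n)) ⟩
      - (suc m · 1# * (n · 1#))          ≈⟨ -‿distribˡ-* _ _ ⟩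
      - (suc m · 1#) * (n · 1#)          ∎
    fromℤ-* (-[1+ m ]) (-[1+ n ]) = begin
      fromℤ (+ suc m ℤ.* + suc n)                ≈⟨ fromℤ-* (+ suc m) (+ suc n) ⟩
      suc m · 1# * (suc n · 1#)                  ≈⟨ -‿involutive _ ⟨
      - - (suc m · 1# * (suc n · 1#))            ≈⟨ -‿cong (-‿distribˡ-* _ _) ⟩
      - (- (suc m · 1#) * (suc n · 1#))          ≈⟨ -‿distribʳ-* _ _ ⟩
      - (suc m · 1#) * - (suc n · 1#)            ∎

    almost : AlmostCommutativeRing c ℓ
    almost = fromCommutativeRing K

    morphism : CommutativeRing.rawRing ℤₚ.+-*-commutativeRing -Raw-AlmostCommutative⟶ almost
    morphism = record
      { ⟦_⟧ = fromℤ ; +-homo = fromℤ-+ ; *-homo = fromℤ-* ; -‿homo = fromℤ-neg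
      ; 0-homo = refl ; 1-homo = +-identityʳ 1# }

    fromℤ-≟ : ∀ x y → Maybe (fromℤ x ≈ fromℤ y)
    fromℤ-≟ x y with x ℤ.≟ y
    ... | yes ≡.refl = just refl
    ... | no _       = nothing

    open Algebra.Solver.Ring (CommutativeRing.rawRing ℤₚ.+-*-commutativeRing) almost morphism fromℤ-≟ public
      using (solve; _:=_; _:+_; _:*_; :-_; _:-_; con; Polynomial)

    :0 : ∀ {n} → Polynomial n
    :0 = con (+ 0)

-- Rank function, submodularity, deletion and contraction of element 0.

module MatroidRank where
  open import Defs
  open import Data.Nat using (_+_; _⊔_; _≤_; _<_; s≤s)
  open import Data.Nat.Properties
  open import Data.Fin.Subset using (_∈_; _∉_; _⊆_; _∪_; _∩_; ⁅_⁆; ⊥)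
  open import Data.Fin.Subset.Properties
  open import Data.List using (foldr)
  import Data.List.Membership.Propositional as L
  open import Data.List.Membership.Propositional.Properties using (∈-map⁺; ∈-++⁺ˡ; ∈-++⁺ʳ)
  open import Data.Empty using (⊥-elim)
  open import Relation.Binary.PropositionalEquality

  ∈-allSubsets : ∀ {n} (S : Subset n) → S L.∈ allSubsets n
  ∈-allSubsets []            = here refl
  ∈-allSubsets (inside ∷ S)  = ∈-++⁺ˡ (∈-map⁺ (inside ∷_) (∈-allSubsets S))
  ∈-allSubsets (outside ∷ S) = ∈-++⁺ʳ _ (∈-map⁺ (outside ∷_) (∈-allSubsets S))

  ⊆ᵇ⇒⊆ : ∀ {n} (S T : Subset n) → ⊆ᵇ S T ≡ true → S ⊆ T
  ⊆ᵇ⇒⊆ (outside ∷ S) (b ∷ T)      eq = out⊆ (⊆ᵇ⇒⊆ S T eq)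
  ⊆ᵇ⇒⊆ (inside ∷ S)  (inside ∷ T) eq = in⊆in (⊆ᵇ⇒⊆ S T eq)
  ⊆ᵇ⇒⊆ []            []           eq = id

  ⊆⇒⊆ᵇ : ∀ {n} (S T : Subset n) → S ⊆ T → ⊆ᵇ S T ≡ true
  ⊆⇒⊆ᵇ []            []            sub = refl
  ⊆⇒⊆ᵇ (outside ∷ S) (b ∷ T)       sub = ⊆⇒⊆ᵇ S T (drop-∷-⊆ sub)
  ⊆⇒⊆ᵇ (inside ∷ S)  (inside ∷ T)  sub = ⊆⇒⊆ᵇ S T (drop-∷-⊆ sub)
  ⊆⇒⊆ᵇ (inside ∷ S)  (outside ∷ T) sub with () ← sub here

  ∣∪∣+∣∩∣ : ∀ {n} (p q : Subset n) → ∣ p ∪ q ∣ + ∣ p ∩ q ∣ ≡ ∣ p ∣ + ∣ q ∣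
  ∣∪∣+∣∩∣ []            []            = refl
  ∣∪∣+∣∩∣ (inside ∷ p)  (inside ∷ q)  = cong suc (trans (+-suc _ _) (trans (cong suc (∣∪∣+∣∩∣ p q)) (sym (+-suc _ _))))
  ∣∪∣+∣∩∣ (inside ∷ p)  (outside ∷ q) = cong suc (∣∪∣+∣∩∣ p q)
  ∣∪∣+∣∩∣ (outside ∷ p) (inside ∷ q)  = trans (cong suc (∣∪∣+∣∩∣ p q)) (sym (+-suc _ _))
  ∣∪∣+∣∩∣ (outside ∷ p) (outside ∷ q) = ∣∪∣+∣∩∣ p q

  ⊆∧∣≡∣⇒≡ : ∀ {n} (p q : Subset n) → p ⊆ q → ∣ p ∣ ≡ ∣ q ∣ → p ≡ q
  ⊆∧∣≡∣⇒≡ []            []            sub eq = refl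
  ⊆∧∣≡∣⇒≡ (inside ∷ p)  (inside ∷ q)  sub eq = cong (inside ∷_) (⊆∧∣≡∣⇒≡ p q (drop-∷-⊆ sub) (suc-injective eq))
  ⊆∧∣≡∣⇒≡ (inside ∷ p)  (outside ∷ q) sub eq with () ← sub here
  ⊆∧∣≡∣⇒≡ (outside ∷ p) (outside ∷ q) sub eq = cong (outside ∷_) (⊆∧∣≡∣⇒≡ p q (drop-∷-⊆ sub) eq)
  ⊆∧∣≡∣⇒≡ (outside ∷ p) (inside ∷ q)  sub eq = contradiction (p⊆q⇒∣p∣≤∣q∣ (drop-∷-⊆ sub)) (<⇒≱ (≤-reflexive (sym eq)))

  ∪-lub : ∀ {n} {p q s : Subset n} → p ⊆ s → q ⊆ s → p ∪ q ⊆ s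
  ∪-lub {p = p} {q} ps qs x∈ = [ ps , qs ]′ (x∈p∪q⁻ p q x∈)

  ⊆-⁅⁆ : ∀ {n} {i : Fin n} {S : Subset n} → i ∈ S → ⁅ i ⁆ ⊆ S
  ⊆-⁅⁆ {S = S} i∈S x∈ = subst (_∈ S) (sym (x∈⁅y⁆⇒x≡y _ x∈)) i∈S

  module _ {n} (good : Subset n → Bool) where
    private
      largest : List (Subset n) → ℕ
      largest = foldr (λ Y k → if good Y then ∣ Y ∣ ⊔ k else k) 0

    largest-upper : ∀ Ys {Y} → Y L.∈ Ys → good Y ≡ true → ∣ Y ∣ ≤ largest Ys
    largest-upper (Y ∷ Ys) (here refl) eq rewrite eq = m≤m⊔n _ _
    largest-upper (Y ∷ Ys) (there Y∈) eq with good Y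
    ... | true  = ≤-trans (largest-upper Ys Y∈ eq) (m≤n⊔m _ _)
    ... | false = largest-upper Ys Y∈ eq

    largest-attained : ∀ Ys → largest Ys ≡ 0 ⊎ ∃ λ Y → good Y ≡ true × ∣ Y ∣ ≡ largest Ys
    largest-attained []       = inj₁ refl
    largest-attained (Y ∷ Ys) with good Y in eq
    ... | false = largest-attained Ys
    ... | true with ⊔-sel ∣ Y ∣ (largest Ys) | largest-attained Ys
    ...   | inj₁ p | _      = inj₂ (Y , eq , sym p)
    ...   | inj₂ p | inj₁ q = inj₁ (trans p q)
    ...   | inj₂ p | inj₂ (Z , gZ , ∣Z∣) = inj₂ (Z , gZ , trans ∣Z∣ (sym p))

  module Rank {n} (M : Matroid n) where
    r : Subset n → ℕ
    r = rank M

    Indep : Subset n → Set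
    Indep S = indep M S ≡ true

    ∣indep∣≤rank : ∀ {X Y} → Y ⊆ X → Indep Y → ∣ Y ∣ ≤ r X
    ∣indep∣≤rank {X} {Y} sub ind =
      largest-upper _ (allSubsets n) (∈-allSubsets Y) (cong₂ _∧_ (⊆⇒⊆ᵇ Y X sub) ind)

    basis : ∀ X → ∃ λ Y → Y ⊆ X × Indep Y × ∣ Y ∣ ≡ r X
    basis X with largest-attained (λ Y → ⊆ᵇ Y X ∧ indep M Y) (allSubsets n)
    ... | inj₁ eq = ⊥ , ⊆-min X , indep-∅ M , trans (∣⊥∣≡0 n) (sym eq)
    ... | inj₂ (Y , good , eq) with ⊆ᵇ Y X in sub | good
    ...   | true | ind = Y , ⊆ᵇ⇒⊆ Y X sub , ind , eq

    rank-unique : ∀ {X k} → (∀ {Y} → Y ⊆ X → Indep Y → ∣ Y ∣ ≤ k) → (∃ λ Y → Y ⊆ X × Indep Y × ∣ Y ∣ ≡ k) → r X ≡ k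
    rank-unique {X} upper (Y , sub , ind , refl) with Z , subZ , indZ , eqZ ← basis X =
      ≤-antisym (subst (_≤ _) eqZ (upper subZ indZ)) (∣indep∣≤rank sub ind)

    rank-mono : ∀ {A B} → A ⊆ B → r A ≤ r B
    rank-mono {A} A⊆B with Y , sub , ind , eq ← basis A =
      subst (_≤ _) eq (∣indep∣≤rank (A⊆B ∘ sub) ind)

    rank≤∣∣ : ∀ A → r A ≤ ∣ A ∣
    rank≤∣∣ A with Y , sub , ind , eq ← basis A = subst (_≤ ∣ A ∣) eq (p⊆q⇒∣p∣≤∣q∣ sub)

    indep⇒rank : ∀ {A} → Indep A → r A ≡ ∣ A ∣
    indep⇒rank {A} ind = ≤-antisym (rank≤∣∣ A) (∣indep∣≤rank id ind)

    rank⇒indep : ∀ {A} → r A ≡ ∣ A ∣ → Indep A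
    rank⇒indep {A} rA with Y , sub , ind , eq ← basis A =
      subst Indep (⊆∧∣≡∣⇒≡ Y A sub (trans eq rA)) ind

    dep⇒rank< : ∀ {A} → Dependent M A → r A < ∣ A ∣
    dep⇒rank< {A} dep = ≤∧≢⇒< (rank≤∣∣ A) λ eq → case trans (sym (rank⇒indep {A} eq)) dep of λ ()

    private
      -- Each exchange against a basis `W` of `X` adds one element of `X` to `Y`, so it is enough
      -- that the fuel bounds the deficit r(X) - |Y|.
      extend-fuel : ∀ k {X Y} → r X ≤ k + ∣ Y ∣ → Y ⊆ X → Indep Y →
                    ∃ λ Z → Y ⊆ Z × Z ⊆ X × Indep Z × ∣ Z ∣ ≡ r X
      extend-fuel k {X} {Y} le sub ind with r X ≤? ∣ Y ∣
      ... | yes r≤ = Y , id , sub , ind , ≤-antisym (∣indep∣≤rank sub ind) r≤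
      extend-fuel zero    le sub ind | no r≰ = contradiction le r≰
      extend-fuel (suc k) {X} {Y} le sub ind | no r≰
        with W , W⊆X , indW , eqW ← basis X
        with j , j∈W , j∉Y , indj ← exchange M Y W ind indW (subst (∣ Y ∣ <_) (sym eqW) (≰⇒> r≰))
        with Z , sub′ , rest ← extend-fuel k {X} {Y ∪ ⁅ j ⁆}
               (≤-trans le (≤-trans (≤-reflexive (sym (+-suc k _)))
                 (+-monoʳ-≤ k (p⊂q⇒∣p∣<∣q∣ {p = Y} (p⊆p∪q _ , j , q⊆p∪q Y _ (x∈⁅x⁆ j) , j∉Y)))))
               (∪-lub sub (⊆-⁅⁆ (W⊆X j∈W))) indj
        = Z , sub′ ∘ p⊆p∪q _ , rest

    extend : ∀ {X Y} → Y ⊆ X → Indep Y → ∃ λ Z → Y ⊆ Z × Z ⊆ X × Indep Z × ∣ Z ∣ ≡ r X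
    extend {X} = extend-fuel (r X) (m≤m+n _ _)

    -- Extend a basis I of C to a basis Z of A ∪ B: then Z ∩ A and Z ∩ B are independent, cover Z
    -- and overlap at least in I. Taking any C inside the intersection and any D inside the union
    -- spares callers the identities between subsets.
    submodular : ∀ A B {C D} → C ⊆ A → C ⊆ B → D ⊆ A ∪ B → r C + r D ≤ r A + r B
    submodular A B {C} {D} C⊆A C⊆B D⊆ with I , I⊆C , indI , eqI ← basis C
      with Z , I⊆Z , Z⊆ , indZ , eqZ ← extend {A ∪ B} (p⊆p∪q B ∘ C⊆A ∘ I⊆C) indI = begin
      r C + r D                                             ≤⟨ +-mono-≤ (≤-reflexive (sym eqI)) (rank-mono D⊆) ⟩
      ∣ I ∣ + r (A ∪ B)                                     ≡⟨ cong (∣ I ∣ +_) (sym eqZ) ⟩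
      ∣ I ∣ + ∣ Z ∣                                         ≡⟨ +-comm ∣ I ∣ ∣ Z ∣ ⟩
      ∣ Z ∣ + ∣ I ∣                                         ≤⟨ +-mono-≤ (p⊆q⇒∣p∣≤∣q∣ Z⊆ZA∪ZB) (p⊆q⇒∣p∣≤∣q∣ I⊆ZA∩ZB) ⟩
      ∣ (Z ∩ A) ∪ (Z ∩ B) ∣ + ∣ (Z ∩ A) ∩ (Z ∩ B) ∣         ≡⟨ ∣∪∣+∣∩∣ (Z ∩ A) (Z ∩ B) ⟩
      ∣ Z ∩ A ∣ + ∣ Z ∩ B ∣                                 ≤⟨ +-mono-≤ (part A) (part B) ⟩
      r A + r B                                             ∎
      where
        open ≤-Reasoning
        part : ∀ Y → ∣ Z ∩ Y ∣ ≤ r Y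
        part Y = ∣indep∣≤rank (p∩q⊆q Z Y) (indep-down M Z _ (p∩q⊆p Z Y) indZ)
        Z⊆ZA∪ZB : Z ⊆ (Z ∩ A) ∪ (Z ∩ B)
        Z⊆ZA∪ZB x∈ = [ (λ a → p⊆p∪q _ (x∈p∩q⁺ (x∈ , a))) , (λ b → q⊆p∪q (Z ∩ A) _ (x∈p∩q⁺ (x∈ , b))) ]′ (x∈p∪q⁻ A B (Z⊆ x∈))
        I⊆ZA∩ZB : I ⊆ (Z ∩ A) ∩ (Z ∩ B)
        I⊆ZA∩ZB x∈ = x∈p∩q⁺ (x∈p∩q⁺ (I⊆Z x∈ , C⊆A (I⊆C x∈)) , x∈p∩q⁺ (I⊆Z x∈ , C⊆B (I⊆C x∈)))

  delete : ∀ {n} → Matroid (suc n) → Matroid n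
  delete M = record
    { indep = λ S → indep M (outside ∷ S) ; indep-∅ = indep-∅ M
    ; indep-down = λ X Y sub → indep-down M _ _ (out⊆ sub)
    ; exchange = λ X Y iX iY lt → exch X Y (exchange M _ _ iX iY lt) }
    where
      exch : ∀ X Y → (∃ λ j → j ∈ outside ∷ Y × j ∉ outside ∷ X × indep M ((outside ∷ X) ∪ ⁅ j ⁆) ≡ true) →
             ∃ λ j → j ∈ Y × j ∉ X × indep M (outside ∷ (X ∪ ⁅ j ⁆)) ≡ true
      exch X Y (suc j , there j∈ , j∉ , ind) = j , j∈ , j∉ ∘ there , ind

  NonLoop : ∀ {n} → Matroid (suc n) → Set
  NonLoop M = indep M (inside ∷ ⊥) ≡ true

  contract : ∀ {n} (M : Matroid (suc n)) → NonLoop M → Matroid n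
  contract M nl = record
    { indep = λ S → indep M (inside ∷ S) ; indep-∅ = nl
    ; indep-down = λ X Y sub → indep-down M _ _ (in⊆in sub)
    ; exchange = λ X Y iX iY lt → exch X Y (exchange M _ _ iX iY (s≤s lt)) }
    where
      exch : ∀ X Y → (∃ λ j → j ∈ inside ∷ Y × j ∉ inside ∷ X × indep M ((inside ∷ X) ∪ ⁅ j ⁆) ≡ true) →
             ∃ λ j → j ∈ Y × j ∉ X × indep M (inside ∷ (X ∪ ⁅ j ⁆)) ≡ true
      exch X Y (zero  , here     , j∉ , ind) = ⊥-elim (j∉ here)
      exch X Y (suc j , there j∈ , j∉ , ind) = j , j∈ , j∉ ∘ there , ind

  rank-outside : ∀ {n} (M : Matroid (suc n)) X → rank M (outside ∷ X) ≡ rank (delete M) X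
  rank-outside M X with Y , sub , ind , eq ← Rank.basis (delete M) X =
    Rank.rank-unique M upper (outside ∷ Y , out⊆ sub , ind , eq)
    where
      upper : ∀ {Y} → Y ⊆ outside ∷ X → indep M Y ≡ true → ∣ Y ∣ ≤ rank (delete M) X
      upper {outside ∷ Y} sub ind = Rank.∣indep∣≤rank (delete M) (drop-∷-⊆ sub) ind
      upper {inside ∷ Y}  sub ind with () ← sub here

  -- As 0 is not a loop, {0} extends to a basis of `inside ∷ X`; what is left of that basis is
  -- independent in the contraction.
  rank-inside : ∀ {n} (M : Matroid (suc n)) (nl : NonLoop M) X → rank M (inside ∷ X) ≡ suc (rank (contract M nl) X)
  rank-inside M nl X with Y , sub , ind , eq ← Rank.basis (contract M nl) X =
    ≤-antisym upper (subst (_≤ rank M (inside ∷ X)) (cong suc eq) (Rank.∣indep∣≤rank M (in⊆in sub) ind))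
    where
      upper : rank M (inside ∷ X) ≤ suc (rank (contract M nl) X)
      upper with Rank.extend M {inside ∷ X} {inside ∷ ⊥} (in⊆in (⊆-min X)) nl
      ... | outside ∷ Z , 0⊆Z , _ , _ , _ with () ← 0⊆Z here
      ... | inside ∷ Z , 0⊆Z , Z⊆X , indZ , eqZ =
        subst (_≤ suc (rank (contract M nl) X)) eqZ (s≤s (Rank.∣indep∣≤rank (contract M nl) (drop-∷-⊆ Z⊆X) indZ))

  rank-loop : ∀ {n} (M : Matroid (suc n)) → indep M (inside ∷ ⊥) ≡ false → ∀ X → rank M (inside ∷ X) ≡ rank M (outside ∷ X)
  rank-loop M loop X with Y , sub , ind , eq ← Rank.basis M (outside ∷ X) =
    Rank.rank-unique M upper (Y , out⊆in-trans ∘ sub , ind , eq)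
    where
      out⊆in-trans : outside ∷ X ⊆ inside ∷ X
      out⊆in-trans (there x∈) = there x∈
      upper : ∀ {Y} → Y ⊆ inside ∷ X → indep M Y ≡ true → ∣ Y ∣ ≤ rank M (outside ∷ X)
      upper {outside ∷ Y} sub ind = Rank.∣indep∣≤rank M (out⊆ (drop-∷-⊆ sub)) ind
      upper {inside ∷ Y}  sub ind with () ← trans (sym (indep-down M _ _ (in⊆in (⊆-min Y)) ind)) loop

-- The exterior algebra by recursion on the ground set.

module ExteriorAlgebra where
  open import Level using (_⊔_)
  open import Data.Fin.Subset using (_∈_; _⊆_)
  open import Data.Fin.Subset.Properties using (out⊆; in⊆in)
  open import Relation.Binary.Bundles using (Setoid)
  open RingSolver

  -- The cover V = U ⊔ {i}, as data so that inductions follow the `lo`/`hi` splitting. Covers relate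
  -- the coordinates that meet in a contraction or in a product with a linear form.
  data _⋖[_]_ : ∀ {n} → Subset n → Fin n → Subset n → Set where
    here  : ∀ {n} {U : Subset n} → (outside ∷ U) ⋖[ zero ] (inside ∷ U)
    there : ∀ {n} {U V : Subset n} {i} b → U ⋖[ i ] V → (b ∷ U) ⋖[ suc i ] (b ∷ V)

  ⋖⇒∣∣ : ∀ {n} {U V : Subset n} {i} → U ⋖[ i ] V → ∣ V ∣ ≡ suc ∣ U ∣
  ⋖⇒∣∣ here              = ≡.refl
  ⋖⇒∣∣ (there inside  c) = ≡.cong suc (⋖⇒∣∣ c)
  ⋖⇒∣∣ (there outside c) = ⋖⇒∣∣ c

  ⋖⇒⊆ : ∀ {n} {U V : Subset n} {i} → U ⋖[ i ] V → U ⊆ V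
  ⋖⇒⊆ here              (there x∈) = there x∈
  ⋖⇒⊆ (there inside c)  here       = here
  ⋖⇒⊆ (there b c)       (there x∈) = there (⋖⇒⊆ c x∈)

  ⋖⇒∈ : ∀ {n} {U V : Subset n} {i} → U ⋖[ i ] V → i ∈ V
  ⋖⇒∈ here        = here
  ⋖⇒∈ (there b c) = there (⋖⇒∈ c)

  -- An element x of E n with n > 0 is written lo x + e₀ ∧ hi x; all operations are defined by recursion along this splitting.
  module Recursive {c ℓ : Level} (K : CommutativeRing c ℓ) where
    open CommutativeRing K hiding (zero)
    open IntegerSolver K
    open import Algebra.Properties.Ring ring using (-0#≈0#)

    E : ℕ → Set c
    E n = Subset n → Carrier

    infix 4 _≋_
    -- A record instead of a bare function type, so that unification can recover `x` and `y` from a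
    -- proof.
    record _≋_ {n} (x y : E n) : Set ℓ where
      constructor pointwise
      field at : ∀ U → x U ≈ y U
    open _≋_ public

    E-setoid : ℕ → Setoid c ℓ
    E-setoid n = record
      { Carrier = E n ; _≈_ = _≋_
      ; isEquivalence = record
        { refl = pointwise λ U → refl ; sym = λ p → pointwise λ U → sym (p .at U)
        ; trans = λ p q → pointwise λ U → trans (p .at U) (q .at U) } }

    module _ {n : ℕ} where
      open Setoid (E-setoid n) public using () renaming (refl to ≋-refl; sym to ≋-sym; trans to ≋-trans)

    infixl 6 _⊕_
    infixl 7 _∙_
    infix  8 ⊖_

    𝟎 : ∀ {n} → E n
    𝟎 U = 0#
    _⊕_ : ∀ {n} → E n → E n → E n
    (x ⊕ y) U = x U + y U
    ⊖_ : ∀ {n} → E n → E n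
    (⊖ x) U = - x U
    infixr 8 _·_
    _·_ : ∀ {n} → Carrier → E n → E n
    (a · x) U = a * x U

    lo hi : ∀ {n} → E (suc n) → E n
    lo x U = x (outside ∷ U)
    hi x U = x (inside ∷ U)

    infixr 5 _⊹_
    _⊹_ : ∀ {n} → E n → E n → E (suc n)
    (x ⊹ y) (outside ∷ U) = x U
    (x ⊹ y) (inside ∷ U)  = y U

    -- The grade involution e_S ↦ (-1)^|S| e_S, that is, the sign for moving e₀ across an element: x
    -- e₀ = e₀ σ(x).
    σ : ∀ {n} → E n → E n
    σ x []            = x []
    σ x (outside ∷ U) = σ (lo x) U
    σ x (inside ∷ U)  = - σ (hi x) U

    -- Expansion of (x₀ + e₀x₁)(y₀ + e₀y₁) with e₀e₀ = 0 and x₀e₀ = e₀ σ(x₀).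
    _∙_ : ∀ {n} → E n → E n → E n
    (x ∙ y) []            = x [] * y []
    (x ∙ y) (outside ∷ U) = (lo x ∙ lo y) U
    (x ∙ y) (inside ∷ U)  = (hi x ∙ lo y) U + (σ (lo x) ∙ hi y) U

    -- contraction with the linear form e_i ↦ w i; the boundary ∂ is the case w = 1
    D : ∀ {n} → (Fin n → Carrier) → E n → E n
    D w x []            = 0#
    D w x (outside ∷ U) = w zero * x (inside ∷ U) + D (w ∘ suc) (lo x) U
    D w x (inside ∷ U)  = - D (w ∘ suc) (hi x) U

    𝟏 : ∀ {n} → E n
    𝟏 []            = 1#
    𝟏 (outside ∷ U) = 𝟏 U
    𝟏 (inside ∷ U)  = 0#

    linear : ∀ {n} → (Fin n → Carrier) → E n
    linear v []            = 0#
    linear v (outside ∷ U) = linear (v ∘ suc) U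
    linear v (inside ∷ U)  = v zero * 𝟏 U

    pairing : ∀ {n} → (Fin n → Carrier) → (Fin n → Carrier) → Carrier
    pairing {zero}  w v = 0#
    pairing {suc n} w v = w zero * v zero + pairing (w ∘ suc) (v ∘ suc)

    split : ∀ {n} {x y : E (suc n)} → lo x ≋ lo y → hi x ≋ hi y → x ≋ y
    split p q .at (outside ∷ U) = p .at U
    split p q .at (inside ∷ U)  = q .at U

    base : {x y : E 0} → x [] ≈ y [] → x ≋ y
    base p .at [] = p

    lo-cong : ∀ {n} {x y : E (suc n)} → x ≋ y → lo x ≋ lo y
    lo-cong p .at U = p .at (outside ∷ U)
    hi-cong : ∀ {n} {x y : E (suc n)} → x ≋ y → hi x ≋ hi y
    hi-cong p .at U = p .at (inside ∷ U)

    ⊕-cong : ∀ {n} {x x′ y y′ : E n} → x ≋ x′ → y ≋ y′ → x ⊕ y ≋ x′ ⊕ y′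
    ⊕-cong p q .at U = +-cong (p .at U) (q .at U)
    ⊖-cong : ∀ {n} {x y : E n} → x ≋ y → ⊖ x ≋ ⊖ y
    ⊖-cong p .at U = -‿cong (p .at U)
    ·-cong : ∀ {n} {a b} {x y : E n} → a ≈ b → x ≋ y → a · x ≋ b · y
    ·-cong a≈b p .at U = *-cong a≈b (p .at U)

    ⊖≋-1· : ∀ {n} (x : E n) → ⊖ x ≋ (- 1#) · x
    ⊖≋-1· x .at U = trans (-‿cong (sym (*-identityˡ _))) (solve 2 (λ o a → :- (o :* a) := :- o :* a) refl 1# (x U))
    𝟎≋0· : ∀ {n} (x : E n) → 𝟎 ≋ 0# · x
    𝟎≋0· x .at U = sym (zeroˡ _)

    record Linear {m n} (f : E m → E n) : Set (c ⊔ ℓ) where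
      field
        cong : ∀ {x y} → x ≋ y → f x ≋ f y
        ⊕-homo : ∀ x y → f (x ⊕ y) ≋ f x ⊕ f y
        ·-homo : ∀ a x → f (a · x) ≋ a · f x
      ⊖-homo : ∀ x → f (⊖ x) ≋ ⊖ f x
      ⊖-homo x = ≋-trans (cong (⊖≋-1· x)) (≋-trans (·-homo _ x) (≋-sym (⊖≋-1· (f x))))
      𝟎-homo : f 𝟎 ≋ 𝟎
      𝟎-homo = ≋-trans (cong (𝟎≋0· 𝟎)) (≋-trans (·-homo _ 𝟎) (≋-sym (𝟎≋0· (f 𝟎))))
    open Linear public

    σ-linear : ∀ {n} → Linear (σ {n})
    σ-linear {zero} = record
      { cong = λ p → base (p .at []) ; ⊕-homo = λ x y → base refl ; ·-homo = λ a x → base refl }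
    σ-linear {suc n} = record
      { cong = λ p → split (ih .cong (lo-cong p)) (⊖-cong (ih .cong (hi-cong p)))
      ; ⊕-homo = λ x y → split (ih .⊕-homo (lo x) (lo y))
          (pointwise λ U → trans (-‿cong (ih .⊕-homo (hi x) (hi y) .at U))
            (solve 2 (λ a b → :- (a :+ b) := :- a :+ :- b) refl _ _))
      ; ·-homo = λ a x → split (ih .·-homo a (lo x))
          (pointwise λ U → trans (-‿cong (ih .·-homo a (hi x) .at U))
            (solve 2 (λ a b → :- (a :* b) := a :* :- b) refl _ _)) }
      where ih = σ-linear {n}

    module σ {n} = Linear (σ-linear {n})

    D-linear : ∀ {n} w → Linear (D {n} w)
    D-linear {zero} w = record
      { cong = λ p → base refl ; ⊕-homo = λ x y → base (sym (+-identityʳ 0#)) ; ·-homo = λ a x → base (sym (zeroʳ a)) }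
    D-linear {suc n} w = record
      { cong = λ p → split (pointwise λ U → +-cong (*-congˡ (p .at _)) (ih .cong (lo-cong p) .at U)) (⊖-cong (ih .cong (hi-cong p)))
      ; ⊕-homo = λ x y → split
          (pointwise λ U → trans (+-congˡ (ih .⊕-homo (lo x) (lo y) .at U))
            (solve 5 (λ w a b c d → w :* (a :+ b) :+ (c :+ d) := (w :* a :+ c) :+ (w :* b :+ d)) refl _ _ _ _ _))
          (pointwise λ U → trans (-‿cong (ih .⊕-homo (hi x) (hi y) .at U))
            (solve 2 (λ a b → :- (a :+ b) := :- a :+ :- b) refl _ _))
      ; ·-homo = λ a x → split
          (pointwise λ U → trans (+-congˡ (ih .·-homo a (lo x) .at U))
            (solve 4 (λ w a b c → w :* (a :* b) :+ a :* c := a :* (w :* b :+ c)) refl _ _ _ _))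
          (pointwise λ U → trans (-‿cong (ih .·-homo a (hi x) .at U))
            (solve 2 (λ a b → :- (a :* b) := a :* :- b) refl _ _)) }
      where ih = D-linear {n} (w ∘ suc)

    ∙-cong : ∀ {n} {x x′ y y′ : E n} → x ≋ x′ → y ≋ y′ → x ∙ y ≋ x′ ∙ y′
    ∙-cong {zero}  p q = base (*-cong (p .at []) (q .at []))
    ∙-cong {suc n} p q = split (∙-cong (lo-cong p) (lo-cong q))
      (⊕-cong (∙-cong (hi-cong p) (lo-cong q)) (∙-cong (σ.cong (lo-cong p)) (hi-cong q)))

    ∙-linearˡ : ∀ {n} (y : E n) → Linear (_∙ y)
    ∙-linearˡ {zero} y = record
      { cong = λ p → ∙-cong p ≋-refl
      ; ⊕-homo = λ x x′ → base (distribʳ _ _ _) ; ·-homo = λ a x → base (*-assoc _ _ _) }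
    ∙-linearˡ {suc n} y = record
      { cong = λ p → ∙-cong p ≋-refl
      ; ⊕-homo = λ x x′ → split (∙-linearˡ (lo y) .⊕-homo (lo x) (lo x′))
          (pointwise λ U → trans (+-cong (∙-linearˡ (lo y) .⊕-homo (hi x) (hi x′) .at U)
              (trans (∙-cong (σ.⊕-homo (lo x) (lo x′)) ≋-refl .at U) (∙-linearˡ (hi y) .⊕-homo (σ (lo x)) (σ (lo x′)) .at U)))
            (solve 4 (λ a b c d → (a :+ b) :+ (c :+ d) := (a :+ c) :+ (b :+ d)) refl _ _ _ _))
      ; ·-homo = λ a x → split (∙-linearˡ (lo y) .·-homo a (lo x))
          (pointwise λ U → trans (+-cong (∙-linearˡ (lo y) .·-homo a (hi x) .at U)
              (trans (∙-cong (σ.·-homo a (lo x)) ≋-refl .at U) (∙-linearˡ (hi y) .·-homo a (σ (lo x)) .at U)))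
            (sym (distribˡ _ _ _))) }

    ∙-linearʳ : ∀ {n} (x : E n) → Linear (x ∙_)
    ∙-linearʳ {zero} x = record
      { cong = λ p → ∙-cong ≋-refl p
      ; ⊕-homo = λ y y′ → base (distribˡ _ _ _)
      ; ·-homo = λ a y → base (solve 3 (λ x a y → x :* (a :* y) := a :* (x :* y)) refl _ _ _) }
    ∙-linearʳ {suc n} x = record
      { cong = λ p → ∙-cong ≋-refl p
      ; ⊕-homo = λ y y′ → split (∙-linearʳ (lo x) .⊕-homo (lo y) (lo y′))
          (pointwise λ U → trans (+-cong (∙-linearʳ (hi x) .⊕-homo (lo y) (lo y′) .at U)
              (∙-linearʳ (σ (lo x)) .⊕-homo (hi y) (hi y′) .at U))
            (solve 4 (λ a b c d → (a :+ b) :+ (c :+ d) := (a :+ c) :+ (b :+ d)) refl _ _ _ _))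
      ; ·-homo = λ a y → split (∙-linearʳ (lo x) .·-homo a (lo y))
          (pointwise λ U → trans (+-cong (∙-linearʳ (hi x) .·-homo a (lo y) .at U)
              (∙-linearʳ (σ (lo x)) .·-homo a (hi y) .at U))
            (sym (distribˡ _ _ _))) }

    module ∙ˡ {n} (y : E n) = Linear (∙-linearˡ y)
    module ∙ʳ {n} (x : E n) = Linear (∙-linearʳ x)
    module D {n} (w : Fin n → Carrier) = Linear (D-linear w)

    open import Relation.Binary.Reasoning.MultiSetoid public

    ∘-linear : ∀ {k m n} {f : E m → E n} {g : E k → E m} → Linear f → Linear g → Linear (f ∘ g)
    ∘-linear {g = g} F G = record
      { cong = λ p → F .cong (G .cong p)
      ; ⊕-homo = λ x y → ≋-trans (F .cong (G .⊕-homo x y)) (F .⊕-homo (g x) (g y))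
      ; ·-homo = λ a x → ≋-trans (F .cong (G .·-homo a x)) (F .·-homo a (g x)) }

    σ-involutive : ∀ {n} (x : E n) → σ (σ x) ≋ x
    σ-involutive {zero}  x = base refl
    σ-involutive {suc n} x = split (σ-involutive (lo x))
      (pointwise λ U → trans (-‿cong (σ.⊖-homo (σ (hi x)) .at U))
        (trans (solve 1 (λ a → :- (:- a) := a) refl _) (σ-involutive (hi x) .at U)))

    σ-∙ : ∀ {n} (x y : E n) → σ (x ∙ y) ≋ σ x ∙ σ y
    σ-∙ {zero}  x y = base refl
    σ-∙ {suc n} x y = split (σ-∙ (lo x) (lo y)) (pointwise λ U → begin⟨ setoid ⟩
      - σ (hi x ∙ lo y ⊕ σ (lo x) ∙ hi y) U                           ≈⟨ -‿cong (σ.⊕-homo (hi x ∙ lo y) (σ (lo x) ∙ hi y) .at U) ⟩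
      - (σ (hi x ∙ lo y) U + σ (σ (lo x) ∙ hi y) U)                   ≈⟨ -‿cong (+-cong (σ-∙ (hi x) (lo y) .at U) (σ-∙ (σ (lo x)) (hi y) .at U)) ⟩
      - ((σ (hi x) ∙ σ (lo y)) U + (σ (σ (lo x)) ∙ σ (hi y)) U)       ≈⟨ solve 2 (λ a b → :- (a :+ b) := :- a :+ :- b) refl _ _ ⟩
      - (σ (hi x) ∙ σ (lo y)) U + - (σ (σ (lo x)) ∙ σ (hi y)) U       ≈⟨ +-cong (∙ˡ.⊖-homo (σ (lo y)) (σ (hi x)) .at U) (∙ʳ.⊖-homo (σ (σ (lo x))) (σ (hi y)) .at U) ⟨
      (hi (σ x) ∙ lo (σ y)) U + (σ (lo (σ x)) ∙ hi (σ y)) U           ∎)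

    ∙-assoc : ∀ {n} (x y z : E n) → (x ∙ y) ∙ z ≋ x ∙ (y ∙ z)
    ∙-assoc {zero}  x y z = base (*-assoc _ _ _)
    ∙-assoc {suc n} x y z = split (∙-assoc (lo x) (lo y) (lo z)) (pointwise λ U → begin⟨ setoid ⟩
      ((hi x ∙ lo y ⊕ σ (lo x) ∙ hi y) ∙ lo z) U + (σ (lo x ∙ lo y) ∙ hi z) U
        ≈⟨ +-cong (∙ˡ.⊕-homo (lo z) (hi x ∙ lo y) (σ (lo x) ∙ hi y) .at U) (∙-cong (σ-∙ (lo x) (lo y)) ≋-refl .at U) ⟩
      (((hi x ∙ lo y) ∙ lo z) U + ((σ (lo x) ∙ hi y) ∙ lo z) U) + ((σ (lo x) ∙ σ (lo y)) ∙ hi z) U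
        ≈⟨ +-cong (+-cong (∙-assoc (hi x) (lo y) (lo z) .at U) (∙-assoc (σ (lo x)) (hi y) (lo z) .at U)) (∙-assoc (σ (lo x)) (σ (lo y)) (hi z) .at U) ⟩
      ((hi x ∙ (lo y ∙ lo z)) U + (σ (lo x) ∙ (hi y ∙ lo z)) U) + (σ (lo x) ∙ (σ (lo y) ∙ hi z)) U
        ≈⟨ +-assoc _ _ _ ⟩
      (hi x ∙ (lo y ∙ lo z)) U + ((σ (lo x) ∙ (hi y ∙ lo z)) U + (σ (lo x) ∙ (σ (lo y) ∙ hi z)) U)
        ≈⟨ +-congˡ (∙ʳ.⊕-homo (σ (lo x)) (hi y ∙ lo z) (σ (lo y) ∙ hi z) .at U) ⟨
      (hi x ∙ (lo y ∙ lo z)) U + (σ (lo x) ∙ (hi y ∙ lo z ⊕ σ (lo y) ∙ hi z)) U ∎)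

    σ-𝟏 : ∀ {n} → σ 𝟏 ≋ 𝟏 {n}
    σ-𝟏 {zero}  = base refl
    σ-𝟏 {suc n} = split σ-𝟏 (pointwise λ U → trans (-‿cong (σ.𝟎-homo .at U)) -0#≈0#)

    ∙-identityˡ : ∀ {n} (x : E n) → 𝟏 ∙ x ≋ x
    ∙-identityˡ {zero}  x = base (*-identityˡ _)
    ∙-identityˡ {suc n} x = split (∙-identityˡ (lo x)) (pointwise λ U →
      trans (+-cong (∙ˡ.𝟎-homo (lo x) .at U) (trans (∙-cong σ-𝟏 ≋-refl .at U) (∙-identityˡ (hi x) .at U))) (+-identityˡ _))

    ∙-identityʳ : ∀ {n} (x : E n) → x ∙ 𝟏 ≋ x
    ∙-identityʳ {zero}  x = base (*-identityʳ _)
    ∙-identityʳ {suc n} x = split (∙-identityʳ (lo x)) (pointwise λ U →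
      trans (+-cong (∙-identityʳ (hi x) .at U) (∙ʳ.𝟎-homo (σ (lo x)) .at U)) (+-identityʳ _))

    D-σ : ∀ {n} w (x : E n) → D w (σ x) ≋ ⊖ σ (D w x)
    D-σ {zero}  w x = base (sym -0#≈0#)
    D-σ {suc n} w x = split
      (pointwise λ U → begin⟨ setoid ⟩
        w zero * - σ (hi x) U + D (w ∘ suc) (σ (lo x)) U              ≈⟨ +-congˡ (D-σ _ (lo x) .at U) ⟩
        w zero * - σ (hi x) U + - σ (D (w ∘ suc) (lo x)) U            ≈⟨ solve 3 (λ w a b → w :* :- a :+ :- b := :- (w :* a :+ b)) refl _ _ _ ⟩
        - (w zero * σ (hi x) U + σ (D (w ∘ suc) (lo x)) U)            ≈⟨ -‿cong (+-congʳ (σ.·-homo (w zero) (hi x) .at U)) ⟨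
        - (σ (w zero · hi x) U + σ (D (w ∘ suc) (lo x)) U)            ≈⟨ -‿cong (σ.⊕-homo (w zero · hi x) (D (w ∘ suc) (lo x)) .at U) ⟨
        - σ (w zero · hi x ⊕ D (w ∘ suc) (lo x)) U                    ∎)
      (pointwise λ U → begin⟨ setoid ⟩
        - D (w ∘ suc) (⊖ σ (hi x)) U                                  ≈⟨ -‿cong (D.⊖-homo _ (σ (hi x)) .at U) ⟩
        - - D (w ∘ suc) (σ (hi x)) U                                  ≈⟨ -‿cong (-‿cong (D-σ _ (hi x) .at U)) ⟩
        - - - σ (D (w ∘ suc) (hi x)) U                                ≈⟨ -‿cong (-‿cong (σ.⊖-homo (D (w ∘ suc) (hi x)) .at U)) ⟨
        - - σ (⊖ D (w ∘ suc) (hi x)) U                                ∎)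

    -- The graded Leibniz rule: `D w` is the antiderivation of degree -1 with value w i on e_i.
    D-∙ : ∀ {n} w (x y : E n) → D w (x ∙ y) ≋ D w x ∙ y ⊕ σ x ∙ D w y
    D-∙ {zero}  w x y = base (solve 2 (λ a b → :0 := :0 :* b :+ a :* :0) refl _ _)
    D-∙ {suc n} w x y = split
      (pointwise λ U → begin⟨ setoid ⟩
        w₀ * ((x₁ ∙ y₀) U + (σ x₀ ∙ y₁) U) + D w′ (x₀ ∙ y₀) U                                       ≈⟨ +-congˡ (D-∙ w′ x₀ y₀ .at U) ⟩
        w₀ * ((x₁ ∙ y₀) U + (σ x₀ ∙ y₁) U) + ((D w′ x₀ ∙ y₀) U + (σ x₀ ∙ D w′ y₀) U)               ≈⟨ solve 5 (λ w a b c d → w :* (a :+ b) :+ (c :+ d) := (w :* a :+ c) :+ (w :* b :+ d)) refl _ _ _ _ _ ⟩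
        (w₀ * (x₁ ∙ y₀) U + (D w′ x₀ ∙ y₀) U) + (w₀ * (σ x₀ ∙ y₁) U + (σ x₀ ∙ D w′ y₀) U)          ≈⟨ +-cong (+-congʳ (∙ˡ.·-homo y₀ w₀ x₁ .at U)) (+-congʳ (∙ʳ.·-homo (σ x₀) w₀ y₁ .at U)) ⟨
        ((w₀ · x₁ ∙ y₀) U + (D w′ x₀ ∙ y₀) U) + ((σ x₀ ∙ (w₀ · y₁)) U + (σ x₀ ∙ D w′ y₀) U)        ≈⟨ +-cong (∙ˡ.⊕-homo y₀ (w₀ · x₁) (D w′ x₀) .at U) (∙ʳ.⊕-homo (σ x₀) (w₀ · y₁) (D w′ y₀) .at U) ⟨
        ((w₀ · x₁ ⊕ D w′ x₀) ∙ y₀) U + (σ x₀ ∙ (w₀ · y₁ ⊕ D w′ y₀)) U                               ∎)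
      (pointwise λ U → begin⟨ setoid ⟩
        - D w′ (x₁ ∙ y₀ ⊕ σ x₀ ∙ y₁) U
          ≈⟨ -‿cong (trans (D.⊕-homo w′ (x₁ ∙ y₀) (σ x₀ ∙ y₁) .at U) (+-cong (D-∙ w′ x₁ y₀ .at U) (D-∙ w′ (σ x₀) y₁ .at U))) ⟩
        - (((D w′ x₁ ∙ y₀) U + (σ x₁ ∙ D w′ y₀) U) + ((D w′ (σ x₀) ∙ y₁) U + (σ (σ x₀) ∙ D w′ y₁) U))
          ≈⟨ -‿cong (+-congˡ (+-congʳ (trans (∙-cong (D-σ w′ x₀) ≋-refl .at U) (∙ˡ.⊖-homo y₁ (σ (D w′ x₀)) .at U)))) ⟩
        - (((D w′ x₁ ∙ y₀) U + (σ x₁ ∙ D w′ y₀) U) + (- (σ (D w′ x₀) ∙ y₁) U + (σ (σ x₀) ∙ D w′ y₁) U))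
          -- The terms ± w₀ (σ x₁ ∙ y₁) are inserted here. On the right-hand side one comes from
          -- removing e₀ from x and the other from removing e₀ from y, and they cancel.
          ≈⟨ solve 6 (λ a b c d w e → :- ((a :+ b) :+ (:- c :+ d)) := (:- a :+ (w :* e :+ c)) :+ ((:- (w :* e) :+ :- b) :+ :- d)) refl _ _ _ _ w₀ _ ⟩
        (- (D w′ x₁ ∙ y₀) U + (w₀ * (σ x₁ ∙ y₁) U + (σ (D w′ x₀) ∙ y₁) U)) + ((- (w₀ * (σ x₁ ∙ y₁) U) + - (σ x₁ ∙ D w′ y₀) U) + - (σ (σ x₀) ∙ D w′ y₁) U)
          ≈⟨ +-cong (+-cong (∙ˡ.⊖-homo y₀ (D w′ x₁) .at U) (first U)) (+-cong (second U) (∙ʳ.⊖-homo (σ (σ x₀)) (D w′ y₁) .at U)) ⟨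
        ((⊖ D w′ x₁ ∙ y₀) U + (σ (w₀ · x₁ ⊕ D w′ x₀) ∙ y₁) U) + ((⊖ σ x₁ ∙ (w₀ · y₁ ⊕ D w′ y₀)) U + (σ (σ x₀) ∙ ⊖ D w′ y₁) U) ∎)
      where
        x₀ = lo x
        x₁ = hi x
        y₀ = lo y
        y₁ = hi y
        w₀ = w zero
        w′ = w ∘ suc
        first : ∀ U → (σ (w₀ · x₁ ⊕ D w′ x₀) ∙ y₁) U ≈ w₀ * (σ x₁ ∙ y₁) U + (σ (D w′ x₀) ∙ y₁) U
        first U = trans (∙-cong (≋-trans (σ.⊕-homo (w₀ · x₁) (D w′ x₀)) (⊕-cong (σ.·-homo w₀ x₁) ≋-refl)) ≋-refl .at U)
          (trans (∙ˡ.⊕-homo y₁ (w₀ · σ x₁) (σ (D w′ x₀)) .at U) (+-congʳ (∙ˡ.·-homo y₁ w₀ (σ x₁) .at U)))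
        second : ∀ U → (⊖ σ x₁ ∙ (w₀ · y₁ ⊕ D w′ y₀)) U ≈ - (w₀ * (σ x₁ ∙ y₁) U) + - (σ x₁ ∙ D w′ y₀) U
        second U = trans (∙ˡ.⊖-homo (w₀ · y₁ ⊕ D w′ y₀) (σ x₁) .at U)
          (trans (-‿cong (trans (∙ʳ.⊕-homo (σ x₁) (w₀ · y₁) (D w′ y₀) .at U) (+-congʳ (∙ʳ.·-homo (σ x₁) w₀ y₁ .at U))))
            (solve 2 (λ a b → :- (a :+ b) := :- a :+ :- b) refl _ _))

    D-anticomm : ∀ {n} w u (x : E n) → D w (D u x) ≋ ⊖ D u (D w x)
    D-anticomm {zero}  w u x = base (sym -0#≈0#)
    D-anticomm {suc n} w u x = split
      (pointwise λ U → begin⟨ setoid ⟩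
        w zero * - D u′ (hi x) U + D w′ (u zero · hi x ⊕ D u′ (lo x)) U
          ≈⟨ +-congˡ (trans (D.⊕-homo w′ (u zero · hi x) (D u′ (lo x)) .at U) (+-cong (D.·-homo w′ (u zero) (hi x) .at U) (D-anticomm w′ u′ (lo x) .at U))) ⟩
        w zero * - D u′ (hi x) U + (u zero * D w′ (hi x) U + - D u′ (D w′ (lo x)) U)
          ≈⟨ solve 5 (λ w u a b c → w :* :- a :+ (u :* b :+ :- c) := :- (u :* :- b :+ (w :* a :+ c))) refl _ _ _ _ _ ⟩
        - (u zero * - D w′ (hi x) U + (w zero * D u′ (hi x) U + D u′ (D w′ (lo x)) U))
          ≈⟨ -‿cong (+-congˡ (trans (D.⊕-homo u′ (w zero · hi x) (D w′ (lo x)) .at U) (+-congʳ (D.·-homo u′ (w zero) (hi x) .at U)))) ⟨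
        - (u zero * - D w′ (hi x) U + D u′ (w zero · hi x ⊕ D w′ (lo x)) U) ∎)
      (pointwise λ U → begin⟨ setoid ⟩
        - D w′ (⊖ D u′ (hi x)) U        ≈⟨ -‿cong (D.⊖-homo w′ (D u′ (hi x)) .at U) ⟩
        - - D w′ (D u′ (hi x)) U        ≈⟨ -‿cong (-‿cong (D-anticomm w′ u′ (hi x) .at U)) ⟩
        - - - D u′ (D w′ (hi x)) U      ≈⟨ -‿cong (-‿cong (D.⊖-homo u′ (D w′ (hi x)) .at U)) ⟨
        - - D u′ (⊖ D w′ (hi x)) U      ∎)
      where
        w′ = w ∘ suc
        u′ = u ∘ suc

    -- Proved separately because `D-anticomm` at u = w yields only 2 D w (D w x) = 0, which says
    -- nothing in characteristic 2.
    D-square : ∀ {n} w (x : E n) → D w (D w x) ≋ 𝟎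
    D-square {zero}  w x = base refl
    D-square {suc n} w x = split
      (pointwise λ U → trans (+-congˡ (trans (D.⊕-homo w′ (w zero · hi x) (D w′ (lo x)) .at U)
          (+-cong (D.·-homo w′ (w zero) (hi x) .at U) (D-square w′ (lo x) .at U))))
        (solve 2 (λ w a → w :* :- a :+ (w :* a :+ :0) := :0) refl _ _))
      (pointwise λ U → trans (-‿cong (trans (D.⊖-homo w′ (D w′ (hi x)) .at U) (-‿cong (D-square w′ (hi x) .at U))))
        (solve 0 (:- (:- :0) := :0) refl))
      where w′ = w ∘ suc

    σ-linear-form : ∀ {n} v → σ (linear {n} v) ≋ ⊖ linear v
    σ-linear-form {zero}  v = base (sym -0#≈0#)
    σ-linear-form {suc n} v = split (σ-linear-form (v ∘ suc))
      (⊖-cong (≋-trans (σ.·-homo (v zero) 𝟏) (·-cong refl σ-𝟏)))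

    linear-comm : ∀ {n} v (x : E n) → linear v ∙ x ≋ σ x ∙ linear v
    linear-comm {zero}  v x = base (*-comm _ _)
    linear-comm {suc n} v x = split (linear-comm v′ (lo x)) (pointwise λ U → begin⟨ setoid ⟩
      (v zero · 𝟏 ∙ lo x) U + (σ (linear v′) ∙ hi x) U
        ≈⟨ +-cong (trans (∙ˡ.·-homo (lo x) (v zero) 𝟏 .at U) (*-congˡ (∙-identityˡ (lo x) .at U)))
             (trans (∙-cong (σ-linear-form v′) ≋-refl .at U) (trans (∙ˡ.⊖-homo (hi x) (linear v′) .at U) (-‿cong (linear-comm v′ (hi x) .at U)))) ⟩
      v zero * lo x U + - (σ (hi x) ∙ linear v′) U
        ≈⟨ +-comm _ _ ⟩
      - (σ (hi x) ∙ linear v′) U + v zero * lo x U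
        ≈⟨ +-cong (∙ˡ.⊖-homo (linear v′) (σ (hi x)) .at U)
             (trans (∙ʳ.·-homo (σ (σ (lo x))) (v zero) 𝟏 .at U) (*-congˡ (trans (∙-identityʳ _ .at U) (σ-involutive (lo x) .at U)))) ⟨
      (⊖ σ (hi x) ∙ linear v′) U + (σ (σ (lo x)) ∙ (v zero · 𝟏)) U ∎)
      where v′ = v ∘ suc

    -- Again independent of graded commutativity, which leaves a factor 2.
    linear-square : ∀ {n} v → linear {n} v ∙ linear v ≋ 𝟎
    linear-square {zero}  v = base (zeroˡ _)
    linear-square {suc n} v = split (linear-square v′) (pointwise λ U →
      trans (+-cong (trans (∙ˡ.·-homo (linear v′) (v zero) 𝟏 .at U) (*-congˡ (∙-identityˡ _ .at U)))
          (trans (∙ʳ.·-homo (σ (linear v′)) (v zero) 𝟏 .at U) (*-congˡ (trans (∙-identityʳ _ .at U) (σ-linear-form v′ .at U)))))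
        (solve 2 (λ a b → a :* b :+ a :* :- b := :0) refl _ _))
      where v′ = v ∘ suc

    linear-cancel : ∀ {n} v (x : E n) → linear v ∙ (linear v ∙ x) ≋ 𝟎
    linear-cancel v x = ≋-trans (≋-sym (∙-assoc (linear v) (linear v) x))
      (≋-trans (∙-cong (linear-square v) ≋-refl) (∙ˡ.𝟎-homo x))

    linear-anticomm : ∀ {n} v u (x : E n) → linear v ∙ (linear u ∙ x) ≋ ⊖ (linear u ∙ (linear v ∙ x))
    linear-anticomm v u x = begin⟨ E-setoid _ ⟩
      linear v ∙ (linear u ∙ x)            ≈⟨ ∙-assoc (linear v) (linear u) x ⟨
      (linear v ∙ linear u) ∙ x            ≈⟨ ∙-cong (linear-comm v (linear u)) ≋-refl ⟩
      (σ (linear u) ∙ linear v) ∙ x        ≈⟨ ∙-cong (∙-cong (σ-linear-form u) ≋-refl) ≋-refl ⟩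
      (⊖ linear u ∙ linear v) ∙ x          ≈⟨ ∙-assoc (⊖ linear u) (linear v) x ⟩
      ⊖ linear u ∙ (linear v ∙ x)          ≈⟨ ∙ˡ.⊖-homo (linear v ∙ x) (linear u) ⟩
      ⊖ (linear u ∙ (linear v ∙ x))        ∎

    D-𝟏 : ∀ {n} w → D w (𝟏 {n}) ≋ 𝟎
    D-𝟏 {zero}  w = base refl
    D-𝟏 {suc n} w = split
      (pointwise λ U → trans (+-cong (zeroʳ _) (D-𝟏 (w ∘ suc) .at U)) (+-identityʳ _))
      (pointwise λ U → trans (-‿cong (D.𝟎-homo (w ∘ suc) .at U)) -0#≈0#)

    D-linear-form : ∀ {n} w v → D w (linear {n} v) ≋ pairing w v · 𝟏
    D-linear-form {zero}  w v = base (sym (zeroˡ _))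
    D-linear-form {suc n} w v = split
      (pointwise λ U → trans (+-congˡ (D-linear-form (w ∘ suc) (v ∘ suc) .at U))
        (solve 4 (λ w v p o → w :* (v :* o) :+ p :* o := (w :* v :+ p) :* o) refl _ _ _ _))
      (pointwise λ U → trans (-‿cong (trans (D.·-homo (w ∘ suc) (v zero) 𝟏 .at U) (*-congˡ (D-𝟏 (w ∘ suc) .at U))))
        (solve 2 (λ v p → :- (v :* :0) := p :* :0) refl _ _))

    -- Leibniz rule for a factor of degree one. When `pairing w v` is 1 this makes `D w` a
    -- contracting homotopy for multiplication by v; the regularity of explicit forms and the
    -- recovery of x from ∂ x both come from here.
    D-homotopy : ∀ {n} w v (x : E n) → D w (linear v ∙ x) ≋ pairing w v · x ⊕ ⊖ (linear v ∙ D w x)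
    D-homotopy w v x = ≋-trans (D-∙ w (linear v) x) (⊕-cong
      (≋-trans (∙-cong (D-linear-form w v) ≋-refl) (≋-trans (∙ˡ.·-homo x _ 𝟏) (·-cong refl (∙-identityˡ x))))
      (≋-trans (∙-cong (σ-linear-form v) ≋-refl) (∙ˡ.⊖-homo (D w x) (linear v))))

    -- The coordinate of a product at U involves only coordinates of the factors at subsets of U. As
    -- subsets of independent sets are independent, vectors supported on dependent sets will form an
    -- ideal.
    ∙-vanishʳ : ∀ {n} (x y : E n) U → (∀ V → V ⊆ U → y V ≈ 0#) → (x ∙ y) U ≈ 0#
    ∙-vanishʳ x y []            y≈0 = trans (*-congˡ (y≈0 [] id)) (zeroʳ _)
    ∙-vanishʳ x y (outside ∷ U) y≈0 = ∙-vanishʳ (lo x) (lo y) U (λ V V⊆ → y≈0 _ (out⊆ V⊆))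
    ∙-vanishʳ x y (inside ∷ U)  y≈0 = trans
      (+-cong (∙-vanishʳ (hi x) (lo y) U (λ V V⊆ → y≈0 _ (out⊆ V⊆))) (∙-vanishʳ (σ (lo x)) (hi y) U (λ V V⊆ → y≈0 _ (in⊆in V⊆))))
      (+-identityʳ _)

    σ-vanish : ∀ {n} (x : E n) U → x U ≈ 0# → σ x U ≈ 0#
    σ-vanish x []            p = p
    σ-vanish x (outside ∷ U) p = σ-vanish (lo x) U p
    σ-vanish x (inside ∷ U)  p = trans (-‿cong (σ-vanish (hi x) U p)) -0#≈0#

    ∙-vanishˡ : ∀ {n} (x y : E n) U → (∀ V → V ⊆ U → x V ≈ 0#) → (x ∙ y) U ≈ 0#
    ∙-vanishˡ x y []            x≈0 = trans (*-congʳ (x≈0 [] id)) (zeroˡ _)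
    ∙-vanishˡ x y (outside ∷ U) x≈0 = ∙-vanishˡ (lo x) (lo y) U (λ V V⊆ → x≈0 _ (out⊆ V⊆))
    ∙-vanishˡ x y (inside ∷ U)  x≈0 = trans
      (+-cong (∙-vanishˡ (hi x) (lo y) U (λ V V⊆ → x≈0 _ (in⊆in V⊆)))
        (∙-vanishˡ (σ (lo x)) (hi y) U (λ V V⊆ → σ-vanish (lo x) V (x≈0 _ (out⊆ V⊆)))))
      (+-identityʳ _)

    D-local : ∀ {n} w (x y : E n) U → (∀ i V → U ⋖[ i ] V → x V ≈ y V) → D w x U ≈ D w y U
    D-local w x y []            eq = refl
    D-local w x y (outside ∷ U) eq = +-cong (*-congˡ (eq _ _ here)) (D-local _ (lo x) (lo y) U (λ i V c → eq _ _ (there outside c)))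
    D-local w x y (inside ∷ U)  eq = -‿cong (D-local _ (hi x) (hi y) U (λ i V c → eq _ _ (there inside c)))

    -- The weight `v i` stays in the hypothesis so that, for the form of a single element i, only
    -- covers by i have to be compared.
    linear-local : ∀ {n} v (x y : E n) U → (∀ i V → V ⋖[ i ] U → v i * x V ≈ v i * y V) → (linear v ∙ x) U ≈ (linear v ∙ y) U
    linear-local v x y []            eq = trans (zeroˡ _) (sym (zeroˡ _))
    linear-local v x y (outside ∷ U) eq = linear-local (v ∘ suc) (lo x) (lo y) U (λ i V c → eq _ _ (there outside c))
    linear-local v x y (inside ∷ U)  eq = +-cong
      (trans (scalar x) (trans (eq _ _ here) (sym (scalar y))))
      (trans (negate x) (trans (-‿cong (linear-local (v ∘ suc) (hi x) (hi y) U (λ i V c → eq _ _ (there inside c)))) (sym (negate y))))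
      where
        scalar : ∀ x → (v zero · 𝟏 ∙ lo x) U ≈ v zero * lo x U
        scalar x = trans (∙ˡ.·-homo (lo x) (v zero) 𝟏 .at U) (*-congˡ (∙-identityˡ (lo x) .at U))
        negate : ∀ x → (σ (linear (v ∘ suc)) ∙ hi x) U ≈ - (linear (v ∘ suc) ∙ hi x) U
        negate x = trans (∙-cong (σ-linear-form (v ∘ suc)) ≋-refl .at U) (∙ˡ.⊖-homo (hi x) (linear (v ∘ suc)) .at U)

-- Finite sums over subsets and over elements.

module Sums where
  open import Defs
  open import Data.List using (foldr; allFin; _++_; map)
  open import Data.List.Properties using (foldr-map; map-tabulate)
  open RingSolver

  ≡ᵇ-refl : ∀ k → (k ℕ.≡ᵇ k) ≡ true
  ≡ᵇ-refl zero    = ≡.refl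
  ≡ᵇ-refl (suc k) = ≡ᵇ-refl k

  foldr-allFin : ∀ {A : Set} {n} (f : Fin (suc n) → A → A) z → foldr f z (allFin (suc n)) ≡ f zero (foldr (f ∘ suc) z (allFin n))
  foldr-allFin {n = n} f z = ≡.cong (f zero) (≡.trans (≡.cong (foldr f z) (≡.sym (map-tabulate id suc))) (foldr-map f suc z (allFin n)))

  countᵇ-allFin : ∀ {n} (p : Fin (suc n) → Bool) →
    countᵇ (allFin (suc n)) p ≡ (if p zero then suc (countᵇ (allFin n) (p ∘ suc)) else countᵇ (allFin n) (p ∘ suc))
  countᵇ-allFin p = foldr-allFin (λ x k → if p x then suc k else k) 0

  module Summation {c ℓ : Level} (K : CommutativeRing c ℓ) where
    open CommutativeRing K hiding (zero)
    open IntegerSolver K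

    sumList : {A : Set} → List A → (A → Carrier) → Carrier
    sumList xs f = foldr (λ a r → f a + r) 0# xs

    [_]· : Bool → Carrier → Carrier
    [ b ]· a = if b then a else 0#

    sumList-++ : ∀ {A : Set} (xs ys : List A) f → sumList (xs ++ ys) f ≈ sumList xs f + sumList ys f
    sumList-++ []       ys f = sym (+-identityˡ _)
    sumList-++ (x ∷ xs) ys f = trans (+-congˡ (sumList-++ xs ys f)) (sym (+-assoc _ _ _))

    sumList-map : ∀ {A B : Set} (g : A → B) xs f → sumList (map g xs) f ≡ sumList xs (f ∘ g)
    sumList-map g xs f = foldr-map (λ a r → f a + r) g 0# xs

    ∑ : ∀ {n} → (Subset n → Carrier) → Carrier
    ∑ {zero}  f = f []
    ∑ {suc n} f = ∑ (f ∘ (inside ∷_)) + ∑ (f ∘ (outside ∷_))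

    ⨁ : ∀ {n} → (Fin n → Carrier) → Carrier
    ⨁ {zero}  f = 0#
    ⨁ {suc n} f = f zero + ⨁ (f ∘ suc)

    sumList-allSubsets : ∀ {n} (f : Subset n → Carrier) → sumList (allSubsets n) f ≈ ∑ f
    sumList-allSubsets {zero}  f = +-identityʳ _
    sumList-allSubsets {suc n} f = trans (sumList-++ (map (inside ∷_) (allSubsets n)) _ f) (+-cong
      (trans (reflexive (sumList-map (inside ∷_) (allSubsets n) f)) (sumList-allSubsets (f ∘ (inside ∷_))))
      (trans (reflexive (sumList-map (outside ∷_) (allSubsets n) f)) (sumList-allSubsets (f ∘ (outside ∷_)))))

    sumList-allFin : ∀ {n} (f : Fin n → Carrier) → sumList (allFin n) f ≈ ⨁ f
    sumList-allFin {zero}  f = refl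
    sumList-allFin {suc n} f = +-congˡ (trans
      (reflexive (≡.trans (≡.cong (λ xs → sumList xs f) (≡.sym (map-tabulate id suc))) (sumList-map suc (allFin n) f)))
      (sumList-allFin (f ∘ suc)))

    ∑-cong : ∀ {n} {f g : Subset n → Carrier} → (∀ S → f S ≈ g S) → ∑ f ≈ ∑ g
    ∑-cong {zero}  p = p []
    ∑-cong {suc n} p = +-cong (∑-cong (p ∘ (inside ∷_))) (∑-cong (p ∘ (outside ∷_)))

    ∑-0 : ∀ {n} {f : Subset n → Carrier} → (∀ S → f S ≈ 0#) → ∑ f ≈ 0#
    ∑-0 {zero}  p = p []
    ∑-0 {suc n} p = trans (+-cong (∑-0 (p ∘ (inside ∷_))) (∑-0 (p ∘ (outside ∷_)))) (+-identityʳ _)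

    ∑-+ : ∀ {n} (f g : Subset n → Carrier) → ∑ (λ S → f S + g S) ≈ ∑ f + ∑ g
    ∑-+ {zero}  f g = refl
    ∑-+ {suc n} f g = trans (+-cong (∑-+ (f ∘ (inside ∷_)) (g ∘ (inside ∷_))) (∑-+ (f ∘ (outside ∷_)) (g ∘ (outside ∷_))))
      (solve 4 (λ a b c d → (a :+ b) :+ (c :+ d) := (a :+ c) :+ (b :+ d)) refl _ _ _ _)

    ∑-* : ∀ {n} a (f : Subset n → Carrier) → ∑ (λ S → a * f S) ≈ a * ∑ f
    ∑-* {zero}  a f = refl
    ∑-* {suc n} a f = trans (+-cong (∑-* a (f ∘ (inside ∷_))) (∑-* a (f ∘ (outside ∷_)))) (sym (distribˡ _ _ _))

    ∑-neg : ∀ {n} (f : Subset n → Carrier) → ∑ (λ S → - f S) ≈ - ∑ f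
    ∑-neg {zero}  f = refl
    ∑-neg {suc n} f = trans (+-cong (∑-neg (f ∘ (inside ∷_))) (∑-neg (f ∘ (outside ∷_))))
      (solve 2 (λ a b → :- a :+ :- b := :- (a :+ b)) refl _ _)

    ⨁-cong : ∀ {n} {f g : Fin n → Carrier} → (∀ i → f i ≈ g i) → ⨁ f ≈ ⨁ g
    ⨁-cong {zero}  p = refl
    ⨁-cong {suc n} p = +-cong (p zero) (⨁-cong (p ∘ suc))

    ⨁-0 : ∀ {n} {f : Fin n → Carrier} → (∀ i → f i ≈ 0#) → ⨁ f ≈ 0#
    ⨁-0 {zero}  p = refl
    ⨁-0 {suc n} p = trans (+-cong (p zero) (⨁-0 (p ∘ suc))) (+-identityʳ _)

    ⨁-neg : ∀ {n} (f : Fin n → Carrier) → ⨁ (λ i → - f i) ≈ - ⨁ f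
    ⨁-neg {zero}  f = solve 0 (:0 := :- :0) refl
    ⨁-neg {suc n} f = trans (+-congˡ (⨁-neg (f ∘ suc))) (solve 2 (λ a b → :- a :+ :- b := :- (a :+ b)) refl _ _)

    []·-∧-false : ∀ b {a} → [ b ∧ false ]· a ≈ 0#
    []·-∧-false true  = refl
    []·-∧-false false = refl

    []·-cong : ∀ b {x y} → x ≈ y → [ b ]· x ≈ [ b ]· y
    []·-cong true  p = p
    []·-cong false p = refl

-- Translation between the stated exterior algebra and the recursive one.

module Bridge where
  open import Defs
  open import Level using (_⊔_)
  open import Data.Bool.Properties using (∧-zeroʳ)
  open import Data.Nat using (_<ᵇ_)
  open import Data.Fin using (toℕ)
  open import Data.Fin.Subset using (⊥; ⁅_⁆; _∪_)
  import Data.Fin.Subset as Sub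
  open import Data.Fin.Subset.Properties using (p─⊥≡p)
  open import Data.List using (foldr; allFin; _++_; lookup)
  open import Data.List.Membership.Propositional using (_∈_)
  open import Data.List.Relation.Unary.All as All using (All)
  open import Data.List.Membership.Propositional.Properties using (∈-lookup)
  open import Data.List.Relation.Unary.Any using (index)
  open import Data.List.Relation.Unary.Any.Properties using (lookup-index)
  open RingSolver
  open Sums
  open ExteriorAlgebra

  countᵇ-none : ∀ {n} (p : Fin n → Bool) → countᵇ (allFin n) (λ i → p i ∧ false) ≡ 0
  countᵇ-none {n} p = go (allFin n)
    where
      go : ∀ xs → countᵇ xs (λ i → p i ∧ false) ≡ 0
      go []       = ≡.refl
      go (x ∷ xs) rewrite ∧-zeroʳ (p x) = go xs

  module Translation {c ℓ : Level} (K : CommutativeRing c ℓ) where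
    open CommutativeRing K hiding (zero)
    open IntegerSolver K
    open Recursive K
    open Summation K
    open import Algebra.Properties.Ring ring using (-0#≈0#)
    module Ext {n} = Exterior K n

    sgn : ℕ → Carrier
    sgn zero    = 1#
    sgn (suc k) = - sgn k

    negpow≡sgn : ∀ n k → Exterior.negpow K n k ≡ sgn k
    negpow≡sgn n zero    = ≡.refl
    negpow≡sgn n (suc k) = ≡.cong -_ (negpow≡sgn n k)

    monomial : ∀ {n} → Subset n → E n
    monomial []            []            = 1#
    monomial (outside ∷ S) (outside ∷ U) = monomial S U
    monomial (outside ∷ S) (inside ∷ U)  = 0#
    monomial (inside ∷ S)  (outside ∷ U) = 0#
    monomial (inside ∷ S)  (inside ∷ U)  = monomial S U

    ones : ∀ {n} → Fin n → Carrier
    ones i = 1#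

    ∂ : ∀ {n} → E n → E n
    ∂ = D ones

    e≈monomial : ∀ {n} (S : Subset n) U → [ ≡ᵇ S U ]· 1# ≈ monomial S U
    e≈monomial []            []            = refl
    e≈monomial (outside ∷ S) (outside ∷ U) = e≈monomial S U
    e≈monomial (outside ∷ S) (inside ∷ U)  = []·-∧-false (⊆ᵇ S U)
    e≈monomial (inside ∷ S)  (outside ∷ U) = refl
    e≈monomial (inside ∷ S)  (inside ∷ U)  = e≈monomial S U

    lin≈linear : ∀ {n} (v : Fin n → Carrier) → Ext.lin v ≋ linear v
    lin≈linear v .at U = trans (sumList-allFin (λ i → [ ≡ᵇ ⁅ i ⁆ U ]· (v i))) (go v U)
      where
        head : ∀ {n} a (U : Subset n) → [ ≡ᵇ ⊥ U ]· a ≈ a * 𝟏 U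
        head a []            = sym (*-identityʳ a)
        head a (outside ∷ U) = head a U
        head a (inside ∷ U)  = trans ([]·-∧-false (⊆ᵇ ⊥ U)) (sym (zeroʳ a))
        go : ∀ {n} (v : Fin n → Carrier) U → ⨁ (λ i → [ ≡ᵇ ⁅ i ⁆ U ]· (v i)) ≈ linear v U
        go {zero}  v []            = refl
        go {suc n} v (outside ∷ U) = trans (+-identityˡ _) (go (v ∘ suc) U)
        go {suc n} v (inside ∷ U)  = trans (+-cong (head (v zero) U) (⨁-0 λ i → []·-∧-false (⊆ᵇ ⁅ i ⁆ U))) (+-identityʳ _)

    -- Putting `inside` in front places one more element of S before every later i and flips all
    -- signs; this is the minus in the `inside` clause of `D`.
    ∂e≈∂ : ∀ {n} (S : Subset n) → Ext.∂e S ≋ ∂ (monomial S)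
    ∂e≈∂ {n} S .at U = trans (sumList-allFin (λ i → [ memᵇ S i ∧ ≡ᵇ (S Sub.- i) U ]· (Ext.negpow {n} (before S i))))
      (trans (⨁-cong λ i → reflexive (≡.cong ([ memᵇ S i ∧ ≡ᵇ (S Sub.- i) U ]·) (negpow≡sgn n (before S i)))) (go S U))
      where
        before : ∀ {n} → Subset n → Fin n → ℕ
        before {n} S i = countᵇ (allFin n) (λ s → memᵇ S s ∧ (toℕ s <ᵇ toℕ i))
        before-zero : ∀ {n} (S : Subset (suc n)) → before S zero ≡ 0
        before-zero S = countᵇ-none (memᵇ S)
        before-in : ∀ {n} (S : Subset n) i → before (inside ∷ S) (suc i) ≡ suc (before S i)
        before-in S i = countᵇ-allFin (λ s → memᵇ (inside ∷ S) s ∧ (toℕ s <ᵇ suc (toℕ i)))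
        before-out : ∀ {n} (S : Subset n) i → before (outside ∷ S) (suc i) ≡ before S i
        before-out S i = countᵇ-allFin (λ s → memᵇ (outside ∷ S) s ∧ (toℕ s <ᵇ suc (toℕ i)))
        none : ∀ b {d a} → d ≡ false → [ b ∧ d ]· a ≈ 0#
        none b ≡.refl = []·-∧-false b
        term : ∀ {n} → Subset n → Subset n → Fin n → Carrier
        term S U i = [ memᵇ S i ∧ ≡ᵇ (S Sub.- i) U ]· (sgn (before S i))
        go : ∀ {n} (S U : Subset n) → ⨁ (term S U) ≈ ∂ (monomial S) U
        go []            []            = refl
        go (outside ∷ S) (outside ∷ U) = +-cong (sym (*-identityˡ 0#)) (trans
          (⨁-cong λ i → reflexive (≡.cong (λ k → [ memᵇ S i ∧ ≡ᵇ (S Sub.- i) U ]· (sgn k)) (before-out S i))) (go S U))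
        go (outside ∷ S) (inside ∷ U)  = trans (+-identityˡ _) (trans
          (⨁-0 λ i → none (memᵇ S i) (∧-zeroʳ (⊆ᵇ (S Sub.- i) U)))
          (sym (trans (-‿cong (D.𝟎-homo ones .at U)) -0#≈0#)))
        go (inside ∷ S)  (outside ∷ U) = +-cong
          (trans (reflexive (≡.cong₂ (λ T k → [ ≡ᵇ T U ]· (sgn k)) (p─⊥≡p S) (before-zero (inside ∷ S))))
            (trans (e≈monomial S U) (sym (*-identityˡ _))))
          (trans (⨁-0 λ i → none (memᵇ S i) ≡.refl) (sym (D.𝟎-homo ones .at U)))
        go (inside ∷ S)  (inside ∷ U)  = trans (+-cong ([]·-∧-false (⊆ᵇ (S Sub.─ ⊥) U)) (trans (⨁-cong λ i → negate i) (⨁-neg (term S U))))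
          (trans (+-identityˡ _) (-‿cong (go S U)))
          where
            neg-[]· : ∀ b {a} → [ b ]· (- a) ≈ - [ b ]· a
            neg-[]· true  = refl
            neg-[]· false = sym -0#≈0#
            negate : ∀ i → term (inside ∷ S) (inside ∷ U) (suc i) ≈ - term S U i
            negate i = trans (reflexive (≡.cong (λ k → [ memᵇ S i ∧ ≡ᵇ (S Sub.- i) U ]· (sgn k)) (before-in S i)))
              (neg-[]· (memᵇ S i ∧ ≡ᵇ (S Sub.- i) U))

    private
      inv : ∀ {n} → Subset n → Subset n → ℕ
      inv = Ext.inversions

      sumℕ : ∀ {m} → (Fin m → ℕ) → ℕ
      sumℕ {m} g = foldr (λ s k → g s ℕ.+ k) 0 (allFin m)

      sumℕ-suc : ∀ {m} (g : Fin (suc m) → ℕ) → sumℕ g ≡ g zero ℕ.+ sumℕ (g ∘ suc)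
      sumℕ-suc g = foldr-allFin (λ s k → g s ℕ.+ k) 0

      -- ι tracks the position of S inside the original ground set while S is consumed.
      below : ∀ {m n} → (Fin m → ℕ) → Subset m → Subset n → Fin m → ℕ
      below {n = n} ι S T s = if memᵇ S s then countᵇ (allFin n) (λ t → memᵇ T t ∧ (toℕ t <ᵇ ι s)) else 0

      below-suc : ∀ {m n} c (ι : Fin m → ℕ) S (T : Subset n) →
        sumℕ (below (suc ∘ ι) S (c ∷ T)) ≡ (if c then ∣ S ∣ else 0) ℕ.+ sumℕ (below ι S T)
      below-suc true  ι []            T = ≡.refl
      below-suc false ι []            T = ≡.refl
      below-suc c     ι (outside ∷ S) T = ≡.trans (sumℕ-suc (below (suc ∘ ι) (outside ∷ S) (c ∷ T)))
        (≡.trans (below-suc c (ι ∘ suc) S T) (≡.cong ((if c then ∣ S ∣ else 0) ℕ.+_) (≡.sym (sumℕ-suc (below ι (outside ∷ S) T)))))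
      below-suc {n = n} true  ι (inside ∷ S) T = ≡.trans (sumℕ-suc (below (suc ∘ ι) (inside ∷ S) (true ∷ T))) (≡.trans
        (≡.cong₂ ℕ._+_ (countᵇ-allFin (λ t → memᵇ (true ∷ T) t ∧ (toℕ t <ᵇ suc (ι zero)))) (below-suc true (ι ∘ suc) S T))
        (≡.cong suc (≡.trans (swap (countᵇ (allFin n) (λ t → memᵇ T t ∧ (toℕ t <ᵇ ι zero))) ∣ S ∣ (sumℕ (below (ι ∘ suc) S T)))
          (≡.cong (∣ S ∣ ℕ.+_) (≡.sym (sumℕ-suc (below ι (inside ∷ S) T)))))))
        where
          swap : ∀ a b c → a ℕ.+ (b ℕ.+ c) ≡ b ℕ.+ (a ℕ.+ c)
          swap a b c = ≡.trans (≡.sym (ℕₚ.+-assoc a b c)) (≡.trans (≡.cong (ℕ._+ c) (ℕₚ.+-comm a b)) (ℕₚ.+-assoc b a c))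
      below-suc false ι (inside ∷ S) T = ≡.trans (sumℕ-suc (below (suc ∘ ι) (inside ∷ S) (false ∷ T))) (≡.trans
        (≡.cong₂ ℕ._+_ (countᵇ-allFin (λ t → memᵇ (false ∷ T) t ∧ (toℕ t <ᵇ suc (ι zero)))) (below-suc false (ι ∘ suc) S T))
        (≡.sym (sumℕ-suc (below ι (inside ∷ S) T))))

      -- A new first element of T lies below all of S and creates |S| inversions; a new first
      -- element of S creates none. The sign (-1)^|S| is the `σ` in `_∙_`.
      inv-tail : ∀ {n} b c (S T : Subset n) → inv (b ∷ S) (c ∷ T) ≡ (if c then ∣ S ∣ else 0) ℕ.+ inv S T
      inv-tail b c S T = ≡.trans (sumℕ-suc (below toℕ (b ∷ S) (c ∷ T)))
        (≡.trans (≡.cong (ℕ._+ sumℕ (below (suc ∘ toℕ) S (c ∷ T))) (head b)) (below-suc c toℕ S T))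
        where
          head : ∀ b → below toℕ (b ∷ S) (c ∷ T) zero ≡ 0
          head true  = countᵇ-none (memᵇ (c ∷ T))
          head false = ≡.refl

      sgn-σ : ∀ {n} (x : E n) S → σ x S ≈ sgn ∣ S ∣ * x S
      sgn-σ x []            = sym (*-identityˡ _)
      sgn-σ x (outside ∷ S) = sgn-σ (lo x) S
      sgn-σ x (inside ∷ S)  = trans (-‿cong (sgn-σ (hi x) S)) (solve 2 (λ a b → :- (a :* b) := :- a :* b) refl _ _)

      sgn-+ : ∀ a b → sgn (a ℕ.+ b) ≈ sgn a * sgn b
      sgn-+ zero    b = sym (*-identityˡ _)
      sgn-+ (suc a) b = trans (-‿cong (sgn-+ a b)) (solve 2 (λ a b → :- (a :* b) := :- a :* b) refl _ _)

      term : ∀ {n} → E n → E n → Subset n → Subset n → Subset n → Carrier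
      term x y U S T = [ disjointᵇ S T ∧ ≡ᵇ (S ∪ T) U ]· (sgn (inv S T) * (x S * y T))

      term-keep : ∀ {n} (x y : E (suc n)) (u : E n) (v : E n) b c (S T : Subset n) q →
        sgn (if c then ∣ S ∣ else 0) * (x (b ∷ S) * y (c ∷ T)) ≈ u S * v T →
        [ q ]· (sgn (inv (b ∷ S) (c ∷ T)) * (x (b ∷ S) * y (c ∷ T))) ≈ [ q ]· (sgn (inv S T) * (u S * v T))
      term-keep x y u v b c S T q eq = []·-cong q (trans
        (*-congʳ (trans (reflexive (≡.cong sgn (inv-tail b c S T))) (sgn-+ (if c then ∣ S ∣ else 0) (inv S T))))
        (trans (solve 3 (λ a b c → (a :* b) :* c := b :* (a :* c)) refl _ _ _) (*-congˡ eq)))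

      term-drop : ∀ b d {a} → d ≡ false → [ b ∧ d ]· a ≈ 0#
      term-drop b _ ≡.refl = []·-∧-false b

      -- Of the four head patterns of (S, T), one survives at an `outside` head of U and two at an
      -- `inside` head. They are the three products in the definition of `_∙_`.
      double : ∀ {n} (x y : E n) U → ∑ (λ S → ∑ (λ T → term x y U S T)) ≈ (x ∙ y) U
      double {zero}  x y []            = *-identityˡ _
      double {suc n} x y (outside ∷ U) = trans (+-cong
        (∑-0 {n} λ S → trans (+-cong (∑-0 {n} λ T → refl) (∑-0 {n} λ T → term-drop (disjointᵇ S T) _ ≡.refl)) (+-identityʳ _))
        (∑-cong {n} λ S → trans (+-cong (∑-0 {n} λ T → term-drop (disjointᵇ S T) _ ≡.refl)
          (∑-cong {n} λ T → term-keep x y (lo x) (lo y) outside outside S T (disjointᵇ S T ∧ ≡ᵇ (S ∪ T) U) (*-identityˡ _))) (+-identityˡ _)))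
        (trans (+-identityˡ _) (double (lo x) (lo y) U))
      double {suc n} x y (inside ∷ U) = trans (+-cong
        (∑-cong {n} λ S → trans (+-cong (∑-0 {n} λ T → refl)
          (∑-cong {n} λ T → term-keep x y (hi x) (lo y) inside outside S T (disjointᵇ S T ∧ ≡ᵇ (S ∪ T) U) (*-identityˡ _))) (+-identityˡ _))
        (∑-cong {n} λ S → trans (+-cong
          (∑-cong {n} λ T → term-keep x y (σ (lo x)) (hi y) outside inside S T (disjointᵇ S T ∧ ≡ᵇ (S ∪ T) U)
            (trans (sym (*-assoc _ _ _)) (*-congʳ (sym (sgn-σ (lo x) S)))))
          (∑-0 {n} λ T → term-drop (disjointᵇ S T) _ (∧-zeroʳ (⊆ᵇ (S ∪ T) U)))) (+-identityʳ _)))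
        (+-cong (double (hi x) (lo y) U) (double (σ (lo x)) (hi y) U))

    ∧E≈∙ : ∀ {n} (x y : E n) → x Ext.∧E y ≋ x ∙ y
    ∧E≈∙ {n} x y .at U = trans (sumList-allSubsets {n} (λ S → sumList (allSubsets n) (raw S)))
      (trans (∑-cong λ S → trans (sumList-allSubsets {n} (raw S)) (∑-cong (raw≈term S))) (double x y U))
      where
        raw : Subset n → Subset n → Carrier
        raw S T = [ disjointᵇ S T ∧ ≡ᵇ (S ∪ T) U ]· (Ext.negpow {n} (inv S T) * (x S * y T))
        raw≈term : ∀ S T → raw S T ≈ term x y U S T
        raw≈term S T = reflexive (≡.cong (λ s → [ disjointᵇ S T ∧ ≡ᵇ (S ∪ T) U ]· (s * (x S * y T))) (negpow≡sgn n (inv S T)))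

    module _ {n : ℕ} where
      foldr-ind : ∀ {a p} {A : Set a} (P : E n → Set p) (f : A → E n → E n) z → (∀ t r → P r → P (f t r)) → P z → ∀ ts → P (foldr f z ts)
      foldr-ind P f z step pz []       = pz
      foldr-ind P f z step pz (t ∷ ts) = step t _ (foldr-ind P f z step pz ts)

      -- Closure under sums is all that an elimination of `InIdeal` needs, since a member is by
      -- definition a finite sum of products a (g b).
      record Closed {p} (P : E n → Set p) : Set (c ⊔ ℓ ⊔ p) where
        field
          resp     : ∀ {x y} → x ≋ y → P x → P y
          𝟎-closed : P 𝟎
          ⊕-closed : ∀ {x y} → P x → P y → P (x ⊕ y)

      product≋ : ∀ (a g b : E n) → a Ext.∧E (g Ext.∧E b) ≋ a ∙ (g ∙ b)
      product≋ a g b = ≋-trans (∧E≈∙ a (g Ext.∧E b)) (∙ʳ.cong a (∧E≈∙ g b))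

      InIdeal-elim : ∀ {p} {P : E n → Set p} → Closed P → ∀ {gs} → All (λ g → ∀ a b → P (a ∙ (g ∙ b))) gs → ∀ {x} → Ext.InIdeal gs x → P x
      InIdeal-elim {P = P} cl {gs} gens {x} (ts , eq) = resp (≋-sym (pointwise eq))
        (foldr-ind P _ 𝟎 (λ { (a , k , b) r Pr → ⊕-closed (resp (≋-sym (product≋ a (lookup gs k) b)) (All.lookup gens (∈-lookup k) a b)) Pr }) 𝟎-closed ts)
        where open Closed cl

      module Ideal (gs : List (E n)) where
        private
          foldr-++ : ∀ {a} {A : Set a} (f : A → E n → E n) → (∀ t r → f t r ≋ f t 𝟎 ⊕ r) → (∀ t {r s} → r ≋ s → f t r ≋ f t s) → ∀ ts us → foldr f 𝟎 ts ⊕ foldr f 𝟎 us ≋ foldr f 𝟎 (ts ++ us)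
          foldr-++ f add cong []       us = pointwise λ U → +-identityˡ _
          foldr-++ f add cong (t ∷ ts) us = ≋-trans (⊕-cong (add t _) ≋-refl) (≋-trans
            (pointwise λ U → +-assoc _ _ _) (≋-trans (⊕-cong ≋-refl (foldr-++ f add cong ts us)) (≋-sym (add t _))))

        InIdeal-closed : Closed (Ext.InIdeal gs)
        InIdeal-closed = record
          { resp = λ x≋y (ts , eq) → ts , λ U → trans (sym (x≋y .at U)) (eq U)
          ; 𝟎-closed = [] , λ U → refl
          ; ⊕-closed = λ (ts , eq) (us , eq′) → ts ++ us , λ U → trans (+-cong (eq U) (eq′ U))
              (foldr-++ _ (λ { (a , k , b) r → pointwise λ U → +-congʳ (sym (+-identityʳ _)) })
                          (λ { (a , k , b) p → ⊕-cong ≋-refl p }) ts us .at U) }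

        open Closed InIdeal-closed public using () renaming (resp to InIdeal-resp; 𝟎-closed to InIdeal-𝟎; ⊕-closed to InIdeal-⊕)

        InIdeal-gen : ∀ {g} → g ∈ gs → ∀ a b → Ext.InIdeal gs (a ∙ (g ∙ b))
        InIdeal-gen g∈ a b = InIdeal-resp (product≋ a _ b)
          ((a , index g∈ , b) ∷ [] , λ U → trans (reflexive (≡.cong (λ g → (a Ext.∧E (g Ext.∧E b)) U) (lookup-index g∈))) (sym (+-identityʳ _)))

        InIdeal-gen₀ : ∀ {g} → g ∈ gs → Ext.InIdeal gs g
        InIdeal-gen₀ {g} g∈ = InIdeal-resp (≋-trans (∙-identityˡ (g ∙ 𝟏)) (∙-identityʳ g)) (InIdeal-gen g∈ 𝟏 𝟏)

        InIdeal-∙ˡ : ∀ y {x} → Ext.InIdeal gs x → Ext.InIdeal gs (y ∙ x)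
        InIdeal-∙ˡ y = InIdeal-elim
          (record { resp = λ p → InIdeal-resp (∙ʳ.cong y p) ; 𝟎-closed = InIdeal-resp (≋-sym (∙ʳ.𝟎-homo y)) InIdeal-𝟎
                  ; ⊕-closed = λ {x} {z} p q → InIdeal-resp (≋-sym (∙ʳ.⊕-homo y x z)) (InIdeal-⊕ p q) })
          (All.tabulate λ {g} g∈ a b → InIdeal-resp (∙-assoc y a (g ∙ b)) (InIdeal-gen g∈ (y ∙ a) b))

        InIdeal-· : ∀ k {x} → Ext.InIdeal gs x → Ext.InIdeal gs (k · x)
        InIdeal-· k {x} p = InIdeal-resp (≋-trans (∙ˡ.·-homo x k 𝟏) (·-cong refl (∙-identityˡ x))) (InIdeal-∙ˡ (k · 𝟏) p)

      InIdeal-⊆ : ∀ {gs hs : List (E n)} → (∀ {g} → g ∈ gs → g ∈ hs) → ∀ {x} → Ext.InIdeal gs x → Ext.InIdeal hs x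
      InIdeal-⊆ {hs = hs} sub = InIdeal-elim InIdeal-closed (All.tabulate λ g∈ → InIdeal-gen (sub g∈))
        where open Ideal hs

-- The Orlik-Solomon ideal as the span of dependent monomials and their boundaries.

module OrlikSolomon where
  open import Defs hiding (≡ᵇ)
  open import Level using (_⊔_)
  open import Data.Nat using (_≤_; _<_; _≡ᵇ_)
  open import Data.Fin.Subset using (⊥; ⁅_⁆; _∪_; _⊆_; _∉_)
  open import Data.Fin.Subset.Properties using (nonempty?; Empty-unique; p⊆p∪q; q⊆p∪q; ∪-idem)
  open import Data.List.Membership.Propositional.Properties using (∈-map⁺; ∈-filter⁺)
  import Data.List.Relation.Unary.All as All
  open import Data.List.Relation.Unary.All.Properties using (all-filter) renaming (map⁺ to All-map⁺)
  open RingSolver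
  open MatroidRank
  open Sums
  open ExteriorAlgebra
  open Bridge

  ⋖⇒∉ : ∀ {n} {U V : Subset n} {i} → U ⋖[ i ] V → i ∉ U
  ⋖⇒∉ (there b c) (there i∈) = ⋖⇒∉ c i∈

  ⋖⇒⊆∪ : ∀ {n} {U V : Subset n} {i} → U ⋖[ i ] V → V ⊆ U ∪ ⁅ i ⁆
  ⋖⇒⊆∪ here              here       = here
  ⋖⇒⊆∪ (here {U = U})    (there x∈) = there (p⊆p∪q ⊥ x∈)
  ⋖⇒⊆∪ (there inside c)  here       = here
  ⋖⇒⊆∪ (there b c)       (there x∈) = there (⋖⇒⊆∪ c x∈)

  ⊥⋖⇒≡⁅⁆ : ∀ {n} {V : Subset n} {i} → ⊥ ⋖[ i ] V → V ≡ ⁅ i ⁆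
  ⊥⋖⇒≡⁅⁆ here              = ≡.refl
  ⊥⋖⇒≡⁅⁆ (there outside c) = ≡.cong (outside ∷_) (⊥⋖⇒≡⁅⁆ c)

  module SameClosure {n} (M : Matroid n) where
    open Rank M

    -- same R V decides whether V and R have the same closure.
    same : Subset n → Subset n → Bool
    same R V = (r V ≡ᵇ r R) ∧ (r (V ∪ R) ≡ᵇ r R)

    same-refl : ∀ R → same R R ≡ true
    same-refl R rewrite ∪-idem R | ≡ᵇ-refl (r R) = ≡.refl

    same⇒ : ∀ R V → same R V ≡ true → r V ≡ r R × r (V ∪ R) ≡ r R
    same⇒ R V eq with r V ≡ᵇ r R in e₁ | r (V ∪ R) ≡ᵇ r R in e₂
    ... | true | true = ℕₚ.≡ᵇ⇒≡ (r V) (r R) (≡.subst Bool.T (≡.sym e₁) _) , ℕₚ.≡ᵇ⇒≡ (r (V ∪ R)) (r R) (≡.subst Bool.T (≡.sym e₂) _)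

    -- A dependent V covering an independent U has the rank of U and so the same closure. Hence a
    -- boundary of dependent monomials meets the coordinate of U only from within the flat of U.
    same-⋖ : ∀ R {U V i} → U ⋖[ i ] V → Indep U → Dependent M V → same R U ≡ same R V
    same-⋖ R {U} {V} U⋖V indU depV = ≡.cong₂ (λ a b → (a ≡ᵇ r R) ∧ (b ≡ᵇ r R)) rU≡rV
      (ℕₚ.≤-antisym (rank-mono (∪-lub (p⊆p∪q R ∘ U⊆V) (q⊆p∪q V R)))
        (ℕₚ.+-cancelˡ-≤ (r V) _ _ (ℕₚ.≤-trans
          (≡.subst (λ k → k ℕ.+ r (V ∪ R) ≤ r (U ∪ R) ℕ.+ r V) rU≡rV
            (submodular (U ∪ R) V (p⊆p∪q R) U⊆V (∪-lub (q⊆p∪q (U ∪ R) V) (p⊆p∪q V ∘ q⊆p∪q U R))))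
          (ℕₚ.≤-reflexive (ℕₚ.+-comm (r (U ∪ R)) (r V))))))
      where
        U⊆V : U ⊆ V
        U⊆V = ⋖⇒⊆ U⋖V
        rU≡rV : r U ≡ r V
        rU≡rV = ℕₚ.≤-antisym (rank-mono U⊆V)
          (≡.subst (r V ≤_) (≡.sym (indep⇒rank indU)) (ℕₚ.≤-pred (≡.subst (r V <_) (⋖⇒∣∣ U⋖V) (dep⇒rank< depV))))

  module OS {c ℓ : Level} (K : CommutativeRing c ℓ) where
    open CommutativeRing K hiding (zero)
    open IntegerSolver K
    open Recursive K
    open Summation K using ([_]·)
    open Translation K
    open import Algebra.Properties.Ring ring using (-0#≈0#)

    monomial-≢ : ∀ {n} (S U : Subset n) → S ≢ U → monomial S U ≈ 0#
    monomial-≢ []            []            S≢U = contradiction ≡.refl S≢U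
    monomial-≢ (outside ∷ S) (outside ∷ U) S≢U = monomial-≢ S U (S≢U ∘ ≡.cong (outside ∷_))
    monomial-≢ (outside ∷ S) (inside ∷ U)  S≢U = refl
    monomial-≢ (inside ∷ S)  (outside ∷ U) S≢U = refl
    monomial-≢ (inside ∷ S)  (inside ∷ U)  S≢U = monomial-≢ S U (S≢U ∘ ≡.cong (inside ∷_))

    monomial-diag : ∀ {n} (S : Subset n) → monomial S S ≈ 1#
    monomial-diag []            = refl
    monomial-diag (outside ∷ S) = monomial-diag S
    monomial-diag (inside ∷ S)  = monomial-diag S

    δ : ∀ {n} → Fin n → Fin n → Carrier
    δ zero    zero    = 1#
    δ zero    (suc j) = 0#
    δ (suc i) zero    = 0#
    δ (suc i) (suc j) = δ i j

    δ-≢ : ∀ {n} (i j : Fin n) → i ≡ j ⊎ δ i j ≈ 0#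
    δ-≢ zero    zero    = inj₁ ≡.refl
    δ-≢ zero    (suc j) = inj₂ refl
    δ-≢ (suc i) zero    = inj₂ refl
    δ-≢ (suc i) (suc j) = [ inj₁ ∘ ≡.cong suc , inj₂ ]′ (δ-≢ i j)

    pairing-δ : ∀ {n} (w : Fin n → Carrier) i → pairing w (δ i) ≈ w i
    pairing-δ {suc n} w zero    = trans (+-cong (*-identityʳ _) (pairing-0 (w ∘ suc))) (+-identityʳ _)
      where
        pairing-0 : ∀ {n} (w : Fin n → Carrier) → pairing w (λ _ → 0#) ≈ 0#
        pairing-0 {zero}  w = refl
        pairing-0 {suc n} w = trans (+-cong (zeroʳ _) (pairing-0 (w ∘ suc))) (+-identityʳ _)
    pairing-δ {suc n} w (suc i) = trans (+-cong (zeroʳ _) (pairing-δ (w ∘ suc) i)) (+-identityˡ _)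

    δ-vanish : ∀ {n} i (x : E n) W → (∀ V → V ⋖[ i ] W → x V ≈ 0#) → (linear (δ i) ∙ x) W ≈ 0#
    δ-vanish i x W x≈0 = trans (linear-local (δ i) x 𝟎 W local) (∙ʳ.𝟎-homo (linear (δ i)) .at W)
      where
        local : ∀ j V → V ⋖[ j ] W → δ i j * x V ≈ δ i j * 0#
        local j V V⋖W with δ-≢ i j
        ... | inj₁ ≡.refl = *-congˡ (x≈0 V V⋖W)
        ... | inj₂ δ≈0    = trans (*-congʳ δ≈0) (trans (zeroˡ _) (sym (zeroʳ _)))

    D-vanish : ∀ {n} w (x : E n) U → (∀ i V → U ⋖[ i ] V → x V ≈ 0#) → D w x U ≈ 0#
    D-vanish w x U x≈0 = trans (D-local w x 𝟎 U x≈0) (D.𝟎-homo w .at U)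

    ∂-δ : ∀ {n} i (x : E n) → x ≋ ∂ (linear (δ i) ∙ x) ⊕ linear (δ i) ∙ ∂ x
    ∂-δ i x .at U = sym (trans (+-congʳ (trans (D-homotopy ones (δ i) x .at U) (+-congʳ (trans (*-congʳ (pairing-δ ones i)) (*-identityˡ _)))))
      (solve 2 (λ a b → (a :+ :- b) :+ b := a) refl _ _))

    ⊹-linearˡ : ∀ {n} → Linear {n} (_⊹ 𝟎)
    ⊹-linearˡ = record
      { cong = λ p → split p ≋-refl
      ; ⊕-homo = λ x y → split ≋-refl (pointwise λ U → sym (+-identityʳ _))
      ; ·-homo = λ a x → split ≋-refl (pointwise λ U → sym (zeroʳ a)) }

    ⊹-linearʳ : ∀ {n} → Linear {n} (𝟎 ⊹_)
    ⊹-linearʳ = record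
      { cong = λ p → split ≋-refl p
      ; ⊕-homo = λ x y → split (pointwise λ U → sym (+-identityʳ _)) ≋-refl
      ; ·-homo = λ a x → split (pointwise λ U → sym (zeroʳ a)) ≋-refl }

    closed-∘ : ∀ {m n p} {P : E n → Set p} {f : E m → E n} → Closed P → Linear f → Closed (P ∘ f)
    closed-∘ cl F = record
      { resp = λ p → resp (F .cong p) ; 𝟎-closed = resp (≋-sym (𝟎-homo F)) 𝟎-closed
      ; ⊕-closed = λ {x} {y} p q → resp (≋-sym (F .⊕-homo x y)) (⊕-closed p q) }
      where open Closed cl

    by-monomials : ∀ {n p} {P : E n → Set p} → Closed P → ∀ x → (∀ U → P (x U · monomial U)) → P x
    by-monomials {zero} cl x terms = Closed.resp cl (base (*-identityʳ _)) (terms [])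
    by-monomials {suc n} {P = P} cl x terms = resp (split (pointwise λ U → +-identityʳ _) (pointwise λ U → +-identityˡ _))
      (⊕-closed
        (by-monomials (closed-∘ cl ⊹-linearˡ) (lo x) λ U → resp (split ≋-refl (pointwise λ V → zeroʳ _)) (terms (outside ∷ U)))
        (by-monomials (closed-∘ cl ⊹-linearʳ) (hi x) λ U → resp (split (pointwise λ V → zeroʳ _) ≋-refl) (terms (inside ∷ U))))
      where open Closed cl

    π : ∀ {n} → (Subset n → Bool) → E n → E n
    π b x U = [ b U ]· (x U)

    π-linear : ∀ {n} b → Linear (π {n} b)
    π-linear b = record { cong = λ p → pointwise λ U → c′ (b U) (p .at U) ; ⊕-homo = λ x y → pointwise λ U → s (b U) ; ·-homo = λ a x → pointwise λ U → m (b U) }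
      where
        c′ : ∀ d {x y} → x ≈ y → [ d ]· x ≈ [ d ]· y
        c′ true  p = p
        c′ false p = refl
        s : ∀ d {x y} → [ d ]· (x + y) ≈ [ d ]· x + [ d ]· y
        s true  = refl
        s false = sym (+-identityʳ _)
        m : ∀ d {a x} → [ d ]· (a * x) ≈ a * [ d ]· x
        m true  = refl
        m false = sym (zeroʳ _)

    π-vanish : ∀ {n} b (x : E n) U → x U ≈ 0# → π b x U ≈ 0#
    π-vanish b x U p with b U
    ... | true  = p
    ... | false = refl

    module _ {n} (M : Matroid n) where
      Dep : E n → Set ℓ
      Dep p = ∀ U → indep M U ≡ true → p U ≈ 0#

      -- The Orlik–Solomon ideal: since y ∙ ∂ q = ∂ (σ y ∙ q) - ∂ (σ y) ∙ q, it is the span of the e_U and ∂ e_U with U dependent.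
      record J (x : E n) : Set (c ⊔ ℓ) where
        constructor in-J
        field
          {p q} : E n
          dep-p : Dep p
          dep-q : Dep q
          eq    : x ≋ p ⊕ ∂ q

    module _ {n} {M : Matroid n} where
      Dep-𝟎 : Dep M 𝟎
      Dep-𝟎 U _ = refl

      Dep-⊕ : ∀ {p q} → Dep M p → Dep M q → Dep M (p ⊕ q)
      Dep-⊕ dp dq U i = trans (+-cong (dp U i) (dq U i)) (+-identityʳ _)

      Dep-⊖ : ∀ {p} → Dep M p → Dep M (⊖ p)
      Dep-⊖ dp U i = trans (-‿cong (dp U i)) -0#≈0#

      Dep-∙ˡ : ∀ y {p} → Dep M p → Dep M (y ∙ p)
      Dep-∙ˡ y {p} dp U i = ∙-vanishʳ y p U λ V V⊆U → dp V (indep-down M U V V⊆U i)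

      Dep-∙ʳ : ∀ y {p} → Dep M p → Dep M (p ∙ y)
      Dep-∙ʳ y {p} dp U i = ∙-vanishˡ p y U λ V V⊆U → dp V (indep-down M U V V⊆U i)

      J-resp : ∀ {x y} → x ≋ y → J M x → J M y
      J-resp x≋y (in-J dp dq eq) = in-J dp dq (≋-trans (≋-sym x≋y) eq)

      J-Dep : ∀ {p} → Dep M p → J M p
      J-Dep dp = in-J dp Dep-𝟎 (pointwise λ U → sym (trans (+-congˡ (D.𝟎-homo ones .at U)) (+-identityʳ _)))

      J-∂Dep : ∀ {q} → Dep M q → J M (∂ q)
      J-∂Dep dq = in-J Dep-𝟎 dq (pointwise λ U → sym (+-identityˡ _))

      J-⊕ : ∀ {x y} → J M x → J M y → J M (x ⊕ y)
      J-⊕ (in-J {p} {q} dp dq eq) (in-J {p′} {q′} dp′ dq′ eq′) = in-J (Dep-⊕ dp dp′) (Dep-⊕ dq dq′) (pointwise λ U →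
        trans (+-cong (eq .at U) (eq′ .at U)) (trans (solve 4 (λ a b c d → (a :+ b) :+ (c :+ d) := (a :+ c) :+ (b :+ d)) refl _ _ _ _)
          (+-congˡ (sym (D.⊕-homo ones q q′ .at U)))))

      J-𝟎 : J M 𝟎
      J-𝟎 = J-Dep Dep-𝟎

      J-closed : Closed (J M)
      J-closed = record { resp = J-resp ; 𝟎-closed = J-𝟎 ; ⊕-closed = J-⊕ }

      J-∙ˡ : ∀ y {x} → J M x → J M (y ∙ x)
      J-∙ˡ y (in-J {p} {q} dp dq eq) = J-resp
        (pointwise λ U → trans (+-congˡ (+-congʳ (trans (D-∙ ones (σ y) q .at U) (+-congˡ (∙-cong (σ-involutive y) ≋-refl .at U)))))
          (trans (solve 3 (λ a b c → a :+ ((b :+ c) :+ :- b) := a :+ c) refl _ _ _)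
            (sym (trans (∙ʳ.cong y eq .at U) (∙ʳ.⊕-homo y p (∂ q) .at U)))))
        (J-⊕ (J-Dep (Dep-∙ˡ y dp)) (J-⊕ (J-∂Dep (Dep-∙ˡ (σ y) dq)) (J-Dep (Dep-⊖ (Dep-∙ˡ (∂ (σ y)) dq)))))

      J-∙ʳ : ∀ y {x} → J M x → J M (x ∙ y)
      J-∙ʳ y (in-J {p} {q} dp dq eq) = J-resp
        (pointwise λ U → trans (+-congˡ (+-congʳ (D-∙ ones q y .at U)))
          (trans (solve 3 (λ a b c → a :+ ((b :+ c) :+ :- c) := a :+ b) refl _ _ _)
            (sym (trans (∙ˡ.cong y eq .at U) (∙ˡ.⊕-homo y p (∂ q) .at U)))))
        (J-⊕ (J-Dep (Dep-∙ʳ y dp)) (J-⊕ (J-∂Dep (Dep-∙ʳ y dq)) (J-Dep (Dep-⊖ (Dep-∙ʳ (∂ y) (λ U i → σ-vanish q U (dq U i)))))))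

      J-· : ∀ a {x} → J M x → J M (a · x)
      J-· a {x} jx = J-resp (≋-trans (∙ˡ.·-homo x a 𝟏) (·-cong refl (∙-identityˡ x))) (J-∙ˡ (a · 𝟏) jx)

      J-⊖ : ∀ {x} → J M x → J M (⊖ x)
      J-⊖ {x} jx = J-resp (≋-sym (⊖≋-1· x)) (J-· (- 1#) jx)

      J-∂ : ∀ {x} → J M x → J M (∂ x)
      J-∂ (in-J {p} {q} dp dq eq) = J-resp
        (pointwise λ U → sym (trans (D.cong ones eq .at U) (trans (D.⊕-homo ones p (∂ q) .at U)
          (trans (+-congˡ (D-square ones q .at U)) (+-identityʳ _)))))
        (J-∂Dep dp)

      InIdeal⇒J : ∀ {x} → Ext.InIdeal (Ext.OSgens M) x → J M x
      InIdeal⇒J = InIdeal-elim J-closed (All-map⁺ (All.map gen (all-filter (λ S → indep M S Bool.≟ false) (allSubsets n))))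
        where
          gen : ∀ {S} → indep M S ≡ false → ∀ a b → J M (a ∙ (Ext.∂e S ∙ b))
          gen {S} dep a b = J-∙ˡ a (J-∙ʳ b (J-resp (≋-sym (∂e≈∂ S)) (J-∂Dep λ U i →
            monomial-≢ S U λ { ≡.refl → case ≡.trans (≡.sym i) dep of λ () })))

      J⇒InIdeal : ∀ {x} → J M x → Ext.InIdeal (Ext.OSgens M) x
      J⇒InIdeal (in-J {p} {q} dp dq eq) = InIdeal-resp (≋-sym eq) (InIdeal-⊕
        (by-monomials InIdeal-closed p λ U → summand id (λ a {V} → ≋-refl {x = a · monomial V}) p dp U (in-ideal U))
        (by-monomials (closed-∘ InIdeal-closed (D-linear ones)) q λ U → summand ∂ (λ a {V} → ≋-sym (D.·-homo ones a (monomial V))) q dq U (∂-in-ideal U)))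
        where
          open Ideal (Ext.OSgens M)
          I : E n → Set (c ⊔ ℓ)
          I = Ext.InIdeal (Ext.OSgens M)
          ∂-in-ideal : ∀ U → indep M U ≡ false → I (∂ (monomial U))
          ∂-in-ideal U dep = InIdeal-resp (∂e≈∂ U)
            (InIdeal-gen₀ (∈-map⁺ Ext.∂e (∈-filter⁺ (λ S → indep M S Bool.≟ false) (∈-allSubsets U) dep)))
          in-ideal : ∀ U → indep M U ≡ false → I (monomial U)
          in-ideal U dep with nonempty? U
          ... | no empty rewrite Empty-unique empty with () ← ≡.trans (≡.sym (indep-∅ M)) dep
          -- For i ∈ U the product e_i e_U vanishes, so the homotopy formula reduces to e_U = e_i ∂
          -- e_U and puts the monomial itself into the ideal generated by the boundaries.
          ... | yes (i , i∈U) = InIdeal-resp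
            (≋-sym (≋-trans (∂-δ i (monomial U)) (pointwise λ W → trans (+-congʳ (trans (D.cong ones δU≋𝟎 .at W) (D.𝟎-homo ones .at W))) (+-identityˡ _))))
            (InIdeal-∙ˡ (linear (δ i)) (∂-in-ideal U dep))
            where
              δU≋𝟎 : linear (δ i) ∙ monomial U ≋ 𝟎
              δU≋𝟎 .at W = δ-vanish i (monomial U) W λ V V⋖W → monomial-≢ U V λ { ≡.refl → ⋖⇒∉ V⋖W i∈U }
          summand : ∀ f → (∀ a {V} → a · f (monomial V) ≋ f (a · monomial V)) → ∀ p → Dep M p → ∀ U → (indep M U ≡ false → I (f (monomial U))) → I (f (p U · monomial U))
          summand f hom p dp U gen with indep M U in eqU
          ... | false = InIdeal-resp (hom (p U) {U}) (InIdeal-· (p U) (gen ≡.refl))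
          ... | true  = InIdeal-resp (≋-trans (pointwise λ V → sym (trans (*-congʳ (dp U eqU)) (zeroˡ _))) (hom (p U) {U})) InIdeal-𝟎

-- The nbc basis of E/J by deletion and contraction.

module NBC where
  open import Defs hiding (≡ᵇ)
  open import Data.Nat using (_≤_; _<_; _≡ᵇ_; z≤n; s≤s)
  open import Data.Fin.Properties using (any?)
  open import Data.Fin.Subset using (⊥; ⁅_⁆; _∪_; _⊆_; _∈_)
  open import Data.Fin.Subset.Properties using (nonempty?; Empty-unique; p⊆p∪q; q⊆p∪q; ⊆-min; ∣⁅x⁆∣≡1; ∣p∣≤n)
  import Data.List.Membership.Propositional as L
  open import Data.Empty using (⊥-elim)
  open RingSolver
  open MatroidRank
  open Sums
  open ExteriorAlgebra
  open Bridge
  open OrlikSolomon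

  -- The sets without broken circuits for the order in which 0 is the largest element, a broken
  -- circuit being a circuit minus its smallest element in that order. For a nonloop 0 those
  -- avoiding 0 are the nbc sets of the deletion, those containing 0 are 0 plus an nbc set of the
  -- contraction; if 0 is a loop there are none.
  mutual
    nbc : ∀ {n} → Matroid n → Subset n → Bool
    nbc M []      = true
    nbc M (b ∷ U) = nbc-step M _ ≡.refl b U

    -- The outcome `d` of the loop test travels with its equation, because `contract` consumes that
    -- equation and proofs can then split on `d`.
    nbc-step : ∀ {n} (M : Matroid (suc n)) d → indep M (inside ∷ ⊥) ≡ d → Bool → Subset n → Bool
    nbc-step M true  nl outside U = nbc (delete M) U
    nbc-step M true  nl inside  U = nbc (contract M nl) U
    nbc-step M false _  b       U = false

  module BrokenCircuits {c ℓ : Level} (K : CommutativeRing c ℓ) where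
    open CommutativeRing K hiding (zero)
    open IntegerSolver K
    open Recursive K
    open Summation K using ([_]·)
    open Translation K
    open OS K
    open import Algebra.Properties.Ring ring using (-0#≈0#)

    -- Taking the coefficient of e₀ anticommutes with ∂, so it induces the residue map from E/J(M)
    -- to E/J of the contraction.
    J-hi : ∀ {n} {M : Matroid (suc n)} (nl : NonLoop M) {x} → J M x → J (contract M nl) (hi x)
    J-hi nl (in-J {p} {q} dp dq eq) = J-resp (≋-sym (hi-cong eq))
      (J-⊕ (J-Dep λ U → dp (inside ∷ U)) (J-⊖ (J-∂Dep λ U → dq (inside ∷ U))))

    -- For y = p + ∂ q one has ∂(-e₀q) = -q + e₀ ∂ q, so e₀ y - q = e₀ p + ∂(-e₀q) lies in J(M): the
    -- lower half is a = -q.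
    J-lift : ∀ {n} {M : Matroid (suc n)} (nl : NonLoop M) {y} → J (contract M nl) y → ∃ λ a → J M (a ⊹ y)
    J-lift {n} {M} nl (in-J {p} {q} dp dq eq) = ⊖ q ,
      in-J {p = 𝟎 ⊹ p} {q = 𝟎 ⊹ ⊖ q} (inside-dep p dp) (inside-dep (⊖ q) (λ U i → trans (-‿cong (dq U i)) -0#≈0#))
        (split (pointwise λ U → sym (trans (+-congˡ (trans (+-congˡ (D.𝟎-homo ones .at U)) (trans (+-identityʳ _) (*-identityˡ _)))) (+-identityˡ _)))
          (pointwise λ U → trans (eq .at U) (+-congˡ (sym (trans (-‿cong (D.⊖-homo ones q .at U)) (solve 1 (λ a → :- :- a := a) refl _))))))
      where
        inside-dep : ∀ p → Dep (contract M nl) p → Dep M (𝟎 ⊹ p)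
        inside-dep p dp (outside ∷ U) i = refl
        inside-dep p dp (inside ∷ U)  i = dp U i

    ∂-⊹𝟎 : ∀ {n} (x : E n) → ∂ (x ⊹ 𝟎) ≋ ∂ x ⊹ 𝟎
    ∂-⊹𝟎 x = split (pointwise λ U → trans (+-congʳ (zeroʳ _)) (+-identityˡ _))
      (pointwise λ U → trans (-‿cong (D.𝟎-homo ones .at U)) -0#≈0#)

    J-extend : ∀ {n} {M : Matroid (suc n)} {x} → J (delete M) x → J M (x ⊹ 𝟎)
    J-extend {n} {M} (in-J {p} {q} dp dq eq) = in-J {p = p ⊹ 𝟎} {q = q ⊹ 𝟎} (outside-dep p dp) (outside-dep q dq)
      (≋-trans (split eq (pointwise λ U → sym (+-identityʳ _))) (⊕-cong {x = p ⊹ 𝟎} ≋-refl (≋-sym (∂-⊹𝟎 q))))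
      where
        outside-dep : ∀ p → Dep (delete M) p → Dep M (p ⊹ 𝟎)
        outside-dep p dp (outside ∷ U) i = dp U i
        outside-dep p dp (inside ∷ U)  i = refl

    -- J is graded by flats.
    J-same : ∀ {n} {M : Matroid n} R {x} → J M x → J M (π (SameClosure.same M R) x)
    J-same {n} {M} R (in-J {p} {q} dp dq eq) = in-J {p = π s p ⊕ (π s (∂ q) ⊕ ⊖ ∂ (π s q))} {q = π s q}
      (λ U i → trans (+-cong (π-vanish s p U (dp U i)) (commutator U i)) (+-identityʳ _))
      (λ U i → π-vanish s q U (dq U i))
      (pointwise λ U → trans (π-linear s .cong eq .at U) (trans (π-linear s .⊕-homo p (∂ q) .at U)
        (solve 3 (λ a b c → a :+ b := (a :+ (b :+ :- c)) :+ c) refl _ _ _)))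
      where
        s = SameClosure.same M R
        -- At an independent U the vector ∂ q sees only dependent covers of U, and all of these are
        -- in the class of U or none is; so projecting before or after ∂ gives the same coordinate.
        commutator : ∀ U → indep M U ≡ true → π s (∂ q) U + - ∂ (π s q) U ≈ 0#
        commutator U i with s U in sU
        ... | true  = trans (+-congˡ (-‿cong (D-local ones (π s q) q U agree))) (-‿inverseʳ _)
          where
            agree : ∀ i V → U ⋖[ i ] V → π s q V ≈ q V
            agree j V c with indep M V in dV
            ... | true  = trans (π-vanish s q V (dq V dV)) (sym (dq V dV))
            ... | false rewrite ≡.trans (≡.sym (SameClosure.same-⋖ M R c i dV)) sU = refl
        ... | false = trans (+-identityˡ _) (trans (-‿cong (D-vanish ones (π s q) U vanish)) -0#≈0#)
          where
            vanish : ∀ i V → U ⋖[ i ] V → π s q V ≈ 0#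
            vanish j V c with indep M V in dV
            ... | true  = π-vanish s q V (dq V dV)
            ... | false rewrite ≡.trans (≡.sym (SameClosure.same-⋖ M R c i dV)) sU = refl

    J-⊥ : ∀ {n} {M : Matroid n} → Loopless M → ∀ {x} → J M x → x ⊥ ≈ 0#
    J-⊥ {M = M} loopless (in-J {p} {q} dp dq eq) = trans (eq .at ⊥) (trans
      (+-cong (dp ⊥ (indep-∅ M)) (D-vanish ones q ⊥ λ i V c → ≡.subst (λ V → q V ≈ 0#) (≡.sym (⊥⋖⇒≡⁅⁆ c)) (dq ⁅ i ⁆ (loopless i))))
      (+-identityʳ _))

    -- The obstacle is that the witnesses p, q for `x ⊹ 𝟎` may involve element 0 and cannot simply
    -- be restricted. Instead x is cut into pieces, one closure class each; if i lies in that
    -- closure, e_i times the piece is supported on dependent sets, and the piece is recovered from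
    -- its boundary, which has smaller degree. `k` is a strict bound on the degrees occurring in x.
    J-delete : ∀ {n} {M : Matroid (suc n)} → NonLoop M → ∀ k x → (∀ U → k ≤ ∣ U ∣ → x U ≈ 0#) → J M (x ⊹ 𝟎) → J (delete M) x
    J-delete nl zero x x≈0 jx = J-resp (pointwise λ U → sym (x≈0 U z≤n)) J-𝟎
    J-delete {n} {M} nl (suc k) x x≈0 jx = peel (allSubsets n) x x≈0 jx (λ U → inj₁ (∈-allSubsets U))
      where
        open SameClosure (delete M)
        open Rank (delete M)

        piece : E n → Subset n → E n
        piece x R = π (same R) x

        degree-piece : ∀ {x} → (∀ U → suc k ≤ ∣ U ∣ → x U ≈ 0#) → ∀ R U → suc k ≤ ∣ U ∣ → piece x R U ≈ 0#
        degree-piece {x} x≈0 R U k≤ = π-vanish (same R) x U (x≈0 U k≤)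

        -- Sets avoiding 0 have the same rank in M and in the deletion, so the class of
        -- `outside ∷ R` in M restricts to the class of R, and the grading of J(M) can be used.
        J-piece : ∀ {x} R → J M (x ⊹ 𝟎) → J M (piece x R ⊹ 𝟎)
        J-piece {x} R jx = J-resp (split
          (pointwise λ U → reflexive (≡.cong (λ b → [ b ]· (x U)) (≡.cong₂ (λ a b → a ∧ b)
            (≡.cong₂ _≡ᵇ_ (rank-outside M U) (rank-outside M R)) (≡.cong₂ _≡ᵇ_ (rank-outside M (U ∪ R)) (rank-outside M R)))))
          (pointwise λ U → π-vanish (SameClosure.same M (outside ∷ R)) (x ⊹ 𝟎) (inside ∷ U) refl))
          (J-same (outside ∷ R) jx)

        homotopy : ∀ {z} i → Dep (delete M) (linear (δ i) ∙ z) → J (delete M) (∂ z) → J (delete M) z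
        homotopy {z} i dz jz = J-resp (≋-sym (∂-δ i z)) (J-⊕ (J-∂Dep dz) (J-∙ˡ (linear (δ i)) jz))

        -- If V is in the class of R and V ∪ {i} were independent, its rank would exceed |V| ≥ r(V)
        -- = r(R), although i adds nothing to the rank of R.
        cone-dep : ∀ x R i → r (R ∪ ⁅ i ⁆) ≡ r R → Dep (delete M) (linear (δ i) ∙ piece x R)
        cone-dep x R i rRi W indW = δ-vanish i (piece x R) W λ V c → go V c
          where
            go : ∀ V → V ⋖[ i ] W → piece x R V ≈ 0#
            go V c with same R V in sV
            ... | false = refl
            ... | true with rV , rVR ← same⇒ R V sV = contradiction rW≤ (ℕₚ.<⇒≱ (≡.subst₂ _<_ rV ≡.refl (ℕₚ.≤-<-trans (rank≤∣∣ V)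
                  (≡.subst (∣ V ∣ <_) (≡.sym (≡.trans (indep⇒rank indW) (⋖⇒∣∣ c))) ℕₚ.≤-refl))))
              where
                W⊆ : W ⊆ (V ∪ R) ∪ (R ∪ ⁅ i ⁆)
                W⊆ = ∪-lub (p⊆p∪q _ ∘ p⊆p∪q R) (q⊆p∪q (V ∪ R) _ ∘ q⊆p∪q R _) ∘ ⋖⇒⊆∪ c
                rW≤ : r W ≤ r R
                rW≤ = ℕₚ.+-cancelˡ-≤ (r R) _ _ (ℕₚ.≤-trans (submodular (V ∪ R) (R ∪ ⁅ i ⁆) (q⊆p∪q V R) (p⊆p∪q _) W⊆)
                  (ℕₚ.≤-reflexive (≡.cong₂ ℕ._+_ rVR rRi)))

        -- Here i may also lie in R, so the hypothesis says that the closure of R is empty. Then ∅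
        -- is the only set in the class, M has no loops, and the constant coefficient of a member of
        -- J(M) is 0.
        closed-flat-dep : ∀ x R → J M (x ⊹ 𝟎) → ¬ (∃ λ i → r (R ∪ ⁅ i ⁆) ≡ r R) → Dep (delete M) (piece x R)
        closed-flat-dep x R jx none U indU with same R U in sU
        ... | false = refl
        ... | true with rU , rUR ← same⇒ R U sU with nonempty? U
        ...   | yes (i , i∈U) = ⊥-elim (none (i , ℕₚ.≤-antisym
                  (≡.subst (r (R ∪ ⁅ i ⁆) ≤_) rUR (rank-mono (∪-lub (q⊆p∪q U R) (p⊆p∪q R ∘ ⊆-⁅⁆ i∈U)))) (rank-mono (p⊆p∪q _))))
        ...   | no empty = ≡.subst (λ U → x U ≈ 0#) (≡.sym (Empty-unique empty)) (J-⊥ loopless jx)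
          where
            rank-loop-∪ : ∀ i → indep (delete M) ⁅ i ⁆ ≡ false → r (R ∪ ⁅ i ⁆) ≤ r R
            rank-loop-∪ i dep = ℕₚ.≤-trans (ℕₚ.m≤n+m _ (r ⊥)) (ℕₚ.≤-trans
              (submodular R ⁅ i ⁆ (⊆-min R) (⊆-min ⁅ i ⁆) id)
              (ℕₚ.≤-reflexive (≡.trans (≡.cong (r R ℕ.+_) (ℕₚ.n≤0⇒n≡0 (ℕₚ.≤-pred (≡.subst (r ⁅ i ⁆ <_) (∣⁅x⁆∣≡1 i) (dep⇒rank< dep))))) (ℕₚ.+-identityʳ _))))
            loopless : Loopless M
            loopless zero    = nl
            loopless (suc i) with indep M ⁅ suc i ⁆ in di
            ... | true  = ≡.refl
            ... | false = ⊥-elim (none (i , ℕₚ.≤-antisym (rank-loop-∪ i di) (rank-mono (p⊆p∪q _))))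

        J-delete-piece : ∀ x R → (∀ U → suc k ≤ ∣ U ∣ → x U ≈ 0#) → J M (x ⊹ 𝟎) → J (delete M) (piece x R)
        J-delete-piece x R x≈0 jx with any? (λ i → r (R ∪ ⁅ i ⁆) ℕ.≟ r R)
        ... | no none = J-Dep (closed-flat-dep x R jx none)
        ... | yes (i , rRi) = homotopy i (cone-dep x R i rRi) (J-delete nl k (∂ (piece x R))
                (λ U k≤ → D-vanish ones (piece x R) U λ i V c → degree-piece x≈0 R V (≡.subst (suc k ≤_) (≡.sym (⋖⇒∣∣ c)) (s≤s k≤)))
                (J-resp (∂-⊹𝟎 (piece x R)) (J-∂ (J-piece R jx))))

        -- Subtracting the piece of R clears at least the coordinate at R and never revives a
        -- cleared one. One pass over all subsets therefore exhausts x, without choosing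
        -- representatives of the flats.
        peel : ∀ Rs x → (∀ U → suc k ≤ ∣ U ∣ → x U ≈ 0#) → J M (x ⊹ 𝟎) → (∀ U → U L.∈ Rs ⊎ x U ≈ 0#) → J (delete M) x
        peel [] x x≈0 jx supp = J-resp (pointwise λ U → sym (zero-at U)) J-𝟎
          where
            zero-at : ∀ U → x U ≈ 0#
            zero-at U with inj₂ p ← supp U = p
        peel (R ∷ Rs) x x≈0 jx supp = J-resp
          (pointwise λ U → solve 2 (λ a b → b :+ (a :+ :- b) := a) refl (x U) (piece x R U))
          (J-⊕ (J-delete-piece x R x≈0 jx) (peel Rs rest rest≈0 j-rest supp′))
          where
            rest : E n
            rest = x ⊕ ⊖ piece x R
            difference : ∀ U → x U ≈ 0# → rest U ≈ 0#
            difference U p = trans (+-cong p (trans (-‿cong (π-vanish (same R) x U p)) -0#≈0#)) (+-identityʳ _)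
            rest≈0 : ∀ U → suc k ≤ ∣ U ∣ → rest U ≈ 0#
            rest≈0 U k≤ = difference U (x≈0 U k≤)
            j-rest : J M (rest ⊹ 𝟎)
            j-rest = J-resp (split ≋-refl (pointwise λ U → trans (+-congˡ -0#≈0#) (+-identityʳ _))) (J-⊕ jx (J-⊖ (J-piece R jx)))
            supp′ : ∀ U → U L.∈ Rs ⊎ rest U ≈ 0#
            supp′ U with supp U
            ... | inj₁ (here ≡.refl) = inj₂ (trans (+-congˡ (-‿cong (reflexive (≡.cong (λ b → [ b ]· (x U)) (same-refl R))))) (-‿inverseʳ _))
            ... | inj₁ (there U∈)    = inj₁ U∈
            ... | inj₂ p             = inj₂ (difference U p)

    SupportedOn : ∀ {n} → (Subset n → Bool) → E n → Set ℓ
    SupportedOn P x = ∀ U → P U ≡ false → x U ≈ 0#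

    -- The residue lies in the ideal of the contraction, so induction kills the upper half; only
    -- then does x have the shape `lo x ⊹ 𝟎` to which `J-delete` applies.
    nbc-independent : ∀ {n} (M : Matroid n) {x} → SupportedOn (nbc M) x → J M x → x ≋ 𝟎
    nbc-independent {zero} M supp (in-J dp dq eq) = base (trans (eq .at []) (trans (+-congʳ (dp [] (indep-∅ M))) (+-identityʳ 0#)))
    nbc-independent {suc n} M {x} supp jx = go _ ≡.refl λ b U → supp (b ∷ U)
      where
        go : ∀ d (eq : indep M (inside ∷ ⊥) ≡ d) → (∀ b U → nbc-step M d eq b U ≡ false → x (b ∷ U) ≈ 0#) → x ≋ 𝟎
        go false eq supp = split (pointwise λ U → supp outside U ≡.refl) (pointwise λ U → supp inside U ≡.refl)
        go true  nl supp = split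
          (nbc-independent (delete M) (supp outside)
            (J-delete nl (suc n) (lo x) (λ U n<∣U∣ → contradiction (∣p∣≤n U) (ℕₚ.<⇒≱ n<∣U∣))
              (J-resp (split ≋-refl hi≋𝟎) jx)))
          hi≋𝟎
          where
            hi≋𝟎 : hi x ≋ 𝟎
            hi≋𝟎 = nbc-independent (contract M nl) (supp inside) (J-hi nl jx)

    J-loop : ∀ {n} {M : Matroid (suc n)} → indep M (inside ∷ ⊥) ≡ false → ∀ x → J M x
    J-loop {n} {M} loop x = J-resp (≋-sym (∂-δ zero x)) (J-⊕ (J-∂Dep (cone x)) (J-Dep (cone (∂ x))))
      where
        cone : ∀ x → Dep M (linear (δ zero) ∙ x)
        cone x U ind = δ-vanish zero x U λ V c → contradiction (≡.trans (≡.sym (indep-down M U _ (⊆-⁅⁆ (⋖⇒∈ c)) ind)) loop) λ ()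

    -- The upper half is reduced first, since lifting its relation into J(M) changes the lower half
    -- by `a`; the corrected lower half is then reduced in the deletion.
    nbc-spanning : ∀ {n} (M : Matroid n) x → ∃ λ y → SupportedOn (nbc M) y × J M (x ⊕ ⊖ y)
    nbc-spanning {zero} M x = x , (λ { [] () }) , J-resp (pointwise λ U → sym (-‿inverseʳ _)) J-𝟎
    nbc-spanning {suc n} M x = let y , supp , jx = go _ ≡.refl in y , (λ { (b ∷ U) → supp b U }) , jx
      where
        go : ∀ d (eq : indep M (inside ∷ ⊥) ≡ d) → ∃ λ y → (∀ b U → nbc-step M d eq b U ≡ false → y (b ∷ U) ≈ 0#) × J M (x ⊕ ⊖ y)
        go false loop = 𝟎 , (λ _ U _ → refl) , J-loop loop _
        go true nl with nbc-spanning (contract M nl) (hi x)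
        ... | y₁ , supp₁ , j₁ with J-lift nl j₁
        ...   | a , ja with nbc-spanning (delete M) (lo x ⊕ ⊖ a)
        ...     | y₀ , supp₀ , j₀ = y₀ ⊹ y₁ , (λ { outside → supp₀ ; inside → supp₁ }) ,
          J-resp (split (pointwise λ U → solve 3 (λ x a y → a :+ ((x :+ :- a) :+ :- y) := x :+ :- y) refl _ _ _) (pointwise λ U → +-identityʳ _))
            (J-⊕ ja (J-extend j₀))

-- Counting subsets, and finite search under double negation.

module Counting where
  open import Data.Nat using (_+_; _<_; _≡ᵇ_)
  open import Data.List using (filter; length)
  open import Data.List.Properties using (length-++; filter-++)
  open import Relation.Binary.PropositionalEquality
  open import Defs using (allSubsets)

  # : ∀ {n} → (Subset n → Bool) → ℕ
  # {zero}  P = if P [] then 1 else 0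
  # {suc n} P = # (P ∘ (inside ∷_)) + # (P ∘ (outside ∷_))

  #-positive : ∀ {n} (P : Subset n → Bool) → 0 < # P → ∃ λ V → P V ≡ true
  #-positive {zero} P 0<# with P [] in eq
  ... | true = [] , eq
  #-positive {suc n} P 0<# with # (P ∘ (inside ∷_)) in eq
  ... | zero  with V , PV ← #-positive (P ∘ (outside ∷_)) 0<# = outside ∷ V , PV
  ... | suc _ with V , PV ← #-positive (P ∘ (inside ∷_)) (subst (0 <_) (sym eq) (ℕ.s≤s ℕ.z≤n)) = inside ∷ V , PV

  inDegree : ∀ {n} → (Subset n → Bool) → ℕ → Subset n → Bool
  inDegree P k U = P U ∧ (∣ U ∣ ≡ᵇ k)

  remove : ∀ {n} → Subset n → (Subset n → Bool) → Subset n → Bool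
  remove []            P []            = false
  remove (inside ∷ V)  P (inside ∷ U)  = remove V (P ∘ (inside ∷_)) U
  remove (inside ∷ V)  P (outside ∷ U) = P (outside ∷ U)
  remove (outside ∷ V) P (inside ∷ U)  = P (inside ∷ U)
  remove (outside ∷ V) P (outside ∷ U) = remove V (P ∘ (outside ∷_)) U

  #-remove : ∀ {n} V (P : Subset n → Bool) → P V ≡ true → # P ≡ suc (# (remove V P))
  #-remove []            P PV rewrite PV = refl
  #-remove (inside ∷ V)  P PV = cong (_+ # (P ∘ (outside ∷_))) (#-remove V (P ∘ (inside ∷_)) PV)
  #-remove (outside ∷ V) P PV = trans (cong (# (P ∘ (inside ∷_)) +_) (#-remove V (P ∘ (outside ∷_)) PV)) (ℕₚ.+-suc _ _)

  remove-self : ∀ {n} V (P : Subset n → Bool) → remove V P V ≡ false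
  remove-self []            P = refl
  remove-self (inside ∷ V)  P = remove-self V _
  remove-self (outside ∷ V) P = remove-self V _

  remove-other : ∀ {n} V (P : Subset n → Bool) U → U ≢ V → remove V P U ≡ P U
  remove-other []            P []            U≢V = contradiction refl U≢V
  remove-other (inside ∷ V)  P (inside ∷ U)  U≢V = remove-other V _ U (U≢V ∘ cong (inside ∷_))
  remove-other (inside ∷ V)  P (outside ∷ U) U≢V = refl
  remove-other (outside ∷ V) P (inside ∷ U)  U≢V = refl
  remove-other (outside ∷ V) P (outside ∷ U) U≢V = remove-other V _ U (U≢V ∘ cong (outside ∷_))

  members : ∀ {n} → (Subset n → Bool) → List (Subset n)
  members {n} P = filter (λ U → P U Bool.≟ true) (allSubsets n)

  length-members : ∀ {n} (P : Subset n → Bool) → length (members P) ≡ # P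
  length-members {n} P = go P
    where
      filter-map : ∀ {A B : Set} (f : A → B) (P : B → Bool) xs →
        length (filter (λ b → P b Bool.≟ true) (List.map f xs)) ≡ length (filter (λ a → P (f a) Bool.≟ true) xs)
      filter-map f P []       = refl
      filter-map f P (x ∷ xs) with does (P (f x) Bool.≟ true)
      ... | true  = cong suc (filter-map f P xs)
      ... | false = filter-map f P xs
      go : ∀ {n} (P : Subset n → Bool) → length (members P) ≡ # P
      go {zero} P with P []
      ... | true  = refl
      ... | false = refl
      go {suc n} P = trans (cong length (filter-++ (λ U → P U Bool.≟ true) (List.map (inside ∷_) (allSubsets n)) _))
        (trans (length-++ (filter (λ U → P U Bool.≟ true) (List.map (inside ∷_) (allSubsets n))))
          (cong₂ _+_ (trans (filter-map (inside ∷_) P (allSubsets n)) (go (P ∘ (inside ∷_))))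
                     (trans (filter-map (outside ∷_) P (allSubsets n)) (go (P ∘ (outside ∷_))))))

  ¬¬-or : ∀ {a} {A : Set a} → ¬ ¬ (A ⊎ ¬ A)
  ¬¬-or k = k (inj₂ (k ∘ inj₁))

  -- Finitely many undecided alternatives can be decided one after the other as long as the goal is
  -- negative.
  ¬¬-all : ∀ {n a b} {A : Subset n → Set a} {B : Subset n → Set b} → (∀ V → ¬ ¬ (A V ⊎ B V)) → ¬ ¬ ((∀ V → A V) ⊎ ∃ B)
  ¬¬-all {zero} f k = f [] λ { (inj₁ a) → k (inj₁ λ { [] → a }) ; (inj₂ b) → k (inj₂ ([] , b)) }
  ¬¬-all {suc n} f k = ¬¬-all (f ∘ (inside ∷_)) λ
    { (inj₂ (V , b)) → k (inj₂ (inside ∷ V , b))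
    ; (inj₁ allIn)   → ¬¬-all (f ∘ (outside ∷_)) λ
      { (inj₂ (V , b)) → k (inj₂ (outside ∷ V , b))
      ; (inj₁ allOut)  → k (inj₁ λ { (inside ∷ V) → allIn V ; (outside ∷ V) → allOut V }) } }

-- Linear algebra over K and invariance of graded dimensions.

module Dimension where
  open import Defs hiding (≡ᵇ)
  open import Level using (_⊔_)
  open import Data.Bool.Properties using (∧-zeroʳ)
  open import Data.Nat using (_≤_; _<_; _≡ᵇ_)
  open import Data.List using (length)
  open import Data.List.Properties using (length-map)
  import Data.List.Membership.Propositional as L
  open import Data.List.Membership.Propositional.Properties using (∈-filter⁺)
  open import Data.List.Relation.Unary.All as All using (All; []; _∷_)
  open import Data.List.Relation.Unary.All.Properties using (map⁻)
  import Data.Vec.Properties as Vecₚ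
  open import Data.Empty using (⊥)
  open RingSolver
  open MatroidRank using (∈-allSubsets)
  open Sums
  open ExteriorAlgebra
  open Bridge
  open OrlikSolomon
  open NBC
  open Counting

  _≟ˢ_ : ∀ {n} (U V : Subset n) → Dec (U ≡ V)
  _≟ˢ_ = Vecₚ.≡-dec Bool._≟_

  module LinearAlgebra {c ℓ : Level} (K : CommutativeRing c ℓ) (isField : IsField K) where
    open CommutativeRing K hiding (zero)
    open IntegerSolver K
    open Recursive K
    open Summation K
    open Translation K
    open OS K
    open BrokenCircuits K using (SupportedOn)
    open import Algebra.Properties.Ring ring using (-0#≈0#)

    1≉0 : ¬ (1# ≈ 0#)
    1≉0 p = proj₁ isField (sym p)

    dot : ∀ {m} → E m → E m → Carrier
    dot ρ x = ∑ (λ V → ρ V * x V)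

    dot-⊕ʳ : ∀ {m} (ρ x y : E m) → dot ρ (x ⊕ y) ≈ dot ρ x + dot ρ y
    dot-⊕ʳ {m} ρ x y = trans (∑-cong {m} λ V → distribˡ _ _ _) (∑-+ {m} _ _)

    dot-·ʳ : ∀ {m} (ρ : E m) a x → dot ρ (a · x) ≈ a * dot ρ x
    dot-·ʳ {m} ρ a x = trans (∑-cong {m} λ V → solve 3 (λ r a x → r :* (a :* x) := a :* (r :* x)) refl _ _ _) (∑-* {m} a _)

    dot-comm : ∀ {m} (ρ x : E m) → dot ρ x ≈ dot x ρ
    dot-comm {m} ρ x = ∑-cong {m} λ V → *-comm _ _

    dot-monomial : ∀ {m} (ρ : E m) V → dot ρ (monomial V) ≈ ρ V
    dot-monomial ρ []            = *-identityʳ _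
    dot-monomial {suc m} ρ (inside ∷ V)  = trans (+-cong (dot-monomial (hi ρ) V) (∑-0 {m} λ U → zeroʳ _)) (+-identityʳ _)
    dot-monomial {suc m} ρ (outside ∷ V) = trans (+-cong (∑-0 {m} λ U → zeroʳ _) (dot-monomial (lo ρ) V)) (+-identityˡ _)

    -- Equality in K need not be stable under double negation, so nonzero solutions exist only up to double negation.
    kernel : ∀ {m} N (ρs : List (E m)) (P : Subset m → Bool) → length ρs ≡ N → N < # P →
      ¬ ¬ (∃ λ x → SupportedOn P x × All (λ ρ → dot ρ x ≈ 0#) ρs × ∃ λ V → ¬ (x V ≈ 0#))
    kernel zero [] P _ 0<#P k with V , PV ← #-positive P 0<#P = k (monomial V ,
      (λ U PU → monomial-≢ V U λ { ≡.refl → contradiction (≡.trans (≡.sym PV) PU) λ () }) , [] ,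
      V , λ e → 1≉0 (trans (sym (monomial-diag V)) e))
    kernel {m} (suc N) (ρ ∷ ρs) P len lt k = ¬¬-all {A = λ V → P V ≡ true → ρ V ≈ 0#} {B = λ V → P V ≡ true × ¬ (ρ V ≈ 0#)} decide λ
      { (inj₁ zero-row)       → kernel N ρs P (ℕₚ.suc-injective len) (ℕₚ.<⇒≤ lt) λ (x , supp , dots , nz) → k (x , supp , ∑-0 {m} (zero-term zero-row supp) ∷ dots , nz)
      ; (inj₂ (V , PV , ρV≉0)) → pivot V PV (proj₁ (proj₂ isField (ρ V) ρV≉0)) (proj₂ (proj₂ isField (ρ V) ρV≉0)) }
      where
        decide : ∀ V → ¬ ¬ ((P V ≡ true → ρ V ≈ 0#) ⊎ (P V ≡ true × ¬ (ρ V ≈ 0#)))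
        decide V h with P V
        ... | false = h (inj₁ λ ())
        ... | true  = ¬¬-or λ { (inj₁ p) → h (inj₁ λ _ → p) ; (inj₂ q) → h (inj₂ (≡.refl , q)) }

        zero-term : (∀ V → P V ≡ true → ρ V ≈ 0#) → ∀ {x} → SupportedOn P x → ∀ V → ρ V * x V ≈ 0#
        zero-term zr supp V with P V in PV
        ... | true  = trans (*-congʳ (zr V PV)) (zeroˡ _)
        ... | false = trans (*-congˡ (supp V PV)) (zeroʳ _)

        -- Gaussian elimination: `fix` chooses the coordinate at V so that row ρ vanishes, and a row
        -- σ applied to `fix x` equals `eliminate σ` applied to x. The remaining system has one row
        -- and one column fewer.
        pivot : ∀ V → P V ≡ true → ∀ i → ρ V * i ≈ 1# → ⊥
        pivot V PV i ρVi = kernel N (List.map eliminate ρs) (remove V P)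
          (≡.trans (length-map eliminate ρs) (ℕₚ.suc-injective len)) (ℕₚ.≤-pred (≡.subst (suc N <_) (#-remove V P PV) lt))
          λ (x , supp , dots , W , xW≉0) → k (fix x , fix-supp supp ,
            (trans (dot-fix ρ x) (trans (solve 3 (λ d i r → d :+ (:- d :* i) :* r := d :+ :- d :* (r :* i)) refl _ _ _)
              (trans (+-congˡ (trans (*-congˡ ρVi) (*-identityʳ _))) (-‿inverseʳ _))))
            ∷ All.map (λ {σ} p → trans (dot-fix σ x) (trans (trans
                (solve 4 (λ s d i r → s :+ (:- d :* i) :* r := s :+ (:- (r :* i)) :* d) refl _ _ _ _) (sym (dot-eliminate σ x))) p)) (map⁻ dots) ,
            W , λ fixW≈0 → xW≉0 (trans (sym (fix-at W x supp xW≉0)) fixW≈0))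
          where
            eliminate : E m → E m
            eliminate σ = σ ⊕ (- (σ V * i)) · ρ
            fix : E m → E m
            fix x = x ⊕ (- dot ρ x * i) · monomial V
            dot-fix : ∀ σ x → dot σ (fix x) ≈ dot σ x + (- dot ρ x * i) * σ V
            dot-fix σ x = trans (dot-⊕ʳ σ x _) (+-congˡ (trans (dot-·ʳ σ _ (monomial V)) (*-congˡ (dot-monomial σ V))))
            dot-eliminate : ∀ σ x → dot (eliminate σ) x ≈ dot σ x + (- (σ V * i)) * dot ρ x
            dot-eliminate σ x = trans (dot-comm (eliminate σ) x) (trans (dot-⊕ʳ x σ _)
              (+-cong (dot-comm x σ) (trans (dot-·ʳ x _ ρ) (*-congˡ (dot-comm x ρ)))))
            fix-supp : ∀ {x} → SupportedOn (remove V P) x → SupportedOn P (fix x)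
            fix-supp supp U PU = trans (+-cong (supp U (≡.trans (remove-other V P U U≢V) PU))
                (trans (*-congˡ (monomial-≢ V U (U≢V ∘ ≡.sym))) (zeroʳ _))) (+-identityʳ _)
              where
                U≢V : U ≢ V
                U≢V ≡.refl = contradiction (≡.trans (≡.sym PV) PU) λ ()
            fix-at : ∀ W x → SupportedOn (remove V P) x → ¬ (x W ≈ 0#) → fix x W ≈ x W
            fix-at W x supp xW≉0 = trans (+-congˡ (trans (*-congˡ (monomial-≢ V W λ { ≡.refl → xW≉0 (supp V (remove-self V P)) })) (zeroʳ _))) (+-identityʳ _)

    combination : ∀ {m n} → E m → (Subset m → E n) → E n
    combination x f U = ∑ (λ V → x V * f V U)

    combination-linear : ∀ {m n k} {F : E n → E k} → Linear F → ∀ (x : E m) f → F (combination x f) ≋ combination x (F ∘ f)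
    combination-linear {zero}  L x f = L .·-homo _ _
    combination-linear {suc m} L x f = ≋-trans (L .⊕-homo (combination (hi x) (f ∘ (inside ∷_))) (combination (lo x) (f ∘ (outside ∷_))))
      (⊕-cong (combination-linear L (hi x) (f ∘ (inside ∷_))) (combination-linear L (lo x) (f ∘ (outside ∷_))))

    combination-closed : ∀ {m n p} {P : E n → Set p} → Closed P → ∀ (x : E m) f → (∀ V → P (x V · f V)) → P (combination x f)
    combination-closed {zero}  cl x f terms = terms []
    combination-closed {suc m} cl x f terms = Closed.⊕-closed cl
      (combination-closed cl (hi x) (f ∘ (inside ∷_)) (terms ∘ (inside ∷_))) (combination-closed cl (lo x) (f ∘ (outside ∷_)) (terms ∘ (outside ∷_)))

    combination-monomial : ∀ {m} (x : E m) → combination x monomial ≋ x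
    combination-monomial {m} x .at U = trans (∑-cong {m} λ V → *-congˡ (monomial-sym V U)) (dot-monomial x U)
      where
        monomial-sym : ∀ {m} (V U : Subset m) → monomial V U ≈ monomial U V
        monomial-sym []            []            = refl
        monomial-sym (inside ∷ V)  (inside ∷ U)  = monomial-sym V U
        monomial-sym (inside ∷ V)  (outside ∷ U) = refl
        monomial-sym (outside ∷ V) (inside ∷ U)  = refl
        monomial-sym (outside ∷ V) (outside ∷ U) = monomial-sym V U

    record Submodule {n p} (I : E n → Set p) : Set (c ⊔ ℓ ⊔ p) where
      field
        closed   : Closed I
        ·-closed : ∀ a {x} → I x → I (a · x)
      open Closed closed public

    ofDegree : ∀ {n} → (ℕ → Bool) → Subset n → Bool
    ofDegree f U = f ∣ U ∣

    -- Stated for every set `f` of degrees: an operator of degree ±1 then merely replaces f by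
    -- `f ∘ pred` or `f ∘ suc`.
    Graded : ∀ {n p} → (E n → Set p) → Set (c ⊔ p)
    Graded I = ∀ f {x} → I x → I (π (ofDegree f) x)

    -- A homogeneous basis of E/I indexed by the subsets satisfying `P`, the size of the index being
    -- the degree. Coordinate vectors live in a possibly different `E m`, so that bases with unlike
    -- index sets can be compared.
    record Coordinates {n p} (I : E n → Set p) {m} (P : Subset m → Bool) (T : E m → E n) : Set (c ⊔ ℓ ⊔ p) where
      field
        linearity   : Linear T
        degree      : ∀ f x → π (ofDegree f) (T x) ≋ T (π (ofDegree f) x)
        independent : ∀ x → SupportedOn P x → I (T x) → ∀ V → ¬ ¬ (x V ≈ 0#)
        spanning    : ∀ x → ∃ λ y → SupportedOn P y × I (x ⊕ ⊖ T y)

    -- With more P-indices than Q-indices in degree k, the Q-expansions of the P-basis satisfy a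
    -- nontrivial relation, contradicting independence. Passing through `≮⇒≥` makes the goal a
    -- refutation and absorbs the double negation of `kernel`.
    dimension-≤ : ∀ {n p} {I : E n → Set p} → Submodule I → Graded I →
      ∀ {m m′} {P : Subset m → Bool} {Q : Subset m′ → Bool} {T T′} → Coordinates I P T → Coordinates I Q T′ →
      ∀ k → # (inDegree P k) ≤ # (inDegree Q k)
    dimension-≤ {n} {I = I} sub graded {m} {m′} {P} {Q} {T} {T′} A B k = ℕₚ.≮⇒≥ λ lt →
      kernel _ (List.map row (members (inDegree Q k))) (inDegree P k)
        (≡.trans (length-map row (members (inDegree Q k))) (length-members (inDegree Q k))) lt
        λ (x , supp , dots , V , xV≉0) → A.independent x (λ U PU → supp U (≡.cong (_∧ (∣ U ∣ ≡ᵇ k)) PU)) (I-T x supp (map⁻ dots)) V xV≉0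
      where
        module A = Coordinates A
        module B = Coordinates B
        open Submodule sub
        d : ∀ {n} → Subset n → Bool
        d = ofDegree (_≡ᵇ k)
        -- Only the part of degree k of each expansion is kept. As I is graded it still represents a
        -- monomial of degree k, and the number of equations drops to the size of `inDegree Q k`.
        y : Subset m → E m′
        y V = π d (proj₁ (B.spanning (T (monomial V))))
        row : Subset m′ → E m
        row U V = y V U

        I-y : ∀ V → (∣ V ∣ ≡ᵇ k) ≡ true → I (T (monomial V) ⊕ ⊖ T′ (y V))
        I-y V dV with z , supp , Iz ← B.spanning (T (monomial V)) in eq = resp
          (≋-trans (π-linear d .⊕-homo (T (monomial V)) (⊖ T′ z)) (⊕-cong
            (≋-trans (A.degree (_≡ᵇ k) (monomial V)) (A.linearity .cong π-monomial))
            (≋-trans (⊖-homo (π-linear d) (T′ z)) (⊖-cong (B.degree (_≡ᵇ k) z)))))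
          (graded (_≡ᵇ k) Iz)
          where
            π-monomial : π d (monomial V) ≋ monomial V
            π-monomial .at U with V ≟ˢ U
            ... | yes ≡.refl rewrite dV = refl
            ... | no V≢U = trans (π-vanish d (monomial V) U (monomial-≢ V U V≢U)) (sym (monomial-≢ V U V≢U))

        module _ (x : E m) (supp : SupportedOn (inDegree P k) x) (dots : All (λ U → dot (row U) x ≈ 0#) (members (inDegree Q k))) where
          combination-y : combination x y ≋ 𝟎
          combination-y .at U = go _ _ ≡.refl ≡.refl
            where
              full : Subset m → E m′
              full V = proj₁ (B.spanning (T (monomial V)))
              go : ∀ a b → Q U ≡ a → (∣ U ∣ ≡ᵇ k) ≡ b → combination x y U ≈ 0#
              go true  true  QU dU = trans (∑-cong {m} λ V → *-comm _ _) (All.lookup dots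
                (∈-filter⁺ (λ U → inDegree Q k U Bool.≟ true) (∈-allSubsets U) (≡.cong₂ _∧_ QU dU)))
              go false _     QU dU = ∑-0 {m} λ V → trans (*-congˡ (π-vanish d (full V) U (proj₁ (proj₂ (B.spanning (T (monomial V)))) U QU))) (zeroʳ _)
              go true  false QU dU = ∑-0 {m} λ V → trans (*-congˡ (reflexive (≡.cong (λ b → [ b ]· (full V U)) dU))) (zeroʳ _)

          I-T : I (T x)
          I-T = resp (≋-trans
              (≋-trans (pointwise λ U → trans (∑-cong {m} λ V → distribˡ _ _ _) (∑-+ {m} _ _))
                (≋-trans (⊕-cong (≋-sym (combination-linear A.linearity x monomial)) (≋-sym (combination-linear (∘-linear ⊖-linear B.linearity) x y)))
                  (⊕-cong (A.linearity .cong (combination-monomial x)) (⊖-cong (≋-trans (B.linearity .cong combination-y) (𝟎-homo B.linearity))))))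
              (pointwise λ U → trans (+-congˡ -0#≈0#) (+-identityʳ _)))
            (combination-closed closed x (λ V → T (monomial V) ⊕ ⊖ T′ (y V)) term)
            where
              ⊖-linear : ∀ {n} → Linear {n} ⊖_
              ⊖-linear = record
                { cong = ⊖-cong ; ⊕-homo = λ x y → pointwise λ U → solve 2 (λ a b → :- (a :+ b) := :- a :+ :- b) refl _ _
                ; ·-homo = λ a x → pointwise λ U → solve 2 (λ a b → :- (a :* b) := a :* :- b) refl _ _ }
              term : ∀ V → I (x V · (T (monomial V) ⊕ ⊖ T′ (y V)))
              term V with ∣ V ∣ ≡ᵇ k in dV
              ... | true  = ·-closed (x V) (I-y V dV)
              ... | false = resp (pointwise λ U → sym (trans (*-congʳ (supp V (≡.trans (≡.cong (P V ∧_) dV) (∧-zeroʳ (P V))))) (zeroˡ _))) 𝟎-closed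

    module _ {n p} {I : E n → Set p} (sub : Submodule I) where
      open Submodule sub

      Independent Spans : (Subset n → Bool) → Set (c ⊔ ℓ ⊔ p)
      Independent C = ∀ x → SupportedOn C x → I x → ∀ U → ¬ ¬ (x U ≈ 0#)
      Spans C = ∀ x → ∃ λ y → SupportedOn C y × I (x ⊕ ⊖ y)

      private
        InSpan : (Subset n → Bool) → E n → Set (c ⊔ ℓ ⊔ p)
        InSpan C x = ∃ λ y → SupportedOn C y × I (x ⊕ ⊖ y)

        insert : Subset n → (Subset n → Bool) → Subset n → Bool
        insert S C U = does (S ≟ˢ U) ∨ C U

        insert-other : ∀ S C U → S ≢ U → insert S C U ≡ C U
        insert-other S C U S≢U with S ≟ˢ U
        ... | yes S≡U = contradiction S≡U S≢U
        ... | no _    = ≡.refl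

        insert-false : ∀ S C U → insert S C U ≡ false → S ≢ U × C U ≡ false
        insert-false S C U eq with S ≟ˢ U
        ... | no S≢U = S≢U , eq

        insert-independent : ∀ S C → Independent C → ¬ InSpan C (monomial S) → Independent (insert S C)
        insert-independent S C ind not-in x supp Ix U h = ¬¬-or λ
          { (inj₁ xS≈0) → ind x (supp′ xS≈0) Ix U h
          ; (inj₂ xS≉0) → invertible (proj₁ (proj₂ isField (x S) xS≉0)) (proj₂ (proj₂ isField (x S) xS≉0)) }
          where
            supp′ : x S ≈ 0# → SupportedOn C x
            supp′ xS≈0 V CV with S ≟ˢ V
            ... | yes ≡.refl = xS≈0
            ... | no S≢V = supp V (≡.trans (insert-other S C V S≢V) CV)
            invertible : ∀ i → x S * i ≈ 1# → ⊥
            invertible i xSi = not-in (monomial S ⊕ ⊖ (i · x) , supp″ , resp (pointwise λ V → solve 2 (λ a b → b := a :+ :- (a :+ :- b)) refl _ _) (·-closed i Ix))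
              where
                supp″ : SupportedOn C (monomial S ⊕ ⊖ (i · x))
                supp″ V CV with S ≟ˢ V
                ... | yes ≡.refl = trans (+-cong (monomial-diag S) (-‿cong (trans (*-comm _ _) xSi))) (-‿inverseʳ _)
                ... | no S≢V = trans (+-cong (monomial-≢ S V S≢V) (-‿cong (trans (*-congˡ (supp V (≡.trans (insert-other S C V S≢V) CV))) (zeroʳ _))))
                                 (trans (+-congˡ -0#≈0#) (+-identityʳ _))

        greedy : ∀ Ss → ¬ ¬ (∃ λ C → Independent C × (∀ S → S L.∈ Ss → InSpan C (monomial S)))
        greedy [] k = k ((λ _ → false) , (λ x supp Ix U h → h (supp U ≡.refl)) , λ S ())
        greedy (S ∷ Ss) k = greedy Ss λ (C , ind , span) → ¬¬-or {A = InSpan C (monomial S)} λ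
          { (inj₁ yes-in) → k (C , ind , λ { S′ (here ≡.refl) → yes-in ; S′ (there S∈) → span S′ S∈ })
          ; (inj₂ not-in) → k (insert S C , insert-independent S C ind not-in , λ
              { S′ (here ≡.refl) → monomial S , (λ U eq → monomial-≢ S U (proj₁ (insert-false S C U eq))) , resp (pointwise λ U → sym (-‿inverseʳ _)) 𝟎-closed
              ; S′ (there S∈) → let y , supp , Iy = span S′ S∈ in y , (λ U eq → supp U (proj₂ (insert-false S C U eq))) , Iy }) }

      -- A greedy pass keeps a monomial when it is not in the span of those kept before. That
      -- membership is undecided, whence the double negation. The result serves quotients for which
      -- no explicit basis is at hand.
      monomial-basis : ¬ ¬ (∃ λ C → Independent C × Spans C)
      monomial-basis k = greedy (allSubsets n) λ (C , ind , span) → k (C , ind , λ x → by-monomials (closure C) x λ U →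
        let y , supp , Iy = span U (∈-allSubsets U) in
        x U · y , (λ V CV → trans (*-congˡ (supp V CV)) (zeroʳ _)) ,
        resp (pointwise λ V → solve 3 (λ x a b → x :* (a :+ :- b) := x :* a :+ :- (x :* b)) refl _ _ _) (·-closed (x U) Iy))
        where
          closure : ∀ C → Closed (InSpan C)
          closure C = record
            { resp = λ p (y , supp , Iy) → y , supp , resp (⊕-cong p ≋-refl) Iy
            ; 𝟎-closed = 𝟎 , (λ U _ → refl) , resp (pointwise λ U → sym (-‿inverseʳ 0#)) 𝟎-closed
            ; ⊕-closed = λ (y , supp , Iy) (z , supp′ , Iz) → y ⊕ z , (λ U CU → trans (+-cong (supp U CU) (supp′ U CU)) (+-identityʳ _)) ,
                resp (pointwise λ U → solve 4 (λ a b c d → (a :+ :- b) :+ (c :+ :- d) := (a :+ c) :+ :- (b :+ d)) refl _ _ _ _) (⊕-closed Iy Iz) }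

-- A regular pair makes E/J free over an exterior algebra on two generators.

module FreeModule where
  open import Defs hiding (≡ᵇ)
  open import Level using (_⊔_)
  open import Data.Nat using (pred)
  open RingSolver
  open Sums
  open ExteriorAlgebra
  open Bridge
  open OrlikSolomon
  open NBC
  open Counting
  open Dimension

  -- The two leading bits record the factors v₁ and v₂, so that the cardinality of a subset is the degree of the basis element it stands for.
  doubled : ∀ {n} → (Subset n → Bool) → Subset (suc (suc n)) → Bool
  doubled C (_ ∷ _ ∷ U) = C U

  module FreeOverTwoForms {c ℓ : Level} (K : CommutativeRing c ℓ) (isField : IsField K) {n} (M : Matroid n)
    (v₁ v₂ : Fin n → CommutativeRing.Carrier K) where
    open CommutativeRing K hiding (zero)
    open IntegerSolver K
    open Recursive K
    open Summation K using ([_]·)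
    open Translation K
    open OS K
    open BrokenCircuits K
    open LinearAlgebra K isField

    L N : E n
    L = linear v₁
    N = linear v₂

    infix 4 _~_
    record _~_ (x y : E n) : Set (c ⊔ ℓ) where
      constructor modulo
      field difference : J M (x ⊕ ⊖ y)
    open _~_

    J⇒~ : ∀ {x y z} → z ≋ x ⊕ ⊖ y → J M z → x ~ y
    J⇒~ p jz = modulo (J-resp p jz)

    ≋⇒~ : ∀ {x y} → x ≋ y → x ~ y
    ≋⇒~ p = J⇒~ (pointwise λ U → sym (trans (+-congʳ (p .at U)) (-‿inverseʳ _))) J-𝟎

    ~-trans : ∀ {x y z} → x ~ y → y ~ z → x ~ z
    ~-trans {x} {y} {z} p q = J⇒~ (pointwise λ U → solve 3 (λ a b c → (a :+ :- b) :+ (b :+ :- c) := a :+ :- c) refl (x U) (y U) (z U))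
      (J-⊕ (p .difference) (q .difference))

    ~-⊕ : ∀ {x x′ y y′} → x ~ x′ → y ~ y′ → x ⊕ y ~ x′ ⊕ y′
    ~-⊕ {x} {x′} {y} {y′} p q = J⇒~
      (pointwise λ U → solve 4 (λ a b c d → (a :+ :- b) :+ (c :+ :- d) := (a :+ c) :+ :- (b :+ d)) refl (x U) (x′ U) (y U) (y′ U))
      (J-⊕ (p .difference) (q .difference))

    ~-∙ : ∀ v {x y} → x ~ y → v ∙ x ~ v ∙ y
    ~-∙ v {x} {y} p = J⇒~ (≋-trans (∙ʳ.⊕-homo v x (⊖ y)) (⊕-cong ≋-refl (∙ʳ.⊖-homo v y))) (J-∙ˡ v (p .difference))

    ~-refl : ∀ {x} → x ~ x
    ~-refl = ≋⇒~ ≋-refl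

    -- The ideals J + (v₁) and J + (v₁, v₂). Left multiples are enough, because a linear form passes
    -- any element up to `σ`.
    I₁ I₂ : E n → Set (c ⊔ ℓ)
    I₁ x = ∃ λ y → x ~ L ∙ y
    I₂ x = ∃₂ λ y z → x ~ L ∙ y ⊕ N ∙ z

    I₂-submodule : Submodule I₂
    I₂-submodule = record
      { closed = record
        { resp = λ p (y , z , q) → y , z , ~-trans (≋⇒~ (≋-sym p)) q
        ; 𝟎-closed = 𝟎 , 𝟎 , ≋⇒~ (≋-sym (≋-trans (⊕-cong (∙ʳ.𝟎-homo L) (∙ʳ.𝟎-homo N)) (pointwise λ U → +-identityʳ _)))
        ; ⊕-closed = λ (y , z , p) (y′ , z′ , p′) → y ⊕ y′ , z ⊕ z′ , ~-trans (~-⊕ p p′) (≋⇒~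
            (≋-trans (pointwise λ U → solve 4 (λ a b c d → (a :+ b) :+ (c :+ d) := (a :+ c) :+ (b :+ d)) refl _ _ _ _)
              (⊕-cong (≋-sym (∙ʳ.⊕-homo L y y′)) (≋-sym (∙ʳ.⊕-homo N z z′))))) }
      ; ·-closed = λ a {x} (y , z , p) → a · y , a · z , J⇒~
          (≋-trans (pointwise λ U → solve 4 (λ a x b c → a :* (x :+ :- (b :+ c)) := a :* x :+ :- (a :* b :+ a :* c)) refl _ _ _ _)
            (⊕-cong ≋-refl (⊖-cong (⊕-cong (≋-sym (∙ʳ.·-homo L a y)) (≋-sym (∙ʳ.·-homo N a z)))))) (J-· a (p .difference)) }

    J-submodule : Submodule (J M)
    J-submodule = record { closed = J-closed ; ·-closed = λ a → J-· a }

    π-Dep : ∀ b {p} → Dep M p → Dep M (π b p)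
    π-Dep b {p} dp U i = π-vanish b p U (dp U i)

    -- The value `pred 0` = 0 affects only the constant term of q, which ∂ annihilates.
    π-∂ : ∀ f (q : E n) → π (ofDegree f) (∂ q) ≋ ∂ (π (ofDegree (f ∘ pred)) q)
    π-∂ f q .at U with f ∣ U ∣ in fU
    ... | true  = D-local ones q _ U λ i V c → sym (reflexive (≡.cong (λ b → [ b ]· (q V)) (≡.trans (≡.cong (f ∘ pred) (⋖⇒∣∣ c)) fU)))
    ... | false = sym (D-vanish ones _ U λ i V c → reflexive (≡.cong (λ b → [ b ]· (q V)) (≡.trans (≡.cong (f ∘ pred) (⋖⇒∣∣ c)) fU)))

    J-graded : Graded (J M)
    J-graded f (in-J {p} {q} dp dq eq) = in-J (π-Dep _ dp) (π-Dep (ofDegree (f ∘ pred)) dq)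
      (≋-trans (π-linear _ .cong eq) (≋-trans (π-linear _ .⊕-homo p (∂ q)) (⊕-cong ≋-refl (π-∂ f q))))

    π-∙ : ∀ f v (x : E n) → π (ofDegree f) (linear v ∙ x) ≋ linear v ∙ π (ofDegree (f ∘ suc)) x
    π-∙ f v x .at U with f ∣ U ∣ in fU
    ... | true  = linear-local v x _ U λ i V c → *-congˡ (sym (reflexive (≡.cong (λ b → [ b ]· (x V)) (≡.trans (≡.cong f (≡.sym (⋖⇒∣∣ c))) fU))))
    ... | false = sym (trans (linear-local v _ 𝟎 U λ i V c → *-congˡ (reflexive (≡.cong (λ b → [ b ]· (x V)) (≡.trans (≡.cong f (≡.sym (⋖⇒∣∣ c))) fU))))
        (∙ʳ.𝟎-homo (linear v) .at U))

    nbc-coordinates : Coordinates (J M) (nbc M) id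
    nbc-coordinates = record
      { linearity = record { cong = id ; ⊕-homo = λ x y → ≋-refl ; ·-homo = λ a x → ≋-refl }
      ; degree = λ f x → ≋-refl
      ; independent = λ x supp jx V k → k (nbc-independent M supp jx .at V)
      ; spanning = nbc-spanning M }

    -- The map (a, b, c, d) ↦ a + v₂ b + v₁ c + v₁ v₂ d, with the outer bit standing for v₁ and the
    -- inner bit for v₂. Restricted to coordinates in a basis of E/I₂ it expresses freeness.
    T : E (suc (suc n)) → E n
    T x = lo (lo x) ⊕ (N ∙ hi (lo x) ⊕ (L ∙ lo (hi x) ⊕ L ∙ (N ∙ hi (hi x))))

    T-linear : Linear T
    T-linear = lin-⊕ (∘-linear lo-linear lo-linear) (lin-⊕ (∘-linear (∙-linearʳ N) (∘-linear hi-linear lo-linear))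
      (lin-⊕ (∘-linear (∙-linearʳ L) (∘-linear lo-linear hi-linear)) (∘-linear (∙-linearʳ L) (∘-linear (∙-linearʳ N) (∘-linear hi-linear hi-linear)))))
      where
        lo-linear : ∀ {n} → Linear (lo {n})
        lo-linear = record { cong = lo-cong ; ⊕-homo = λ x y → ≋-refl ; ·-homo = λ a x → ≋-refl }
        hi-linear : ∀ {n} → Linear (hi {n})
        hi-linear = record { cong = hi-cong ; ⊕-homo = λ x y → ≋-refl ; ·-homo = λ a x → ≋-refl }
        lin-⊕ : ∀ {m n} {f g : E m → E n} → Linear f → Linear g → Linear (λ x → f x ⊕ g x)
        lin-⊕ F G = record
          { cong = λ p → ⊕-cong (F .cong p) (G .cong p)
          ; ⊕-homo = λ x y → pointwise λ U → trans (+-cong (F .⊕-homo x y .at U) (G .⊕-homo x y .at U))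
              (solve 4 (λ a b c d → (a :+ b) :+ (c :+ d) := (a :+ c) :+ (b :+ d)) refl _ _ _ _)
          ; ·-homo = λ a x → pointwise λ U → trans (+-cong (F .·-homo a x .at U) (G .·-homo a x .at U)) (sym (distribˡ _ _ _)) }

    T-degree : ∀ f x → π (ofDegree f) (T x) ≋ T (π (ofDegree f) x)
    T-degree f x = ≋-trans (π-linear d .⊕-homo (lo (lo x)) _) (⊕-cong ≋-refl
      (≋-trans (π-linear d .⊕-homo (N ∙ hi (lo x)) _) (⊕-cong (π-∙ f v₂ (hi (lo x)))
        (≋-trans (π-linear d .⊕-homo (L ∙ lo (hi x)) _) (⊕-cong (π-∙ f v₁ (lo (hi x)))
          (≋-trans (π-∙ f v₁ (N ∙ hi (hi x))) (∙ʳ.cong L (π-∙ (f ∘ suc) v₂ (hi (hi x))))))))))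
      where
        d : Subset n → Bool
        d = ofDegree f

    module _ (regular₁ : ∀ x → J M (L ∙ x) → I₁ x) (regular₂ : ∀ x → I₁ (N ∙ x) → I₂ x)
             {C : Subset n → Bool} (ind : Independent I₂-submodule C) (span : Spans I₂-submodule C) where
      private
        ¬¬-≋𝟎 : ∀ {x} → SupportedOn C x → I₂ x → ¬ ¬ (x ≋ 𝟎)
        ¬¬-≋𝟎 {x} supp Ix k = ¬¬-all {A = λ V → x V ≈ 0#} {B = λ V → ¬ (x V ≈ 0#)} (λ V → ¬¬-or) λ
          { (inj₁ all) → k (pointwise all) ; (inj₂ (V , xV≉0)) → ind x supp Ix V xV≉0 }

        neg-∙ : ∀ v (x : E n) U → (v ∙ ⊖ x) U ≈ - (v ∙ x) U
        neg-∙ v x U = ∙ʳ.⊖-homo v x .at U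

      private
        drop-zero : ∀ {a y} → a ≋ 𝟎 → J M (a ⊕ y) → J M y
        drop-zero a≋𝟎 = J-resp (pointwise λ U → trans (+-congʳ (a≋𝟎 .at U)) (+-identityˡ _))

        L-sum : ∀ c′ d U → (L ∙ ⊖ (c′ ⊕ N ∙ d)) U ≈ - ((L ∙ c′) U + (L ∙ (N ∙ d)) U)
        L-sum c′ d U = trans (neg-∙ L (c′ ⊕ N ∙ d) U) (-‿cong (∙ʳ.⊕-homo L c′ (N ∙ d) .at U))

        component-a : ∀ {a b c′ d} → J M (a ⊕ (N ∙ b ⊕ (L ∙ c′ ⊕ L ∙ (N ∙ d)))) → I₂ a
        component-a {a} {b} {c′} {d} j = ⊖ (c′ ⊕ N ∙ d) , ⊖ b , J⇒~ (pointwise λ U → trans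
          (solve 4 (λ a b c d → a :+ (b :+ (c :+ d)) := a :+ :- (:- (c :+ d) :+ :- b)) refl (a U) ((N ∙ b) U) ((L ∙ c′) U) ((L ∙ (N ∙ d)) U))
          (+-congˡ (-‿cong (+-cong (sym (L-sum c′ d U)) (sym (neg-∙ N b U)))))) j

        component-b : ∀ {b c′ d} → J M (N ∙ b ⊕ (L ∙ c′ ⊕ L ∙ (N ∙ d))) → I₂ b
        component-b {b} {c′} {d} j = regular₂ b (⊖ (c′ ⊕ N ∙ d) , J⇒~ (pointwise λ U → +-congˡ
          (trans (solve 2 (λ c d → c :+ d := :- :- (c :+ d)) refl ((L ∙ c′) U) ((L ∙ (N ∙ d)) U)) (-‿cong (sym (L-sum c′ d U))))) j)

        component-cd : ∀ {c′ d} → J M (L ∙ c′ ⊕ L ∙ (N ∙ d)) → I₁ (c′ ⊕ N ∙ d)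
        component-cd {c′} {d} j = regular₁ (c′ ⊕ N ∙ d) (J-resp (≋-sym (∙ʳ.⊕-homo L c′ (N ∙ d))) j)

        component-c : ∀ {c′ d} → I₁ (c′ ⊕ N ∙ d) → I₂ c′
        component-c {c′} {d} (y , p) = y , ⊖ d , J⇒~ (pointwise λ U → trans
          (solve 3 (λ c d y → (c :+ d) :+ :- y := c :+ :- (y :+ :- d)) refl (c′ U) ((N ∙ d) U) ((L ∙ y) U))
          (+-congˡ (-‿cong (+-congˡ (sym (neg-∙ N d U)))))) (p .difference)

        component-d : ∀ {c′ d} → c′ ≋ 𝟎 → I₁ (c′ ⊕ N ∙ d) → I₂ d
        component-d {c′} {d} c≋𝟎 (y , p) = regular₂ d (y , J⇒~ (pointwise λ U → +-congʳ (trans (+-congʳ (c≋𝟎 .at U)) (+-identityˡ _))) (p .difference))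

        -- Modulo I₂ only a survives. Then v₂ b is in J + (v₁), so b is in I₂ by the second
        -- regularity. Then v₁ (c + v₂ d) is in J, so c + v₂ d is in J + (v₁) by the first; this
        -- gives c in I₂ and, once c = 0, d in I₂. Each is zero because `C` is independent modulo
        -- I₂.
        components : ∀ {a b c′ d} → SupportedOn C a → SupportedOn C b → SupportedOn C c′ → SupportedOn C d →
          J M (a ⊕ (N ∙ b ⊕ (L ∙ c′ ⊕ L ∙ (N ∙ d)))) → ¬ ¬ (a ≋ 𝟎 × b ≋ 𝟎 × c′ ≋ 𝟎 × d ≋ 𝟎)
        components {a} {b} {c′} {d} sa sb sc sd j k =
          ¬¬-≋𝟎 sa (component-a {a} {b} {c′} {d} j) λ a≋𝟎 → from-b a≋𝟎 (drop-zero a≋𝟎 j)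
          where
            from-cd : a ≋ 𝟎 → b ≋ 𝟎 → I₁ (c′ ⊕ N ∙ d) → _
            from-cd a≋𝟎 b≋𝟎 i = ¬¬-≋𝟎 sc (component-c {c′} {d} i) λ c≋𝟎 →
              ¬¬-≋𝟎 sd (component-d {c′} {d} c≋𝟎 i) λ d≋𝟎 → k (a≋𝟎 , b≋𝟎 , c≋𝟎 , d≋𝟎)
            from-b : a ≋ 𝟎 → J M (N ∙ b ⊕ (L ∙ c′ ⊕ L ∙ (N ∙ d))) → _
            from-b a≋𝟎 j = ¬¬-≋𝟎 sb (component-b {b} {c′} {d} j) λ b≋𝟎 →
              from-cd a≋𝟎 b≋𝟎 (component-cd {c′} {d} (drop-zero (≋-trans (∙ʳ.cong N b≋𝟎) (∙ʳ.𝟎-homo N)) j))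

      T-independent : ∀ x → SupportedOn (doubled C) x → J M (T x) → ∀ V → ¬ ¬ (x V ≈ 0#)
      T-independent x supp jT V k = components
        (λ U → supp (outside ∷ outside ∷ U)) (λ U → supp (outside ∷ inside ∷ U)) (λ U → supp (inside ∷ outside ∷ U)) (λ U → supp (inside ∷ inside ∷ U)) jT
        λ (a≋𝟎 , b≋𝟎 , c≋𝟎 , d≋𝟎) → k (at-V a≋𝟎 b≋𝟎 c≋𝟎 d≋𝟎 V)
        where
          at-V : lo (lo x) ≋ 𝟎 → hi (lo x) ≋ 𝟎 → lo (hi x) ≋ 𝟎 → hi (hi x) ≋ 𝟎 → ∀ V → x V ≈ 0#
          at-V a b c′ d (outside ∷ outside ∷ U) = a .at U
          at-V a b c′ d (outside ∷ inside ∷ U)  = b .at U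
          at-V a b c′ d (inside ∷ outside ∷ U)  = c′ .at U
          at-V a b c′ d (inside ∷ inside ∷ U)   = d .at U

      private
        InC : E n → Set ℓ
        InC = SupportedOn C

        expand : ∀ x → ∃ λ a → InC a × ∃₂ λ y z → x ~ a ⊕ (L ∙ y ⊕ N ∙ z)
        expand x = let a , supp , y , z , p = span x in a , supp , y , z ,
          J⇒~ (pointwise λ U → solve 3 (λ x a b → (x :+ :- a) :+ :- b := x :+ :- (a :+ b)) refl (x U) (a U) ((L ∙ y ⊕ N ∙ z) U)) (p .difference)

        N-expansion : ∀ b y z → N ∙ (b ⊕ (L ∙ y ⊕ N ∙ z)) ≋ N ∙ b ⊕ L ∙ ⊖ (N ∙ y)
        N-expansion b y z .at U = begin⟨ setoid ⟩
          (N ∙ (b ⊕ (L ∙ y ⊕ N ∙ z))) U                      ≈⟨ ∙ʳ.⊕-homo N b (L ∙ y ⊕ N ∙ z) .at U ⟩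
          (N ∙ b) U + (N ∙ (L ∙ y ⊕ N ∙ z)) U                ≈⟨ +-congˡ (∙ʳ.⊕-homo N (L ∙ y) (N ∙ z) .at U) ⟩
          (N ∙ b) U + ((N ∙ (L ∙ y)) U + (N ∙ (N ∙ z)) U)    ≈⟨ +-congˡ (+-cong (linear-anticomm v₂ v₁ y .at U) (linear-cancel v₂ z .at U)) ⟩
          (N ∙ b) U + (- (L ∙ (N ∙ y)) U + 0#)               ≈⟨ +-congˡ (trans (+-identityʳ _) (sym (neg-∙ L (N ∙ y) U))) ⟩
          (N ∙ b) U + (L ∙ ⊖ (N ∙ y)) U                      ∎

        L-expansion : ∀ a y z → L ∙ (a ⊕ (L ∙ y ⊕ z)) ≋ L ∙ a ⊕ L ∙ z
        L-expansion a y z .at U = begin⟨ setoid ⟩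
          (L ∙ (a ⊕ (L ∙ y ⊕ z))) U                          ≈⟨ ∙ʳ.⊕-homo L a (L ∙ y ⊕ z) .at U ⟩
          (L ∙ a) U + (L ∙ (L ∙ y ⊕ z)) U                    ≈⟨ +-congˡ (∙ʳ.⊕-homo L (L ∙ y) z .at U) ⟩
          (L ∙ a) U + ((L ∙ (L ∙ y)) U + (L ∙ z) U)          ≈⟨ +-congˡ (+-congʳ (linear-cancel v₁ y .at U)) ⟩
          (L ∙ a) U + (0# + (L ∙ z) U)                       ≈⟨ +-congˡ (+-identityˡ _) ⟩
          (L ∙ a) U + (L ∙ z) U                              ∎

        LN-expansion : ∀ d y → L ∙ (N ∙ d ⊕ L ∙ y) ≋ L ∙ (N ∙ d)
        LN-expansion d y .at U = begin⟨ setoid ⟩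
          (L ∙ (N ∙ d ⊕ L ∙ y)) U                            ≈⟨ ∙ʳ.⊕-homo L (N ∙ d) (L ∙ y) .at U ⟩
          (L ∙ (N ∙ d)) U + (L ∙ (L ∙ y)) U                  ≈⟨ +-congˡ (linear-cancel v₁ y .at U) ⟩
          (L ∙ (N ∙ d)) U + 0#                               ≈⟨ +-identityʳ _ ⟩
          (L ∙ (N ∙ d)) U                                    ∎

        expand-N : ∀ x → ∃ λ b → InC b × ∃ λ y → N ∙ x ~ N ∙ b ⊕ L ∙ y
        expand-N x = let b , supp , y , z , p = expand x in b , supp , ⊖ (N ∙ y) , ~-trans (~-∙ N p) (≋⇒~ (N-expansion b y z))

        expand-LN : ∀ x → ∃ λ d → InC d × L ∙ (N ∙ x) ~ L ∙ (N ∙ d)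
        expand-LN x = let d , supp , y , p = expand-N x in d , supp , ~-trans (~-∙ L p) (≋⇒~ (LN-expansion d y))

        expand-L : ∀ x → ∃₂ λ c′ d → InC c′ × InC d × L ∙ x ~ L ∙ c′ ⊕ L ∙ (N ∙ d)
        expand-L x =
          let c′ , supp , y , z , p = expand x
              d , supp′ , q = expand-LN z
          in c′ , d , supp , supp′ , ~-trans (~-∙ L p) (~-trans (≋⇒~ (L-expansion c′ y (N ∙ z))) (~-⊕ ~-refl q))

        collect : ∀ b y y′ → L ∙ y ⊕ (N ∙ b ⊕ L ∙ y′) ≋ N ∙ b ⊕ L ∙ (y ⊕ y′)
        collect b y y′ .at U = trans
          (solve 3 (λ a b c → a :+ (b :+ c) := b :+ (a :+ c)) refl ((L ∙ y) U) ((N ∙ b) U) ((L ∙ y′) U))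
          (+-congˡ (sym (∙ʳ.⊕-homo L y y′ .at U)))

      -- An expansion modulo I₂ leaves a remainder v₁ y + v₂ z, whose coefficients are expanded in
      -- turn. Since v₁ and v₂ square to zero this stops: v₂ z gives v₂ b + v₁ y′, and v₁ (y + y′)
      -- gives v₁ c + v₁ v₂ d.
      T-spanning : ∀ x → ∃ λ y → SupportedOn (doubled C) y × J M (x ⊕ ⊖ T y)
      T-spanning x =
        let a , sa , y , z , p = expand x
            b , sb , y′ , q = expand-N z
            c′ , d , sc , sd , s = expand-L (y ⊕ y′)
        in (a ⊹ b) ⊹ (c′ ⊹ d) ,
           (λ { (outside ∷ outside ∷ U) → sa U ; (outside ∷ inside ∷ U) → sb U ; (inside ∷ outside ∷ U) → sc U ; (inside ∷ inside ∷ U) → sd U }) ,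
           ~-trans p (~-⊕ (~-refl {a}) (~-trans (~-⊕ ~-refl q) (~-trans (≋⇒~ (collect b y y′)) (~-⊕ (~-refl {N ∙ b}) s)))) .difference

      T-coordinates : Coordinates (J M) (doubled C) T
      T-coordinates = record { linearity = T-linear ; degree = T-degree ; independent = T-independent ; spanning = T-spanning }

    free-dimension : (∀ x → J M (L ∙ x) → I₁ x) → (∀ x → I₁ (N ∙ x) → I₂ x) →
      ¬ ¬ (∃ λ C → ∀ k → # (inDegree (nbc M) k) ≡ # (inDegree (doubled C) k))
    free-dimension reg₁ reg₂ h = monomial-basis I₂-submodule λ (C , ind , span) → h (C , λ k → ℕₚ.≤-antisym
      (dimension-≤ J-submodule J-graded nbc-coordinates (T-coordinates reg₁ reg₂ ind span) k)
      (dimension-≤ J-submodule J-graded (T-coordinates reg₁ reg₂ ind span) nbc-coordinates k))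

-- The derivative of the Hilbert series at -1 and the beta-invariant.

module Euler where
  open import Defs hiding (≡ᵇ)
  open import Data.Bool.Properties using (∧-identityʳ)
  open import Data.Nat using (_≤_; _<_; _≡ᵇ_)
  open import Data.Integer using (ℤ; +_; -_; _+_; _*_; 0ℤ; 1ℤ)
  open import Agda.Builtin.Int using (pos)
  open import Data.Fin.Subset using (⊤; ⊥)
  open import Data.Fin.Subset.Properties using (∣p∣≤n)
  open import Data.Empty using (⊥-elim)
  open import Relation.Binary.PropositionalEquality
  open RingSolver
  open Sums
  open MatroidRank
  open NBC using (nbc; nbc-step)
  open Counting
  open FreeModule using (doubled)
  open Summation ℤₚ.+-*-commutativeRing
  open IntegerSolver ℤₚ.+-*-commutativeRing

  -- The weight `h` is arbitrary so that the rank shift under contraction becomes `h ∘ suc`; the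
  -- beta-invariant is the case h = `pos`, up to sign.
  rankSum : ∀ {n} → (ℕ → ℤ) → Matroid n → ℤ
  rankSum h M = ∑ (λ S → signℤ ∣ S ∣ * h (rank M S))

  β-rankSum : ∀ {n} (M : Matroid n) → β M ≡ signℤ (rank M ⊤) * rankSum pos M
  β-rankSum {n} M = cong (signℤ (rank M ⊤) *_) (sumList-allSubsets {n} (λ S → signℤ ∣ S ∣ * + rank M S))

  rankSum-loop : ∀ {n} (M : Matroid (suc n)) → indep M (inside ∷ ⊥) ≡ false → ∀ h → rankSum h M ≡ 0ℤ
  rankSum-loop {n} M loop h = trans
    (cong (_+ ∑ out) (trans (∑-cong {n} λ S → trans (cong (λ k → - signℤ ∣ S ∣ * h k) (rank-loop M loop S)) (sym (ℤₚ.neg-distribˡ-* (signℤ ∣ S ∣) (h (rank M (outside ∷ S)))))) (∑-neg {n} out)))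
    (ℤₚ.+-inverseˡ (∑ out))
    where
      out : Subset n → ℤ
      out S = signℤ ∣ S ∣ * h (rank M (outside ∷ S))

  rankSum-step : ∀ {n} (M : Matroid (suc n)) (nl : NonLoop M) h → rankSum h M ≡ - rankSum (h ∘ suc) (contract M nl) + rankSum h (delete M)
  rankSum-step {n} M nl h = cong₂ _+_
    (trans (∑-cong {n} λ S → trans (cong (λ k → - signℤ ∣ S ∣ * h k) (rank-inside M nl S)) (sym (ℤₚ.neg-distribˡ-* (signℤ ∣ S ∣) (h (suc (rank (contract M nl) S)))))) (∑-neg {n} _))
    (∑-cong {n} λ S → cong (λ k → signℤ ∣ S ∣ * h k) (rank-outside M S))

  []·-neg : ∀ b x → [ b ]· (- x) ≡ - [ b ]· x
  []·-neg true  x = refl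
  []·-neg false x = refl

  -- Whitney's broken circuit theorem with `h` in place of the powers of a variable: both sides obey
  -- the same deletion-contraction recursion and vanish when 0 is a loop.
  nbcSum : ∀ {n} (M : Matroid n) h → ∑ (λ U → [ nbc M U ]· (signℤ ∣ U ∣ * h ∣ U ∣)) ≡ rankSum h M
  nbcSum {zero}  M h = cong (λ k → 1ℤ * h k) (sym (ℕₚ.n≤0⇒n≡0 (Rank.rank≤∣∣ M [])))
  nbcSum {suc n} M h = go _ refl
    where
      go : ∀ d (eq : indep M (inside ∷ ⊥) ≡ d) →
        ∑ (λ U → [ nbc-step M d eq inside U ]· (signℤ (suc ∣ U ∣) * h (suc ∣ U ∣))) + ∑ (λ U → [ nbc-step M d eq outside U ]· (signℤ ∣ U ∣ * h ∣ U ∣)) ≡ rankSum h M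
      go false loop = trans (cong₂ _+_ (∑-0 {n} λ U → refl) (∑-0 {n} λ U → refl)) (sym (rankSum-loop M loop h))
      go true  nl   = trans (cong₂ _+_
        (trans (∑-cong {n} λ U → trans (cong [ nbc (contract M nl) U ]· (sym (ℤₚ.neg-distribˡ-* (signℤ ∣ U ∣) (h (suc ∣ U ∣))))) ([]·-neg (nbc (contract M nl) U) _))
          (trans (∑-neg {n} _) (cong -_ (nbcSum (contract M nl) (h ∘ suc)))))
        (nbcSum (delete M) h)) (sym (rankSum-step M nl h))

  ∑-count : ∀ {n} (P : Subset n → Bool) a → ∑ (λ U → [ P U ]· a) ≡ + # P * a
  ∑-count {zero} P a with P []
  ... | true  = sym (ℤₚ.*-identityˡ a)
  ... | false = refl
  ∑-count {suc n} P a = trans (cong₂ _+_ (∑-count (P ∘ (inside ∷_)) a) (∑-count (P ∘ (outside ∷_)) a))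
    (sym (ℤₚ.*-distribʳ-+ a (+ # (P ∘ (inside ∷_))) (+ # (P ∘ (outside ∷_)))))

  ∑< : ℕ → (ℕ → ℤ) → ℤ
  ∑< zero    f = 0ℤ
  ∑< (suc N) f = f N + ∑< N f

  ∑-∑< : ∀ {n} N (f : Subset n → ℕ → ℤ) → ∑ (λ U → ∑< N (f U)) ≡ ∑< N (λ k → ∑ (λ U → f U k))
  ∑-∑< {n} zero    f = ∑-0 {n} λ U → refl
  ∑-∑< {n} (suc N) f = trans (∑-+ {n} _ _) (cong (λ z → ∑ (λ U → f U N) + z) (∑-∑< {n} N f))

  ∑<-cong : ∀ N {f g : ℕ → ℤ} → (∀ k → f k ≡ g k) → ∑< N f ≡ ∑< N g
  ∑<-cong zero    p = refl
  ∑<-cong (suc N) p = cong₂ _+_ (p N) (∑<-cong N p)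

  ≡ᵇ-≢ : ∀ u N → u ≢ N → (u ≡ᵇ N) ≡ false
  ≡ᵇ-≢ u N u≢N with u ≡ᵇ N in eq
  ... | false = refl
  ... | true  = ⊥-elim (u≢N (ℕₚ.≡ᵇ⇒≡ u N (subst Bool.T (sym eq) _)))

  select : ∀ b (w : ℕ → ℤ) u N → u < N → ∑< N (λ k → [ b ∧ (u ≡ᵇ k) ]· (w k)) ≡ [ b ]· (w u)
  select b w u (suc N) u<1+N with u ℕ.≟ N
  ... | yes refl = trans (cong₂ _+_ (cong (λ d → [ b ∧ d ]· (w u)) (≡ᵇ-refl u)) (below u ℕₚ.≤-refl))
                     (trans (ℤₚ.+-identityʳ _) (cong (λ d → [ d ]· (w u)) (∧-identityʳ b)))
    where
      below : ∀ N → N ≤ u → ∑< N (λ k → [ b ∧ (u ≡ᵇ k) ]· (w k)) ≡ 0ℤ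
      below zero    _   = refl
      below (suc N) N<u = trans (cong₂ _+_ (cong (λ d → [ b ∧ d ]· (w N)) (≡ᵇ-≢ u N (≢-sym (ℕₚ.<⇒≢ N<u)))) (below N (ℕₚ.<⇒≤ N<u)))
        (trans (ℤₚ.+-identityʳ _) ([]·-∧-false b))
  ... | no u≢N = trans (cong₂ _+_ (trans (cong (λ d → [ b ∧ d ]· (w N)) (≡ᵇ-≢ u N u≢N)) ([]·-∧-false b)) (select b w u N (ℕₚ.≤∧≢⇒< (ℕₚ.≤-pred u<1+N) u≢N)))
                     (ℤₚ.+-identityˡ _)

  ∑-by-degree : ∀ {n} (P : Subset n → Bool) w N → n < N → ∑ (λ U → [ P U ]· (w ∣ U ∣)) ≡ ∑< N (λ k → + # (inDegree P k) * w k)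
  ∑-by-degree {n} P w N n<N = trans (∑-cong {n} λ U → sym (select (P U) w ∣ U ∣ N (ℕₚ.≤-<-trans (∣p∣≤n U) n<N)))
    (trans (∑-∑< {n} N (λ U k → [ inDegree P k U ]· (w k))) (∑<-cong N λ k → ∑-count (inDegree P k) (w k)))

  -- Up to sign, the derivative of t^k at t = -1.
  signedDegree : ℕ → ℤ
  signedDegree k = signℤ k * + k

  -- The double zero of (1 + t)² at -1: each element of `C` of degree u contributes (u + 2) - 2(u +
  -- 1) + u = 0, up to sign.
  ∑-doubled : ∀ {n} (C : Subset n → Bool) → ∑ (λ V → [ doubled C V ]· (signedDegree ∣ V ∣)) ≡ 0ℤ
  ∑-doubled {n} C = trans (cong₂ _+_ (sym (∑-+ {n} _ _)) (sym (∑-+ {n} _ _))) (trans (sym (∑-+ {n} _ _)) (∑-0 {n} λ U → cancel (C U) ∣ U ∣))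
    where
      cancel : ∀ b u → ([ b ]· (signedDegree (suc (suc u))) + [ b ]· (signedDegree (suc u))) + ([ b ]· (signedDegree (suc u)) + [ b ]· (signedDegree u)) ≡ 0ℤ
      cancel false u = refl
      cancel true  u = solve 3 (λ s o u → (:- :- s :* (o :+ (o :+ u)) :+ :- s :* (o :+ u)) :+ (:- s :* (o :+ u) :+ s :* u) := :0) refl (signℤ u) 1ℤ (+ u)

  doubled⇒β≡0 : ∀ {n} (M : Matroid n) → (∃ λ C → ∀ k → # (inDegree (nbc M) k) ≡ # (inDegree (doubled C) k)) → β M ≡ 0ℤ
  doubled⇒β≡0 {n} M (C , same) = trans (β-rankSum M) (trans (cong (signℤ (rank M ⊤) *_) sum≡0) (ℤₚ.*-zeroʳ (signℤ (rank M ⊤))))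
    where
      sum≡0 : rankSum pos M ≡ 0ℤ
      sum≡0 = begin
        rankSum pos M                                                        ≡⟨ nbcSum M pos ⟨
        -- The cut-off `3 ℕ.+ n` exceeds the size of every index of `doubled C`, a subset of n + 2
        -- elements, so one bound serves both sums.
        ∑ (λ U → [ nbc M U ]· (signedDegree ∣ U ∣))                         ≡⟨ ∑-by-degree (nbc M) signedDegree (3 ℕ.+ n) (ℕₚ.m≤n+m (suc n) 2) ⟩
        ∑< (3 ℕ.+ n) (λ k → + # (inDegree (nbc M) k) * signedDegree k)      ≡⟨ ∑<-cong (3 ℕ.+ n) (λ k → cong (λ m → + m * signedDegree k) (same k)) ⟩
        ∑< (3 ℕ.+ n) (λ k → + # (inDegree (doubled C) k) * signedDegree k)  ≡⟨ ∑-by-degree (doubled C) signedDegree (3 ℕ.+ n) ℕₚ.≤-refl ⟨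
        ∑ (λ V → [ doubled C V ]· (signedDegree ∣ V ∣))                     ≡⟨ ∑-doubled C ⟩
        0ℤ                                                                  ∎
        where open ≡-Reasoning

-- Crapo's theorem: a vanishing beta-invariant forces a separation.

module Crapo where
  open import Defs hiding (≡ᵇ)
  open import Agda.Builtin.Int using (pos)
  open import Data.Nat using (_+_; _≤_; _<_; s≤s)
  open import Data.Integer as ℤ using (ℤ; 0ℤ; 1ℤ)
  open import Data.Fin.Subset using (_∈_; _∉_; _⊆_; _∪_; _∩_; ⁅_⁆; ⊥; ⊤; Nonempty; Empty)
  open import Data.Fin.Subset.Properties
  open import Data.Empty using (⊥-elim)
  open import Relation.Binary.PropositionalEquality
  open RingSolver
  open Sums
  open MatroidRank
  open Euler
  open Summation ℤₚ.+-*-commutativeRing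
  open IntegerSolver ℤₚ.+-*-commutativeRing

  -- A direct sum decomposition. The reverse of `rank-sum` is automatic by submodularity.
  record Separation {n} (M : Matroid n) (X Y : Subset n) : Set where
    field
      nonemptyˡ : Nonempty X
      nonemptyʳ : Nonempty Y
      disjoint  : ∀ {i} → i ∈ X → i ∉ Y
      cover     : ∀ i → i ∈ X ⊎ i ∈ Y
      rank-sum  : rank M X + rank M Y ≤ rank M ⊤
  open Separation

  Separation-swap : ∀ {n} {M : Matroid n} {X Y} → Separation M X Y → Separation M Y X
  Separation-swap {M = M} {X} {Y} s = record
    { nonemptyˡ = s .nonemptyʳ ; nonemptyʳ = s .nonemptyˡ ; disjoint = λ y x → s .disjoint x y
    ; cover = λ i → [ inj₂ , inj₁ ]′ (s .cover i) ; rank-sum = subst (_≤ rank M ⊤) (ℕₚ.+-comm (rank M X) (rank M Y)) (s .rank-sum) }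

  SeparationOf : ∀ {n} → Matroid n → Set
  SeparationOf M = ∃₂ λ X Y → Separation M X Y

  signSum : ℕ → ℤ
  signSum n = ∑ {n} (λ S → signℤ ∣ S ∣)

  signSum-suc : ∀ n → signSum (suc n) ≡ 0ℤ
  signSum-suc n = trans (cong (ℤ._+ signSum n) (∑-neg {n} (λ S → signℤ ∣ S ∣))) (ℤₚ.+-inverseˡ (signSum n))

  rankSum-suc : ∀ {n} (M : Matroid n) → rankSum (pos ∘ suc) M ≡ signSum n ℤ.+ rankSum pos M
  rankSum-suc {n} M = trans (∑-cong {n} λ S → trans (ℤₚ.*-distribˡ-+ (signℤ ∣ S ∣) 1ℤ (pos (rank M S)))
    (cong (ℤ._+ signℤ ∣ S ∣ ℤ.* pos (rank M S)) (ℤₚ.*-identityʳ (signℤ ∣ S ∣)))) (∑-+ {n} _ _)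

  module _ {n} (M : Matroid (suc n)) (nl : NonLoop M) where
    private
      r = rank M
    open Rank M using (submodular; rank-mono; rank≤∣∣)

    rank-zero≤1 : r (inside ∷ ⊥) ≤ 1
    rank-zero≤1 = subst (r (inside ∷ ⊥) ≤_) (cong suc (∣⊥∣≡0 n)) (rank≤∣∣ (inside ∷ ⊥))

    out⊆in : ∀ {X : Subset n} → (outside ∷ X) ⊆ (inside ∷ X)
    out⊆in (there x∈) = there x∈

    rank-inside≤ : ∀ X → r (inside ∷ X) ≤ suc (r (outside ∷ X))
    rank-inside≤ X = ℕₚ.≤-trans (ℕₚ.m≤n+m _ (r ⊥)) (ℕₚ.≤-trans
      (submodular (outside ∷ X) (inside ∷ ⊥) (⊆-min _) (⊆-min _) (in⊆in-∪ X))
      (ℕₚ.≤-trans (ℕₚ.+-monoʳ-≤ (r (outside ∷ X)) rank-zero≤1) (ℕₚ.≤-reflexive (ℕₚ.+-comm _ 1))))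
      where
        in⊆in-∪ : ∀ X → (inside ∷ X) ⊆ (outside ∷ X) ∪ (inside ∷ ⊥)
        in⊆in-∪ X here       = here
        in⊆in-∪ X (there x∈) = there (p⊆p∪q ⊥ x∈)

    module Coloop (coloop : r (outside ∷ ⊤) ≢ r (inside ∷ ⊤)) where
      rank-⊤ : r (inside ∷ ⊤) ≡ suc (r (outside ∷ ⊤))
      rank-⊤ = ℕₚ.≤-antisym (rank-inside≤ ⊤) (ℕₚ.≤∧≢⇒< (rank-mono out⊆in) coloop)

      -- Submodularity of the complement of 0 with `inside ∷ X` carries the rank jump at the full
      -- set down to every X.
      rank-coloop : ∀ X → rank (contract M nl) X ≡ rank (delete M) X
      rank-coloop X = ℕₚ.suc-injective (trans (sym (rank-inside M nl X)) (trans
        (ℕₚ.≤-antisym (rank-inside≤ X) (ℕₚ.+-cancelˡ-≤ (r (outside ∷ ⊤)) _ _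
          (subst₂ _≤_ (trans (ℕₚ.+-comm (r (outside ∷ X)) (r (inside ∷ ⊤))) (trans (cong (_+ r (outside ∷ X)) rank-⊤) (sym (ℕₚ.+-suc _ _)))) refl
            (submodular (outside ∷ ⊤) (inside ∷ X) (out⊆ ⊆-⊤) out⊆in λ { here → here ; (there x∈) → there (p⊆p∪q X x∈) }))))
        (cong suc (rank-outside M X))))
        where
          ⊆-⊤ : X ⊆ ⊤
          ⊆-⊤ _ = ∈⊤

      rankSum-coloop : rankSum pos M ≡ ℤ.- signSum n
      rankSum-coloop = trans (rankSum-step M nl pos) (trans
        (cong (λ z → ℤ.- z ℤ.+ rankSum pos (delete M)) (trans (rankSum-suc (contract M nl)) (cong (λ z → signSum n ℤ.+ z)
          (∑-cong {n} λ S → cong (λ k → signℤ ∣ S ∣ ℤ.* pos k) (rank-coloop S)))))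
        (solve 2 (λ s g → :- (s :+ g) :+ g := :- s) refl (signSum n) (rankSum pos (delete M))))

    -- A loop i of the contraction that is no loop of M is parallel to 0, so 0 joins the side
    -- containing i without raising its rank.
    parallel-separation : ∀ i → indep M (inside ∷ ⁅ i ⁆) ≡ false → indep M (outside ∷ ⁅ i ⁆) ≡ true → r (outside ∷ ⊤) ≡ r (inside ∷ ⊤) →
      ∀ {T T′} → Separation (delete M) T T′ → i ∈ T → Separation M (inside ∷ T) (outside ∷ T′)
    parallel-separation i dep ind top {T} {T′} s i∈T = record
      { nonemptyˡ = zero , here ; nonemptyʳ = suc (proj₁ (s .nonemptyʳ)) , there (proj₂ (s .nonemptyʳ))
      ; disjoint = λ { (there x∈) (there y∈) → s .disjoint x∈ y∈ }
      ; cover = λ { zero → inj₁ here ; (suc j) → [ inj₁ ∘ there , inj₂ ∘ there ]′ (s .cover j) }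
      ; rank-sum = ℕₚ.≤-trans (ℕₚ.+-mono-≤ inside≤ (ℕₚ.≤-reflexive (rank-outside M T′)))
          (ℕₚ.≤-trans (s .rank-sum) (ℕₚ.≤-reflexive (trans (sym (rank-outside M ⊤)) top))) }
      where
        rank-i : r (outside ∷ ⁅ i ⁆) ≡ 1
        rank-i = trans (Rank.indep⇒rank M ind) (∣⁅x⁆∣≡1 i)
        rank-0i : r (inside ∷ ⁅ i ⁆) ≤ 1
        rank-0i = ℕₚ.≤-pred (subst (r (inside ∷ ⁅ i ⁆) <_) (cong suc (∣⁅x⁆∣≡1 i)) (Rank.dep⇒rank< M dep))
        inside≤ : r (inside ∷ T) ≤ rank (delete M) T
        inside≤ = subst (r (inside ∷ T) ≤_) (rank-outside M T) (ℕₚ.+-cancelˡ-≤ 1 _ _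
          (ℕₚ.≤-trans (subst (λ k → k + r (inside ∷ T) ≤ r (outside ∷ T) + r (inside ∷ ⁅ i ⁆)) rank-i
              (submodular (outside ∷ T) (inside ∷ ⁅ i ⁆) (out⊆ (⊆-⁅⁆ i∈T)) out⊆in λ { here → here ; (there x∈) → there (p⊆p∪q ⁅ i ⁆ x∈) }))
            (ℕₚ.≤-trans (ℕₚ.+-monoʳ-≤ (r (outside ∷ T)) rank-0i) (ℕₚ.≤-reflexive (ℕₚ.+-comm _ 1)))))

    -- Tutte's argument: submodularity on crossing separations of the deletion and the contraction.
    module _ (top : r (outside ∷ ⊤) ≡ r (inside ∷ ⊤)) where
      private
        -- Two numbers with sum at most 2k + 1 cannot both exceed k.
        cross-arith : ∀ {a b c d k} → (a + b) + (c + d) ≤ suc (k + k) → a + d ≤ k ⊎ c + b ≤ k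
        cross-arith {a} {b} {c} {d} {k} le with a + d ℕ.≤? k
        ... | yes p = inj₁ p
        ... | no ¬p = inj₂ (ℕₚ.+-cancelˡ-≤ (suc k) _ _ (ℕₚ.≤-trans (ℕₚ.+-monoˡ-≤ (c + b) (ℕₚ.≰⇒> ¬p)) (ℕₚ.≤-trans (ℕₚ.≤-reflexive (shuffle a b c d)) le)))
          where
            shuffle : ∀ a b c d → (a + d) + (c + b) ≡ (a + b) + (c + d)
            shuffle a b c d = begin
              (a + d) + (c + b)   ≡⟨ cong ((a + d) +_) (ℕₚ.+-comm c b) ⟩
              (a + d) + (b + c)   ≡⟨ ℕₚ.+-assoc a d (b + c) ⟩
              a + (d + (b + c))   ≡⟨ cong (a +_) (ℕₚ.+-comm d (b + c)) ⟩
              a + ((b + c) + d)   ≡⟨ cong (a +_) (ℕₚ.+-assoc b c d) ⟩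
              a + (b + (c + d))   ≡⟨ ℕₚ.+-assoc a b (c + d) ⟨
              (a + b) + (c + d)   ∎
              where open ≡-Reasoning

        corner : ∀ {T T′ U U′} → Separation (delete M) T T′ → Separation (contract M nl) U U′ → Nonempty (T ∩ U) →
          r (outside ∷ (T ∩ U)) + r (inside ∷ (T′ ∪ U′)) ≤ r (inside ∷ ⊤) → Separation M (outside ∷ (T ∩ U)) (inside ∷ (T′ ∪ U′))
        corner {T} {T′} {U} {U′} s t (i , i∈) le = record
          { nonemptyˡ = suc i , there i∈ ; nonemptyʳ = zero , here
          ; disjoint = λ { (there x∈) (there y∈) → let x∈T , x∈U = x∈p∩q⁻ T U x∈ in [ s .disjoint x∈T , t .disjoint x∈U ]′ (x∈p∪q⁻ T′ U′ y∈) }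
          ; cover = λ { zero → inj₂ here ; (suc j) → cov j (s .cover j) (t .cover j) }
          ; rank-sum = le }
          where
            cov : ∀ j → j ∈ T ⊎ j ∈ T′ → j ∈ U ⊎ j ∈ U′ → suc j ∈ outside ∷ (T ∩ U) ⊎ suc j ∈ inside ∷ (T′ ∪ U′)
            cov j (inj₁ a) (inj₁ b) = inj₁ (there (x∈p∩q⁺ (a , b)))
            cov j (inj₂ a) _        = inj₂ (there (p⊆p∪q U′ a))
            cov j (inj₁ a) (inj₂ b) = inj₂ (there (q⊆p∪q T′ U′ b))

        crossing : ∀ {T T′ U U′} → Separation (delete M) T T′ → Separation (contract M nl) U U′ →
          SeparationOf M ⊎ Empty (T ∩ U) ⊎ Empty (T′ ∩ U′)
        crossing {T} {T′} {U} {U′} s t with nonempty? (T ∩ U) | nonempty? (T′ ∩ U′)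
        ... | no e  | _     = inj₂ (inj₁ e)
        ... | yes _ | no e  = inj₂ (inj₂ e)
        ... | yes p | yes q = inj₁ ([ (λ le → _ , _ , corner s t p le) , (λ le → _ , _ , corner (Separation-swap s) (Separation-swap t) q le) ]′
            (cross-arith {r (outside ∷ (T ∩ U))} {r (inside ∷ (T ∪ U))} {r (outside ∷ (T′ ∩ U′))} {r (inside ∷ (T′ ∪ U′))} total))
          where
            sub : ∀ A B → r (outside ∷ (A ∩ B)) + r (inside ∷ (A ∪ B)) ≤ r (outside ∷ A) + r (inside ∷ B)
            sub A B = submodular (outside ∷ A) (inside ∷ B) (out⊆ (p∩q⊆p A B)) (out⊆ (p∩q⊆q A B)) id
            swap-middle : ∀ a b c d → (a + b) + (c + d) ≡ (a + c) + (b + d)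
            swap-middle a b c d = trans (ℕₚ.+-assoc a b _) (trans (cong (a +_) (trans (sym (ℕₚ.+-assoc b c d)) (trans (cong (_+ d) (ℕₚ.+-comm b c)) (ℕₚ.+-assoc c b d)))) (sym (ℕₚ.+-assoc a c _)))
            delete-sum : r (outside ∷ T) + r (outside ∷ T′) ≤ r (inside ∷ ⊤)
            delete-sum = subst₂ _≤_ (cong₂ _+_ (sym (rank-outside M T)) (sym (rank-outside M T′))) (trans (sym (rank-outside M ⊤)) top) (s .rank-sum)
            -- Element 0 counts on both sides of a separation of the contraction; this is the
            -- surplus of 1 that `cross-arith` tolerates.
            contract-sum : r (inside ∷ U) + r (inside ∷ U′) ≤ suc (r (inside ∷ ⊤))
            contract-sum = subst₂ _≤_ (trans (cong suc (sym (ℕₚ.+-suc _ _))) (cong₂ _+_ (sym (rank-inside M nl U)) (sym (rank-inside M nl U′))))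
              (cong suc (sym (rank-inside M nl ⊤))) (s≤s (s≤s (t .rank-sum)))
            total : (r (outside ∷ (T ∩ U)) + r (inside ∷ (T ∪ U))) + (r (outside ∷ (T′ ∩ U′)) + r (inside ∷ (T′ ∪ U′))) ≤ suc (r (inside ∷ ⊤) + r (inside ∷ ⊤))
            total = ℕₚ.≤-trans (ℕₚ.+-mono-≤ (sub T U) (sub T′ U′)) (ℕₚ.≤-trans (ℕₚ.≤-reflexive (swap-middle (r (outside ∷ T)) (r (inside ∷ U)) (r (outside ∷ T′)) (r (inside ∷ U′))))
              (ℕₚ.≤-trans (ℕₚ.+-mono-≤ delete-sum contract-sum) (ℕₚ.≤-reflexive (ℕₚ.+-suc _ _))))

      -- If no crossing separates M, one corner is empty in each diagonal pair. Two such corners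
      -- always share a side, so one of T, T′, U, U′ would be empty.
      tutte : SeparationOf (delete M) → SeparationOf (contract M nl) → SeparationOf M
      tutte (T , T′ , s) (U , U′ , t) with crossing s t | crossing s (Separation-swap t)
      ... | inj₁ sep       | _              = sep
      ... | inj₂ _         | inj₁ sep       = sep
      ... | inj₂ (inj₁ e₁) | inj₂ (inj₁ e₂) = let i , i∈ = s .nonemptyˡ in
            ⊥-elim ([ (λ u → e₁ (i , x∈p∩q⁺ (i∈ , u))) , (λ u → e₂ (i , x∈p∩q⁺ (i∈ , u))) ]′ (t .cover i))
      ... | inj₂ (inj₁ e₁) | inj₂ (inj₂ e₂) = let i , i∈ = t .nonemptyˡ in
            ⊥-elim ([ (λ u → e₁ (i , x∈p∩q⁺ (u , i∈))) , (λ u → e₂ (i , x∈p∩q⁺ (u , i∈))) ]′ (s .cover i))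
      ... | inj₂ (inj₂ e₁) | inj₂ (inj₁ e₂) = let i , i∈ = t .nonemptyʳ in
            ⊥-elim ([ (λ u → e₂ (i , x∈p∩q⁺ (u , i∈))) , (λ u → e₁ (i , x∈p∩q⁺ (u , i∈))) ]′ (s .cover i))
      ... | inj₂ (inj₂ e₁) | inj₂ (inj₂ e₂) = let i , i∈ = s .nonemptyʳ in
            ⊥-elim ([ (λ u → e₂ (i , x∈p∩q⁺ (i∈ , u))) , (λ u → e₁ (i , x∈p∩q⁺ (i∈ , u))) ]′ (t .cover i))

      -- Contraction shifts the rank by one and adds `signSum n`, which vanishes because n is
      -- positive; the equality `top` supplies matching signs for the deletion.
      β-step : ∀ {m} → n ≡ suc m → β M ≡ β (delete M) ℤ.+ β (contract M nl)
      β-step {m} refl = begin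
        β M                                                                    ≡⟨ β-rankSum M ⟩
        signℤ (r ⊤) ℤ.* rankSum pos M                                          ≡⟨ cong₂ ℤ._*_ (cong signℤ (rank-inside M nl ⊤)) (trans (rankSum-step M nl pos)
                                                                                    (cong (λ z → ℤ.- z ℤ.+ rankSum pos (delete M)) (trans (rankSum-suc (contract M nl)) (cong (ℤ._+ G) (signSum-suc m))))) ⟩
        ℤ.- s ℤ.* (ℤ.- (0ℤ ℤ.+ G) ℤ.+ H)                                       ≡⟨ solve 3 (λ s g h → :- s :* (:- (:0 :+ g) :+ h) := :- s :* h :+ s :* g) refl s G H ⟩
        ℤ.- s ℤ.* H ℤ.+ s ℤ.* G                                                ≡⟨ cong (λ k → signℤ k ℤ.* H ℤ.+ s ℤ.* G) (trans (sym (rank-inside M nl ⊤)) (trans (sym top) (rank-outside M ⊤))) ⟩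
        signℤ (rank (delete M) ⊤) ℤ.* H ℤ.+ s ℤ.* G                            ≡⟨ cong₂ ℤ._+_ (β-rankSum (delete M)) (β-rankSum (contract M nl)) ⟨
        β (delete M) ℤ.+ β (contract M nl)                                     ∎
        where
          open ≡-Reasoning
          s G H : ℤ
          s = signℤ (rank (contract M nl) ⊤)
          G = rankSum pos (contract M nl)
          H = rankSum pos (delete M)

  Degenerate : ∀ {n} → Matroid n → Set
  Degenerate {n} M = n ≡ 0 ⊎ (∃ λ i → indep M ⁅ i ⁆ ≡ false) ⊎ SeparationOf M

  -- The value is exhibited as a natural number so that a zero sum of the values of deletion and
  -- contraction makes both zero. A coloop either is the whole matroid, with value 1, or splits off.
  crapo : ∀ {n} (M : Matroid n) → ∃ λ k → β M ≡ pos k × (k ≡ 0 → Degenerate M)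
  crapo {zero} M = 0 , trans (β-rankSum M) (trans (cong (λ k → signℤ (rank M []) ℤ.* (1ℤ ℤ.* pos k)) (ℕₚ.n≤0⇒n≡0 (Rank.rank≤∣∣ M []))) (ℤₚ.*-zeroʳ (signℤ (rank M [])))) , λ _ → inj₁ refl
  crapo {suc n} M with indep M (inside ∷ ⊥) in nl
  ... | false = 0 , trans (β-rankSum M) (trans (cong (signℤ (rank M ⊤) ℤ.*_) (rankSum-loop M nl pos)) (ℤₚ.*-zeroʳ (signℤ (rank M ⊤)))) , λ _ → inj₂ (inj₁ (zero , nl))
  ... | true with rank M (outside ∷ ⊤) ℕ.≟ rank M (inside ∷ ⊤)
  crapo {suc zero} M | true | no coloop = 1 ,
    trans (β-rankSum M) (cong₂ ℤ._*_ (cong signℤ (trans (Coloop.rank-⊤ M nl coloop) (cong suc (ℕₚ.n≤0⇒n≡0 (Rank.rank≤∣∣ M (outside ∷ [])))))) (Coloop.rankSum-coloop M nl coloop)) , λ ()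
  crapo {suc (suc n)} M | true | no coloop = 0 ,
    trans (β-rankSum M) (trans (cong (signℤ (rank M ⊤) ℤ.*_) (trans (Coloop.rankSum-coloop M nl coloop) (cong ℤ.-_ (signSum-suc n)))) (ℤₚ.*-zeroʳ (signℤ (rank M ⊤)))) ,
    λ _ → inj₂ (inj₂ (inside ∷ ⊥ , outside ∷ ⊤ , record
      { nonemptyˡ = zero , here ; nonemptyʳ = suc zero , there here
      ; disjoint = λ { (there x∈) (there _) → ∉⊥ x∈ }
      ; cover = λ { zero → inj₁ here ; (suc j) → inj₂ (there ∈⊤) }
      ; rank-sum = ℕₚ.≤-trans (ℕₚ.+-monoˡ-≤ (rank M (outside ∷ ⊤)) (rank-zero≤1 M nl)) (ℕₚ.≤-reflexive (sym (Coloop.rank-⊤ M nl coloop))) }))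
  crapo {suc zero} M | true | yes top with () ← trans (sym (rank-inside M nl [])) (trans (sym top) (ℕₚ.n≤0⇒n≡0 (Rank.rank≤∣∣ M (outside ∷ []))))
  crapo {suc (suc n)} M | true | yes top with crapo (delete M) | crapo (contract M nl)
  ... | k₁ , β₁ , z₁ | k₂ , β₂ , z₂ = k₁ + k₂ , trans (β-step M nl top refl) (cong₂ ℤ._+_ β₁ β₂) ,
        λ k≡0 → combine (z₁ (ℕₚ.m+n≡0⇒m≡0 k₁ k≡0)) (z₂ (ℕₚ.m+n≡0⇒n≡0 k₁ k≡0))
    where
      combine : Degenerate (delete M) → Degenerate (contract M nl) → Degenerate M
      combine (inj₂ (inj₁ (i , loop))) _ = inj₂ (inj₁ (suc i , loop))
      combine (inj₂ (inj₂ s)) (inj₂ (inj₂ t)) = inj₂ (inj₂ (tutte M nl top s t))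
      combine (inj₂ (inj₂ (T , T′ , s))) (inj₂ (inj₁ (i , dep))) with indep M (outside ∷ ⁅ i ⁆) in ind
      ... | false = inj₂ (inj₁ (suc i , ind))
      ... | true  = inj₂ (inj₂ ([ (λ i∈T → _ , _ , parallel-separation M nl i dep ind top s i∈T)
                                , (λ i∈T′ → _ , _ , parallel-separation M nl i dep ind top (Separation-swap s) i∈T′) ]′ (s .cover i)))

-- Regular sequences and depth.

module Depth where
  open import Defs hiding (≡ᵇ)
  open import Level using (_⊔_)
  open import Data.Nat using (_≤_; _<_; z≤n; s≤s)
  open import Data.Integer as ℤ using (ℤ; 0ℤ)
  open import Data.Fin.Subset using (⊥; ⊤; _∪_; _∩_; _⊆_; _∈_; _∉_; ⁅_⁆)
  open import Data.Fin.Subset.Properties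
  open import Data.List using (_++_; [_]; length)
  open import Data.List.Properties using (length-++; ++-assoc)
  open import Data.List.Membership.Propositional.Properties using (∈-++⁺ˡ; ∈-++⁺ʳ)
  open import Data.List.Relation.Unary.All as All using (All; []; _∷_)
  import Data.List.Relation.Unary.All.Properties as Allₚ
  import Data.Vec as Vec
  import Data.Vec.Properties as Vecₚ
  open import Data.Empty using () renaming (⊥ to False)
  open import Relation.Nullary.Decidable using (decidable-stable)
  open RingSolver
  open MatroidRank
  open Sums
  open ExteriorAlgebra
  open Bridge
  open OrlikSolomon
  open NBC
  open FreeModule
  open Euler using (doubled⇒β≡0)
  open Crapo

  module _ {n} {M : Matroid n} {X Y} (s : Separation M X Y) where
    open Rank M

    -- Submodularity for (S, X) and for (S ∪ X, Y), added to the rank inequality of the separation,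
    -- gives r(S ∩ X) + r(S ∩ Y) ≤ r(S).
    separation-indep : ∀ S → Indep (S ∩ X) → Indep (S ∩ Y) → Indep S
    separation-indep S ind₁ ind₂ = rank⇒indep (ℕₚ.≤-antisym (rank≤∣∣ S) (begin
      ∣ S ∣                                  ≤⟨ p⊆q⇒∣p∣≤∣q∣ S⊆ ⟩
      ∣ (S ∩ X) ∪ (S ∩ Y) ∣                  ≤⟨ ℕₚ.m≤m+n _ _ ⟩
      ∣ (S ∩ X) ∪ (S ∩ Y) ∣ ℕ.+ ∣ (S ∩ X) ∩ (S ∩ Y) ∣  ≡⟨ ∣∪∣+∣∩∣ (S ∩ X) (S ∩ Y) ⟩
      ∣ S ∩ X ∣ ℕ.+ ∣ S ∩ Y ∣                ≡⟨ ≡.cong₂ ℕ._+_ (indep⇒rank ind₁) (indep⇒rank ind₂) ⟨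
      r (S ∩ X) ℕ.+ r (S ∩ Y)                ≤⟨ ℕₚ.+-cancelˡ-≤ (r (S ∪ X) ℕ.+ r ⊤) _ _ sum ⟩
      r S                                    ∎))
      where
        open ℕₚ.≤-Reasoning
        S⊆ : S ⊆ (S ∩ X) ∪ (S ∩ Y)
        S⊆ {i} i∈ = [ (λ x → p⊆p∪q (S ∩ Y) (x∈p∩q⁺ (i∈ , x))) , (λ y → q⊆p∪q (S ∩ X) (S ∩ Y) (x∈p∩q⁺ (i∈ , y))) ]′ (s .Separation.cover i)
        ⊤⊆ : ⊤ ⊆ (S ∪ X) ∪ Y
        ⊤⊆ {i} _ = [ (λ x → p⊆p∪q Y (q⊆p∪q S X x)) , q⊆p∪q (S ∪ X) Y ]′ (s .Separation.cover i)
        open import Data.Nat.Solver using (module +-*-Solver)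
        open +-*-Solver
        regroup₁ : ∀ a b c d → (b ℕ.+ d) ℕ.+ (a ℕ.+ c) ≡ (a ℕ.+ b) ℕ.+ (c ℕ.+ d)
        regroup₁ = solve 4 (λ a b c d → (b :+ d) :+ (a :+ c) := (a :+ b) :+ (c :+ d)) ≡.refl
        regroup₂ : ∀ s x t y → (s ℕ.+ x) ℕ.+ (t ℕ.+ y) ≡ (s ℕ.+ t) ℕ.+ (x ℕ.+ y)
        regroup₂ = solve 4 (λ s x t y → (s :+ x) :+ (t :+ y) := (s :+ t) :+ (x :+ y)) ≡.refl
        regroup₃ : ∀ s t e → (s ℕ.+ t) ℕ.+ e ≡ (t ℕ.+ e) ℕ.+ s
        regroup₃ = solve 3 (λ s t e → (s :+ t) :+ e := (t :+ e) :+ s) ≡.refl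
        sum : (r (S ∪ X) ℕ.+ r ⊤) ℕ.+ (r (S ∩ X) ℕ.+ r (S ∩ Y)) ≤ (r (S ∪ X) ℕ.+ r ⊤) ℕ.+ r S
        sum = begin
          (r (S ∪ X) ℕ.+ r ⊤) ℕ.+ (r (S ∩ X) ℕ.+ r (S ∩ Y))  ≡⟨ regroup₁ (r (S ∩ X)) (r (S ∪ X)) (r (S ∩ Y)) (r ⊤) ⟩
          (r (S ∩ X) ℕ.+ r (S ∪ X)) ℕ.+ (r (S ∩ Y) ℕ.+ r ⊤)  ≤⟨ ℕₚ.+-mono-≤ (submodular S X (p∩q⊆p S X) (p∩q⊆q S X) id)
                                                                 (submodular (S ∪ X) Y (p⊆p∪q X ∘ p∩q⊆p S Y) (p∩q⊆q S Y) ⊤⊆) ⟩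
          (r S ℕ.+ r X) ℕ.+ (r (S ∪ X) ℕ.+ r Y)              ≡⟨ regroup₂ (r S) (r X) (r (S ∪ X)) (r Y) ⟩
          (r S ℕ.+ r (S ∪ X)) ℕ.+ (r X ℕ.+ r Y)              ≤⟨ ℕₚ.+-monoʳ-≤ _ (s .Separation.rank-sum) ⟩
          (r S ℕ.+ r (S ∪ X)) ℕ.+ r ⊤                        ≡⟨ regroup₃ (r S) (r (S ∪ X)) (r ⊤) ⟩
          (r (S ∪ X) ℕ.+ r ⊤) ℕ.+ r S                        ∎

  module RegularSequences {c ℓ : Level} (K : CommutativeRing c ℓ) where
    open CommutativeRing K hiding (zero)
    open IntegerSolver K
    open Recursive K
    open Summation K using ([_]·)
    open Translation K
    open OS K
    open BrokenCircuits K using (J-⊥)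
    open import Algebra.Properties.Ring ring using (-0#≈0#)

    lin-∧ : ∀ {n} (v : Fin n → Carrier) x → Ext.lin v Ext.∧E x ≋ linear v ∙ x
    lin-∧ v x = ≋-trans (∧E≈∙ (Ext.lin v) x) (∙-cong (lin≈linear v) ≋-refl)

    -- If a contraction D w preserves the ideal and w(v) = 1, it is a contracting homotopy for multiplication by v.
    contraction⇒regular : ∀ {n} (gs : List (E n)) w v → pairing w v ≈ 1# →
      (∀ {x} → Ext.InIdeal gs x → Ext.InIdeal gs (D w x)) → Ext.Regular gs (Ext.lin v)
    contraction⇒regular gs w v wv closed =
      (λ x h → D w x , InIdeal-resp (homotopy x) (closed (InIdeal-resp (lin-∧ v x) h))) ,
      (λ y → InIdeal-resp (≋-sym (square y)) InIdeal-𝟎)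
      where
        open Ideal gs
        homotopy : ∀ x → D w (linear v ∙ x) ≋ x ⊕ ⊖ (Ext.lin v Ext.∧E D w x)
        homotopy x = ≋-trans (D-homotopy w v x) (⊕-cong (pointwise λ U → trans (*-congʳ wv) (*-identityˡ _)) (⊖-cong (≋-sym (lin-∧ v (D w x)))))
        square : ∀ y → Ext.lin v Ext.∧E (Ext.lin v Ext.∧E y) ≋ 𝟎
        square y = ≋-trans (lin-∧ v _) (≋-trans (∙ʳ.cong (linear v) (lin-∧ v y)) (linear-cancel v y))

    nested : ∀ {n} → List (Fin n → Carrier) → E n → E n
    nested []       x = x
    nested (v ∷ vs) x = linear v ∙ nested vs x

    nested-low : ∀ {n} (vs : List (Fin n → Carrier)) x U → ∣ U ∣ < length vs → nested vs x U ≈ 0#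
    nested-low (v ∷ vs) x U lt = trans
      (linear-local v (nested vs x) 𝟎 U λ i V c → *-congˡ (nested-low vs x V (ℕₚ.≤-pred (≡.subst (_< suc (length vs)) (⋖⇒∣∣ c) lt))))
      (∙ʳ.𝟎-homo (linear v) .at U)

    -- If v z lies in the ideal, regularity puts z into the ideal enlarged by v, which the induction
    -- hypothesis for the remaining forms excludes.
    regular-product : ∀ {n} (gs : List (E n)) vs → Ext.RegSeq gs vs → ∃ λ x → ¬ Ext.InIdeal gs (nested vs x)
    regular-product gs []       (x , x∉) = x , x∉
    regular-product gs (v ∷ vs) (reg , rest) with x , ∉ ← regular-product (gs ++ [ Ext.lin v ]) vs rest = x , λ h →
      let y , i = proj₁ reg (nested vs x) (Ideal.InIdeal-resp gs (≋-sym (lin-∧ v _)) h)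
          open Ideal (gs ++ [ Ext.lin v ])
          vy : Ext.InIdeal (gs ++ [ Ext.lin v ]) (𝟏 ∙ (Ext.lin v ∙ y))
          vy = InIdeal-gen (∈-++⁺ʳ gs (here ≡.refl)) 𝟏 y
      in ∉ (InIdeal-resp (pointwise λ U → trans (+-congˡ (trans (∙-identityˡ _ .at U) (sym (∧E≈∙ (Ext.lin v) y .at U)))) (solve 2 (λ a b → (a :+ :- b) :+ b := a) refl (nested vs x U) ((Ext.lin v Ext.∧E y) U)))
           (InIdeal-⊕ (InIdeal-⊆ {gs = gs} {hs = gs ++ [ Ext.lin v ]} ∈-++⁺ˡ i) vy))

    regular-length : ∀ {n} (gs : List (E n)) vs → Ext.RegSeq gs vs → length vs ≤ n
    regular-length {n} gs vs reg = ℕₚ.≮⇒≥ λ n<l → let x , ∉ = regular-product gs vs reg in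
      ∉ (Ideal.InIdeal-resp gs (pointwise λ U → sym (nested-low vs x U (ℕₚ.≤-<-trans (∣p∣≤n U) n<l))) (Ideal.InIdeal-𝟎 gs))

    vanishing-at-⊥ : ∀ {n} {gs : List (E n)} → All (λ g → g ⊥ ≈ 0#) gs → ¬ (1# ≈ 0#) → Ext.NonzeroQuot gs
    vanishing-at-⊥ {n} gs≈0 1≉0 = 𝟏 , λ h → 1≉0 (trans (sym (𝟏-⊥ {n})) (InIdeal-elim
      (record { resp = λ p x≈0 → trans (sym (p .at ⊥)) x≈0 ; 𝟎-closed = refl ; ⊕-closed = λ p q → trans (+-cong p q) (+-identityʳ _) })
      (All.map (λ {g} g≈0 a b → ∙-vanishʳ a (g ∙ b) ⊥ λ V V⊆ → ∙-vanishˡ g b V λ W W⊆ → ≡.subst (λ W → g W ≈ 0#) (≡.sym (⊆-antisym (V⊆ ∘ W⊆) (⊆-min W))) g≈0) gs≈0) h))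
      where
        𝟏-⊥ : ∀ {n} → 𝟏 {n} ⊥ ≈ 1#
        𝟏-⊥ {zero}  = refl
        𝟏-⊥ {suc n} = 𝟏-⊥ {n}

    linear-⊥ : ∀ {n} (v : Fin n → Carrier) → linear v ⊥ ≈ 0#
    linear-⊥ {zero}  v = refl
    linear-⊥ {suc n} v = linear-⊥ (v ∘ suc)

    module _ {n} (M : Matroid n) where
      OSgens-⊥ : Loopless M → All (λ g → g ⊥ ≈ 0#) (Ext.OSgens M)
      OSgens-⊥ loopless = All.tabulate λ {g} g∈ → J-⊥ {M = M} loopless (InIdeal⇒J {M = M} (Ideal.InIdeal-gen₀ (Ext.OSgens M) g∈))

      OS-NonzeroQuot : Loopless M → ¬ (1# ≈ 0#) → ∀ vs → Ext.NonzeroQuot (Ext.OSgens M ++ List.map Ext.lin vs)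
      OS-NonzeroQuot loopless 1≉0 vs = vanishing-at-⊥ (Allₚ.++⁺ (OSgens-⊥ loopless) (Allₚ.map⁺ (All.universal (λ v → trans (lin≈linear v .at ⊥) (linear-⊥ v)) vs))) 1≉0

      OS-closed-∂ : ∀ {x} → Ext.InIdeal (Ext.OSgens M) x → Ext.InIdeal (Ext.OSgens M) (∂ x)
      OS-closed-∂ h = J⇒InIdeal (J-∂ (InIdeal⇒J {M = M} h))

      InSum : (Fin n → Carrier) → E n → Set (c ⊔ ℓ)
      InSum v x = ∃ λ y → J M (x ⊕ ⊖ (linear v ∙ y))

      -- A two-sided multiple a v b of the new generator is the left multiple v σ(a) b.
      InIdeal⇒InSum : ∀ v {x} → Ext.InIdeal (Ext.OSgens M ++ [ Ext.lin v ]) x → InSum v x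
      InIdeal⇒InSum v = InIdeal-elim closed (Allₚ.++⁺
        (All.tabulate λ {g} g∈ a b → 𝟎 , J-resp (pointwise λ U → sym (trans (+-congˡ (trans (-‿cong (∙ʳ.𝟎-homo (linear v) .at U)) -0#≈0#)) (+-identityʳ _)))
          (InIdeal⇒J (Ideal.InIdeal-gen (Ext.OSgens M) g∈ a b)))
        ((λ a b → σ a ∙ b , J-resp (pointwise λ U → sym (trans (+-congʳ (commute a b .at U)) (-‿inverseʳ _))) J-𝟎) ∷ []))
        where
          commute : ∀ a b → a ∙ (Ext.lin v ∙ b) ≋ linear v ∙ (σ a ∙ b)
          commute a b = ≋-trans (∙ʳ.cong a (∙-cong (lin≈linear v) ≋-refl)) (≋-trans (≋-sym (∙-assoc a (linear v) b))
            (≋-trans (∙-cong (≋-trans (∙-cong (≋-sym (σ-involutive a)) ≋-refl) (≋-sym (linear-comm v (σ a)))) ≋-refl) (∙-assoc (linear v) (σ a) b)))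
          closed : Closed (InSum v)
          closed = record
            { resp = λ p (y , j) → y , J-resp (⊕-cong p ≋-refl) j
            ; 𝟎-closed = 𝟎 , J-resp (pointwise λ U → sym (trans (+-identityˡ _) (trans (-‿cong (∙ʳ.𝟎-homo (linear v) .at U)) -0#≈0#))) J-𝟎
            ; ⊕-closed = λ {x} {x′} (y , j) (y′ , j′) → y ⊕ y′ , J-resp (pointwise λ U → trans
                (solve 4 (λ a b c d → (a :+ :- b) :+ (c :+ :- d) := (a :+ c) :+ :- (b :+ d)) refl (x U) ((linear v ∙ y) U) (x′ U) ((linear v ∙ y′) U))
                (+-congˡ (-‿cong (sym (∙ʳ.⊕-homo (linear v) y y′ .at U))))) (J-⊕ j j′) }

      InSum⇒InIdeal : ∀ v {x} → InSum v x → Ext.InIdeal (Ext.OSgens M ++ [ Ext.lin v ]) x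
      InSum⇒InIdeal v {x} (y , j) = InIdeal-resp
        (pointwise λ U → trans (+-congˡ (trans (∙-identityˡ _ .at U) (∙-cong (lin≈linear v) ≋-refl .at U))) (solve 2 (λ a b → (a :+ :- b) :+ b := a) refl (x U) ((linear v ∙ y) U)))
        (InIdeal-⊕ (InIdeal-⊆ {gs = Ext.OSgens M} {hs = Ext.OSgens M ++ [ Ext.lin v ]} ∈-++⁺ˡ (J⇒InIdeal j)) (InIdeal-gen (∈-++⁺ʳ (Ext.OSgens M) (here ≡.refl)) 𝟏 y))
        where open Ideal (Ext.OSgens M ++ [ Ext.lin v ])

      two-regular⇒β≡0 : IsField K → ∀ v₁ v₂ → Ext.Regular (Ext.OSgens M) (Ext.lin v₁) →
        Ext.Regular (Ext.OSgens M ++ [ Ext.lin v₁ ]) (Ext.lin v₂) → β M ≡ 0ℤ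
      two-regular⇒β≡0 isField v₁ v₂ reg₁ reg₂ = decidable-stable (β M ℤ.≟ 0ℤ) λ β≢0 →
        free-dimension regular₁ regular₂ λ basis → β≢0 (doubled⇒β≡0 M basis)
        where
          open FreeOverTwoForms K isField M v₁ v₂
          regular₁ : ∀ x → J M (L ∙ x) → I₁ x
          regular₁ x j = let y , h = proj₁ reg₁ x (Ideal.InIdeal-resp (Ext.OSgens M) (≋-sym (lin-∧ v₁ x)) (J⇒InIdeal j))
            in y , modulo (J-resp (⊕-cong ≋-refl (⊖-cong (lin-∧ v₁ y))) (InIdeal⇒J h))
          regular₂ : ∀ x → I₁ (N ∙ x) → I₂ x
          regular₂ x (y , p) =
            let z , h = proj₁ reg₂ x (Ideal.InIdeal-resp (Ext.OSgens M ++ [ Ext.lin v₁ ]) (≋-sym (lin-∧ v₂ x)) (InSum⇒InIdeal v₁ (y , p ._~_.difference)))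
                y′ , j = InIdeal⇒InSum v₁ h
            in y′ , z , modulo (J-resp (pointwise λ U → trans (+-congʳ (+-congˡ (-‿cong (lin-∧ v₂ z .at U))))
                 (solve 3 (λ x a b → (x :+ :- a) :+ :- b := x :+ :- (b :+ a)) refl (x U) ((N ∙ z) U) ((L ∙ y′) U))) j)

    indicator : ∀ {n} → Subset n → Fin n → Carrier
    indicator Y i = [ Vec.lookup Y i ]· 1#

    indicator-∈ : ∀ {n} {Y : Subset n} {i} → i ∈ Y → indicator Y i ≈ 1#
    indicator-∈ i∈ = reflexive (≡.cong (λ b → [ b ]· 1#) (Vecₚ.[]=⇒lookup i∈))

    indicator-∉ : ∀ {n} {Y : Subset n} {i} → i ∉ Y → indicator Y i ≈ 0#
    indicator-∉ {Y = Y} {i} i∉ with Vec.lookup Y i in eq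
    ... | true  = contradiction (Vecₚ.lookup⇒[]= i Y eq) i∉
    ... | false = refl

    D-+ : ∀ {n} (w u v : Fin n → Carrier) → (∀ i → w i ≈ u i + v i) → ∀ x → D w x ≋ D u x ⊕ D v x
    D-+ {zero}  w u v p x = base (sym (+-identityʳ _))
    D-+ {suc n} w u v p x = split
      (pointwise λ U → trans (+-cong (*-congʳ (p zero)) (D-+ _ _ _ (p ∘ suc) (lo x) .at U))
        (solve 5 (λ u v h a b → (u :+ v) :* h :+ (a :+ b) := (u :* h :+ a) :+ (v :* h :+ b)) refl _ _ _ _ _))
      (pointwise λ U → trans (-‿cong (D-+ _ _ _ (p ∘ suc) (hi x) .at U)) (solve 2 (λ a b → :- (a :+ b) := :- a :+ :- b) refl _ _))

    D-weighted-vanish : ∀ {n} w (x : E n) U → (∀ i V → U ⋖[ i ] V → w i * x V ≈ 0#) → D w x U ≈ 0#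
    D-weighted-vanish w x []            p = refl
    D-weighted-vanish w x (outside ∷ U) p = trans (+-cong (p _ _ here) (D-weighted-vanish _ (lo x) U (λ i V c → p _ _ (there outside c)))) (+-identityʳ _)
    D-weighted-vanish w x (inside ∷ U)  p = trans (-‿cong (D-weighted-vanish _ (hi x) U (λ i V c → p _ _ (there inside c)))) -0#≈0#

    module _ {n} {M : Matroid n} {X Y} (s : Separation M X Y) where
      private
        module S = Separation s

        ∂-split : ∀ x → ∂ x ≋ D (indicator X) x ⊕ D (indicator Y) x
        ∂-split = D-+ ones (indicator X) (indicator Y) λ i → one i (S.cover i)
          where
            one : ∀ i → i ∈ X ⊎ i ∈ Y → 1# ≈ indicator X i + indicator Y i
            one i (inj₁ x) = sym (trans (+-cong (indicator-∈ x) (indicator-∉ (S.disjoint x))) (+-identityʳ _))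
            one i (inj₂ y) = sym (trans (+-cong (indicator-∉ λ x → S.disjoint x y) (indicator-∈ y)) (+-identityˡ _))

        restrict⊆ : ∀ {U V i} {Z : Subset n} → U ⋖[ i ] V → i ∉ Z → V ∩ Z ⊆ U
        restrict⊆ {U} {V} {i} {Z} c i∉ j∈ with x∈p∩q⁻ V Z j∈
        ... | j∈V , j∈Z with x∈p∪q⁻ U ⁅ i ⁆ (⋖⇒⊆∪ c j∈V)
        ...   | inj₁ j∈U = j∈U
        ...   | inj₂ j∈i = contradiction (≡.subst (_∈ Z) (x∈⁅y⁆⇒x≡y i j∈i) j∈Z) i∉

        indepX : Subset n → Bool
        indepX U = indep M (U ∩ X)

        weighted : ∀ {Z : Subset n} {i a} → (i ∈ Z → a ≈ 0#) → i ∈ Z ⊎ i ∉ Z → indicator Z i * a ≈ 0#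
        weighted p (inj₁ i∈) = trans (*-congˡ (p i∈)) (zeroʳ _)
        weighted p (inj₂ i∉) = trans (*-congʳ (indicator-∉ i∉)) (zeroˡ _)

        ∈X? : ∀ i → i ∈ X ⊎ i ∉ X
        ∈X? i = [ inj₁ , (λ y → inj₂ λ x → S.disjoint x y) ]′ (S.cover i)
        ∈Y? : ∀ i → i ∈ Y ⊎ i ∉ Y
        ∈Y? i = [ (λ x → inj₂ (S.disjoint x)) , inj₁ ]′ (S.cover i)

        dep-X : ∀ p → Dep M p → Dep M (D (indicator Y) (π (not ∘ indepX) p))
        dep-X p dp U indU = D-weighted-vanish (indicator Y) (π (not ∘ indepX) p) U λ i V c → weighted (λ i∈Y → vanish V
          (indep-down M U (V ∩ X) (restrict⊆ c λ i∈X → S.disjoint i∈X i∈Y) indU)) (∈Y? i)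
          where
            vanish : ∀ V → indep M (V ∩ X) ≡ true → π (not ∘ indepX) p V ≈ 0#
            vanish V ind rewrite ind = refl

        dep-Y : ∀ p → Dep M p → Dep M (D (indicator X) (π indepX p))
        dep-Y p dp U indU = D-weighted-vanish (indicator X) (π indepX p) U λ i V c → weighted (λ i∈X → vanish V
          (indep-down M U (V ∩ Y) (restrict⊆ c (S.disjoint i∈X)) indU)) (∈X? i)
          where
            vanish : ∀ V → indep M (V ∩ Y) ≡ true → π indepX p V ≈ 0#
            vanish V indY with indep M (V ∩ X) in indX
            ... | false = refl
            ... | true  = dp V (separation-indep s V indX indY)

        -- Split p by whether the X-part of a monomial is dependent. If it is, removing elements of
        -- Y keeps the monomial dependent. Otherwise its Y-part is dependent, removing elements of X
        -- is harmless, and the contraction by Y is ∂ minus the contraction by X.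
        J-D-Dep : ∀ p → Dep M p → J M (D (indicator Y) p)
        J-D-Dep p dp = J-resp (≋-sym (≋-trans (D.cong _ decompose) (≋-trans (D.⊕-homo _ p₁ p₂) (⊕-cong ≋-refl rewrite-p₂))))
          (J-⊕ (J-Dep (dep-X p dp)) (J-⊕ (J-∂Dep λ U i → π-vanish indepX p U (dp U i)) (J-⊖ (J-Dep (dep-Y p dp)))))
          where
            p₁ p₂ : E n
            p₁ = π (not ∘ indepX) p
            p₂ = π indepX p
            decompose : p ≋ p₁ ⊕ p₂
            decompose .at U with indepX U
            ... | true  = sym (+-identityˡ _)
            ... | false = sym (+-identityʳ _)
            rewrite-p₂ : D (indicator Y) p₂ ≋ ∂ p₂ ⊕ ⊖ D (indicator X) p₂
            rewrite-p₂ .at U = sym (trans (+-congʳ (∂-split p₂ .at U)) (solve 2 (λ a b → (a :+ b) :+ :- a := b) refl _ _))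

      -- Boundaries reduce to the dependent case because contractions anticommute and J is stable
      -- under ∂.
      J-D : ∀ {x} → J M x → J M (D (indicator Y) x)
      J-D (in-J {p} {q} dp dq eq) = J-resp
        (≋-sym (≋-trans (D.cong _ eq) (≋-trans (D.⊕-homo _ p (∂ q)) (⊕-cong ≋-refl (D-anticomm _ ones q)))))
        (J-⊕ (J-D-Dep p dp) (J-⊖ (J-∂ (J-D-Dep q dq))))

      separation-regular : Loopless M → ¬ (1# ≈ 0#) → ∃ λ v₁ → ∃ λ v₂ → Ext.RegSeq (Ext.OSgens M) (v₁ ∷ v₂ ∷ [])
      separation-regular loopless 1≉0 with i , i∈X ← S.nonemptyˡ | j , j∈Y ← S.nonemptyʳ = δ i , δ j ,
        contraction⇒regular (Ext.OSgens M) ones (δ i) (pairing-δ ones i) (OS-closed-∂ M) ,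
        contraction⇒regular (Ext.OSgens M ++ [ Ext.lin (δ i) ]) (indicator Y) (δ j) (trans (pairing-δ (indicator Y) j) (indicator-∈ j∈Y)) closed ,
        ≡.subst Ext.NonzeroQuot (≡.sym (++-assoc (Ext.OSgens M) _ _)) (OS-NonzeroQuot M loopless 1≉0 (δ i ∷ δ j ∷ []))
        where
          -- As i is not in Y, the contraction kills e_i and anticommutes with multiplication by it,
          -- so it also preserves the ideal enlarged by e_i.
          closed : ∀ {x} → Ext.InIdeal (Ext.OSgens M ++ [ Ext.lin (δ i) ]) x → Ext.InIdeal (Ext.OSgens M ++ [ Ext.lin (δ i) ]) (D (indicator Y) x)
          closed {x} h = let y , j = InIdeal⇒InSum M (δ i) h in InSum⇒InIdeal M (δ i) (⊖ D (indicator Y) y , J-resp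
            (≋-trans (D.⊕-homo _ x (⊖ (linear (δ i) ∙ y))) (⊕-cong ≋-refl (≋-trans (D.⊖-homo _ (linear (δ i) ∙ y)) (⊖-cong
              (≋-trans (D-homotopy _ (δ i) y) (pointwise λ U → trans
                (+-congʳ (trans (*-congʳ (trans (pairing-δ (indicator Y) i) (indicator-∉ (S.disjoint i∈X)))) (zeroˡ _)))
                (trans (+-identityˡ _) (sym (∙ʳ.⊖-homo (linear (δ i)) (D (indicator Y) y) .at U)))))))))
            (J-D j))

    module _ (isField : IsField K) {n} (M : Matroid n) (loopless : Loopless M) where
      private
        gs : List (E n)
        gs = Ext.OSgens M
        1≉0 : ¬ (1# ≈ 0#)
        1≉0 p = proj₁ isField (sym p)

      depth-one⇒β≢0 : Ext.DepthQuot gs 1 → β M ≢ 0ℤ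
      depth-one⇒β≢0 ((vs , (reg , _) , len) , unique) β≡0 with k , β≡k , degenerate ← crapo M
        with degenerate (ℤₚ.+-injective (≡.trans (≡.sym β≡k) β≡0))
      ... | inj₁ ≡.refl = contradiction (≡.subst (_≤ 0) len (regular-length gs vs reg)) λ ()
      ... | inj₂ (inj₁ (i , loop)) = contradiction (≡.trans (≡.sym (loopless i)) loop) λ ()
      ... | inj₂ (inj₂ (X , Y , s)) = let v₁ , v₂ , reg′ = separation-regular s loopless 1≉0 in
            extend-regular n (v₁ ∷ v₂ ∷ []) (s≤s (s≤s z≤n)) (ℕₚ.n≤1+n _) reg′
        where
          -- Instead of constructing a maximal extension, every sequence of length at least 2 is
          -- refuted: its extensions are refuted by recursion, so it would be maximal and of length
          -- 1. The fuel runs out once the length exceeds n.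
          extend-regular : ∀ fuel vs → 2 ≤ length vs → n < length vs ℕ.+ fuel → Ext.RegSeq gs vs → False
          extend-regular zero vs 2≤ n< reg = ℕₚ.<⇒≱ (≡.subst (n <_) (ℕₚ.+-identityʳ _) n<) (regular-length gs vs reg)
          extend-regular (suc fuel) vs 2≤ n< reg = ℕₚ.<⇒≢ 2≤ (≡.sym (unique vs (reg , λ v reg′ →
            extend-regular fuel (vs ++ [ v ]) (≡.subst (2 ≤_) (≡.sym (snoc v)) (ℕₚ.m≤n⇒m≤1+n 2≤))
              (≡.subst (n <_) (≡.trans (ℕₚ.+-suc _ _) (≡.cong (ℕ._+ fuel) (≡.sym (snoc v)))) n<) reg′)))
            where
              snoc : ∀ v → length (vs ++ [ v ]) ≡ suc (length vs)
              snoc v = ≡.trans (length-++ vs) (ℕₚ.+-comm (length vs) 1)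

    β≢0⇒depth-one : IsField K → ∀ {n} (M : Matroid n) → Loopless M → β M ≢ 0ℤ → Ext.DepthQuot (Ext.OSgens M) 1
    -- The empty matroid has beta-invariant 0, so there is always an element 0 to start the sequence
    -- with.
    β≢0⇒depth-one isField {zero}  M loopless β≢0 = contradiction (proj₁ (proj₂ (crapo M))) β≢0
    β≢0⇒depth-one isField {suc n} M loopless β≢0 =
      (δ zero ∷ [] , (single , λ v → no-pair (δ zero) v []) , ≡.refl) , unique
      where
        no-pair : ∀ v₁ v₂ vs → ¬ Ext.RegSeq (Ext.OSgens M) (v₁ ∷ v₂ ∷ vs)
        no-pair v₁ v₂ vs (reg₁ , reg₂ , _) = β≢0 (two-regular⇒β≡0 M isField v₁ v₂ reg₁ reg₂)
        single : Ext.RegSeq (Ext.OSgens M) (δ zero ∷ [])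
        single = contraction⇒regular (Ext.OSgens M) ones (δ zero) (pairing-δ {suc n} ones zero) (OS-closed-∂ M) ,
                 OS-NonzeroQuot M loopless (λ p → proj₁ isField (sym p)) (δ zero ∷ [])
        unique : ∀ vs → Ext.MaximalRegSeq (Ext.OSgens M) vs → length vs ≡ 1
        unique []             (_ , max)  = contradiction single (max (δ zero))
        unique (v ∷ [])       _          = ≡.refl
        unique (v₁ ∷ v₂ ∷ vs) (reg , _)  = contradiction reg (no-pair v₁ v₂ vs)

open import Defs
open import Data.Integer using (ℤ; +_)
open import Function.Bundles using (_⇔_; mk⇔)

theorem6p4 : ∀ {c ℓ : Level} (K : CommutativeRing c ℓ) → IsField K → Infinite K →
    (n : ℕ) (M : Matroid n) → Loopless M →
    (Exterior.DepthQuot K n (Exterior.OSgens K n M) 1 ⇔ (β M ≢ + 0))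
theorem6p4 K isField _ n M loopless = mk⇔ (depth-one⇒β≢0 isField M loopless) (β≢0⇒depth-one isField M loopless)
  where open Depth.RegularSequences K
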